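{- There exist $\beta>0$ and $n_2\in\mathbb N$ such that the following holds. Let $n>n_2$ be an even integer and let $\mathcal H$ be a 3-uniform hypergraph on $n$ vertices with \[ \delta_1(\mathcal H)\ge \binom{n-1}{2}-\binom{\lfloor \frac34 n\rfloor}{2}+c, \] where $c=2$ if $n$ is divisible by $4$ and $c=1$ otherwise. If $\mathcal H$ is $\beta$-extremal, then $\mathcal H$ contains a loose Hamilton cycle.
   Context: For a 3-graph $\mathcal H$, $\delta_1(\mathcal H)$ is the minimum over vertices $v$ of the number of edges containing $v$. For $\beta>0$, a 3-graph $\mathcal H$ on $n$ vertices is $\beta$-extremal if there is a set $B\subseteq V(\mathcal H)$ with $|B|=\lfloor 3n/4\rfloor$ and $e(B)\le \beta n^3$, where $e(B)$ is the number of edges of $\mathcal H$ contained in $B$. A loose Hamilton cycle is a spanning subhypergraph whose vertices can be ordered cyclically so that each edge consists of $3$ consecutive vertices and every two consecutive edges share exactly one vertex. -}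

module Defs where

open import Data.Nat using (ℕ; zero; suc; _+_; _*_; _∸_; _≤_; _<_; NonZero)
open import Data.Nat.DivMod using (_/_; _%_; _mod_)
open import Data.Nat.Divisibility using (_∣_)
open import Data.Nat.Combinatorics using (_C_)
open import Data.Bool using (Bool; true; false; _∧_; T)
open import Data.Fin using (Fin)
open import Data.Fin.Subset using (Subset; _∪_; ⁅_⁆; ∣_∣; _⊆_; _∈_; inside; outside)
open import Data.Fin.Subset.Properties using (_⊆?_; _∈?_)
open import Data.Fin.Permutation using (Permutation′; _⟨$⟩ʳ_)
open import Data.List using (List; []; _∷_; map; _++_; length; filter)
open import Data.Vec using (_∷_; [])
open import Data.Product using (Σ; _×_; _,_)
open import Relation.Nullary using (Dec; yes; no)
open import Relation.Binary.PropositionalEquality using (_≡_)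

record Hypergraph3 (n : ℕ) : Set where
  field
    edge    : Subset n → Bool
    uniform : ∀ s → T (edge s) → ∣ s ∣ ≡ 3
open Hypergraph3 public

allSubsets : (n : ℕ) → List (Subset n)
allSubsets zero    = [] ∷ []
allSubsets (suc n) = map (outside ∷_) (allSubsets n) ++ map (inside ∷_) (allSubsets n)

edges : ∀ {n} → Hypergraph3 n → List (Subset n)
edges {n} H = filter (λ s → T? (edge H s)) (allSubsets n)
  where
  T? : (b : Bool) → Dec (T b)
  T? true  = yes _
  T? false = no (λ ())

degree : ∀ {n} → Hypergraph3 n → Fin n → ℕ
degree H v = length (filter (v ∈?_) (edges H))

MinDegreeAtLeast : ∀ {n} → Hypergraph3 n → ℕ → Set
MinDegreeAtLeast {n} H d = ∀ (v : Fin n) → d ≤ degree H v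

edgesIn : ∀ {n} → Hypergraph3 n → Subset n → ℕ
edgesIn H B = length (filter (_⊆? B) (edges H))

-- H is β-extremal with β = p / q (p, q > 0):
-- ∃ B with |B| = ⌊3n/4⌋ and e(B) ≤ (p/q) n³, i.e. q·e(B) ≤ p·n³.
Extremal : ∀ {n} → (p q : ℕ) → Hypergraph3 n → Set
Extremal {n} p q H =
  Σ (Subset n) λ B → (∣ B ∣ ≡ (3 * n) / 4) × (q * edgesIn H B ≤ p * (n * n * n))

triple : ∀ {n} → Fin n → Fin n → Fin n → Subset n
triple a b c = ⁅ a ⁆ ∪ ⁅ b ⁆ ∪ ⁅ c ⁆

-- Loose Hamilton cycle: n even (n ≠ 0) and a cyclic ordering of all vertices
-- σ(0), …, σ(n-1) (a permutation) such that for every i < n/2 the set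
-- {σ(2i), σ(2i+1), σ(2i+2 mod n)} is an edge. Consecutive edges then share
-- exactly one vertex, and the n/2 edges cover every vertex.
LooseHamiltonCycle : ∀ {n} → Hypergraph3 n → Set
LooseHamiltonCycle {n} H =
  Σ (NonZero n) λ nz → (2 ∣ n) × Σ (Permutation′ n) λ σ →
    ∀ (i : ℕ) → i < n / 2 →
      T (edge H (triple (σ ⟨$⟩ʳ ((2 * i) mod n) {{nz}})
                        (σ ⟨$⟩ʳ ((2 * i + 1) mod n) {{nz}})
                        (σ ⟨$⟩ʳ ((2 * i + 2) mod n) {{nz}})))

cConst : ℕ → ℕ
cConst n with n % 4
... | zero  = 2
... | suc _ = 1

threshold : ℕ → ℕ
threshold n = ((n ∸ 1) C 2) ∸ (((3 * n) / 4) C 2) + cConst n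

{-# OPTIONS --safe #-}

-- Let B₀ be the nearly independent set. A vertex is put into B if few pairs of B₀ complete it to an
-- edge, and into A otherwise. By the degree condition a vertex of B forms an edge with almost every pair
-- meeting A, and all but few vertices of A form an edge with almost every pair inside B; the remaining,
-- exceptional vertices of A still have many edges to B.
--
-- A cycle in which every other link vertex lies in A and all other vertices in B has |B| = 3|A|. If A is
-- smaller, the degree condition inside B yields the right number of loose edges inside B; if it is
-- larger, edges whose middle vertex is in A use up the surplus. These edges, and paths through each
-- exceptional vertex, are chosen greedily as disjoint segments with both ends in B. The remaining
-- vertices are placed arbitrarily between the segments, and every slot that is not an edge is then
-- repaired by exchanges: the number of bad exchanges is smaller than the number of all exchanges.

module Submission where

open import Defs
open import Data.Bool using (Bool; true; false; not; T; _∨_)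
open import Data.Fin using (Fin; zero; suc; toℕ; fromℕ<)
open import Data.Fin.Patterns using (0F; 1F; 2F; 3F; 4F; 5F; 6F; 7F; 8F; 9F)
open import Data.Fin.Permutation using (Permutation′; _⟨$⟩ʳ_; _∘ₚ_; transpose; permutation)
  renaming (id to idₚ)
import Data.Fin.Properties as F
open import Data.Fin.Subset using (Subset; _∪_; ⁅_⁆; ∣_∣; _⊆_; _∈_; outside)
open import Data.Fin.Subset.Properties
  using (_⊆?_; _∈?_; ∪-comm; ∪-assoc; x∈p∪q⁻; x∈⁅y⁆⇒x≡y)
open import Data.List using (List; []; _∷_; _++_; length; map; filter; lookup; take; drop)
open import Data.List.Properties using (length-++; take++drop≡id; length-take; length-drop)
open import Data.Nat
open import Data.Nat.Combinatorics using (_C_; nC1≡n; nCk+nC[k+1]≡[n+1]C[k+1])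
open import Data.Nat.DivMod
open import Data.Nat.Divisibility using (_∣_; divides)
open import Data.Nat.Properties
open import Data.Nat.Tactic.RingSolver using (solve-∀)
open import Data.Product using (Σ; ∃; _×_; _,_; proj₁; proj₂)
open import Data.Sum using (_⊎_; inj₁; inj₂)
import Data.Vec as V
open import Data.Vec using ([]; _∷_)
open import Data.Vec.Properties using (lookup-zipWith; lookup⇒[]=; []=⇒lookup)
open import Function using (_∘_)
open import Relation.Binary.PropositionalEquality
open import Relation.Nullary using (Dec; yes; no; does; contradiction)
open import Relation.Nullary.Decidable using (dec-true; dec-false)
open import Relation.Unary using (Decidable)
import Algebra.Properties.Semiring.Sum +-*-semiring as Lib

-- The degree bounds control a vertex only on average: a particular pair of vertices may lie in no
-- edge, and a vertex of A outside `Core` may miss most pairs inside B. So the exceptional vertices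
-- must be placed before the exchanges begin, and the exchanges have to preserve a condition on
-- pairs, not only the slots already filled. Every choice is a union bound over ordered pairs.
--
-- The exact constant c matters only if |B| exceeds its target by one. Then each vertex of B is
-- known to lie in just c edges inside B, and from this alone one edge, or two edges sharing at most
-- one vertex if 4 divides n, must be found. For larger |B| the degrees inside B are of order n.
--
-- All errors are measured by one scale w, about n / 200000: at most w vertices are misplaced, θ =
-- 30wn separates A from B, and the segments use at most 12w vertices. At most 33wn pairs are
-- missing at a vertex; h = 3000w is large enough for 33wn to be at most h * h and small enough for
-- 13h to stay below the number of blocks, which is almost n / 4.

-- Sums over Fin and multiplicities

-- Linear arithmetic by certificate: L ≤ R is a combination of the hypotheses and s the slack; both
-- sides are moved so that no subtraction occurs and the equation is a semiring identity.
linear : ∀ {a b L R} s → L ≤ R → a + R + s ≡ b + L → a ≤ b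
linear {a} {b} {L} {R} s L≤R eq = +-cancelʳ-≤ R a b
  (≤-trans (m≤m+n (a + R) s) (≤-trans (≤-reflexive eq) (+-monoʳ-≤ b L≤R)))

bit : ∀ {x} → x ≤ 1 → x ≡ 0 ⊎ x ≡ 1
bit {zero} _ = inj₁ refl
bit {suc zero} _ = inj₂ refl
bit {suc (suc _)} (s≤s ())

*-bit : ∀ {x y} → x ≤ 1 → y ≤ 1 → x * y ≤ 1
*-bit p q = *-mono-≤ p q

bit*≤ : ∀ {x} y → x ≤ 1 → x * y ≤ y
bit*≤ y p = ≤-trans (*-monoˡ-≤ y p) (≤-reflexive (*-identityˡ y))

*bit≤ : ∀ x {y} → y ≤ 1 → x * y ≤ x
*bit≤ x p = ≤-trans (*-monoʳ-≤ x p) (≤-reflexive (*-identityʳ x))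

pos-bit : ∀ {x} → x ≤ 1 → 0 < x → x ≡ 1
pos-bit p q = ≤-antisym p q

pos-* : ∀ x {y} → 0 < x * y → 0 < x × 0 < y
pos-* (suc x) {suc y} p = s≤s z≤n , s≤s z≤n
pos-* (suc x) {zero} p rewrite *-zeroʳ x = contradiction p λ ()

ι : Bool → ℕ
ι true  = 1
ι false = 0

ι≤1 : ∀ b → ι b ≤ 1
ι≤1 true  = s≤s z≤n
ι≤1 false = z≤n

ι⇒T : ∀ b → ι b ≡ 1 → T b
ι⇒T true _ = _

T⇒ι : ∀ b → T b → ι b ≡ 1
T⇒ι true _ = refl

leq : ℕ → ℕ → ℕ
leq x y = ι (x ≤ᵇ y)

leq-true : ∀ {x y} → leq x y ≡ 1 → x ≤ y
leq-true {x} {y} eq = ≤ᵇ⇒≤ x y (ι⇒T (x ≤ᵇ y) eq)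

leq-false : ∀ {x y} → leq x y ≡ 0 → y < x
leq-false {x} {y} eq = ≰⇒> λ x≤y → contradiction (trans (sym (T⇒ι (x ≤ᵇ y) (≤⇒≤ᵇ x≤y))) eq) λ ()

-- Summed over a family, this bounds the number of entries exceeding `h`; multiplying by `h` avoids
-- a division.
markov : ∀ h x → leq (suc h) x * h ≤ x
markov h x with bit (ι≤1 (suc h ≤ᵇ x))
... | inj₁ eq rewrite eq = z≤n
... | inj₂ eq rewrite eq = ≤-trans (≤-reflexive (*-identityˡ h)) (<⇒≤ (leq-true {suc h} {x} eq))

-- The library's sum is an alias of foldr; hiding this lets the summand be inferred.
opaque
  sum : ∀ {n} → (Fin n → ℕ) → ℕ
  sum = Lib.sum

  sum-empty : (f : Fin 0 → ℕ) → sum f ≡ 0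
  sum-empty f = refl

  sum-suc : ∀ {n} (f : Fin (suc n) → ℕ) → sum f ≡ f zero + sum (f ∘ suc)
  sum-suc f = refl

  sum-cong-≗ : ∀ {n} {f g : Fin n → ℕ} → (∀ i → f i ≡ g i) → sum f ≡ sum g
  sum-cong-≗ = Lib.sum-cong-≗

  sum-+ : ∀ {n} {f g : Fin n → ℕ} → sum (λ i → f i + g i) ≡ sum f + sum g
  sum-+ {f = f} {g} = Lib.∑-distrib-+ f g

  ∑-comm : ∀ {m n} (f : Fin m → Fin n → ℕ) → sum (λ i → sum (f i)) ≡ sum λ j → sum λ i → f i j
  ∑-comm = Lib.∑-comm

  sum-permute : ∀ {n} (f : Fin n → ℕ) (π : Permutation′ n) → sum (λ i → f (π ⟨$⟩ʳ i)) ≡ sum f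
  sum-permute f π = sym (Lib.sum-permute f π)

  sum-*ˡ : ∀ {n} c (f : Fin n → ℕ) → sum (λ i → c * f i) ≡ c * sum f
  sum-*ˡ c f = sym (Lib.*-distribˡ-sum c f)

  sum-*ʳ : ∀ {n} c (f : Fin n → ℕ) → sum (λ i → f i * c) ≡ sum f * c
  sum-*ʳ c f = sym (Lib.*-distribʳ-sum c f)

  sum-mono : ∀ {n} {f g : Fin n → ℕ} → (∀ i → f i ≤ g i) → sum f ≤ sum g
  sum-mono {zero}  f≤g = z≤n
  sum-mono {suc n} f≤g = +-mono-≤ (f≤g zero) (sum-mono (f≤g ∘ suc))

  sum-const : ∀ n c → sum {n} (λ _ → c) ≡ n * c
  sum-const zero    c = refl
  sum-const (suc n) c = cong (c +_) (sum-const n c)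

  term≤sum : ∀ {n} (f : Fin n → ℕ) i → f i ≤ sum f
  term≤sum f zero    = m≤m+n _ _
  term≤sum f (suc i) = ≤-trans (term≤sum (f ∘ suc) i) (m≤n+m _ (f zero))

  sum<⇒∃< : ∀ {n} {f g : Fin n → ℕ} → sum f < sum g → ∃ λ i → f i < g i
  sum<⇒∃< {suc n} {f} {g} p with f zero <? g zero
  ... | yes q = zero , q
  ... | no ¬q with sum<⇒∃< {f = f ∘ suc} {g ∘ suc}
        (+-cancelˡ-< (f zero) _ _ (≤-trans p (+-monoˡ-≤ _ (≮⇒≥ ¬q))))
  ...   | i , r = suc i , r

  sum-δ : ∀ {n} (x : Fin n) (g : Fin n → ℕ) → sum (λ v → ι (does (x F.≟ v)) * g v) ≡ g x
  sum-δ {suc n} zero g = trans (cong₂ _+_ (*-identityˡ (g zero)) (trans (sum-const n 0) (*-zeroʳ n))) (+-identityʳ (g zero))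
  sum-δ {suc n} (suc x) g = sum-δ x (g ∘ suc)

sum≤ : ∀ {n} {f : Fin n → ℕ} c → (∀ i → f i ≤ c) → sum f ≤ n * c
sum≤ {n} c f≤c = ≤-trans (sum-mono f≤c) (≤-reflexive (sum-const n c))

opaque
  sum-pos : ∀ {n} {f : Fin n → ℕ} → 0 < sum f → ∃ λ i → 0 < f i
  sum-pos {n} {f} p = sum<⇒∃< (subst (_< sum f) (sym (trans (sum-const n 0) (*-zeroʳ n))) p)

sum-zero : ∀ {n} {f : Fin n → ℕ} → sum f ≡ 0 → ∀ i → f i ≡ 0
sum-zero {f = f} p i = n≤0⇒n≡0 (≤-trans (term≤sum f i) (≤-reflexive p))

opaque
  sum<⇒∃0 : ∀ {n} {f : Fin n → ℕ} → sum f < n → ∃ λ i → f i ≡ 0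
  sum<⇒∃0 {n} {f} p with sum<⇒∃< {f = f} {λ _ → 1} (subst (sum f <_) (sym (trans (sum-const n 1) (*-identityʳ n))) p)
  ... | i , s≤s q = i , n≤0⇒n≡0 q

sum₂ : ∀ {m n} → (Fin m → Fin n → ℕ) → ℕ
sum₂ f = sum λ i → sum (f i)

sum₂-mono : ∀ {m n} {f g : Fin m → Fin n → ℕ} → (∀ i j → f i j ≤ g i j) → sum₂ f ≤ sum₂ g
sum₂-mono p = sum-mono λ i → sum-mono (p i)

sum₂-cong : ∀ {m n} {f g : Fin m → Fin n → ℕ} → (∀ i j → f i j ≡ g i j) → sum₂ f ≡ sum₂ g
sum₂-cong p = sum-cong-≗ λ i → sum-cong-≗ (p i)

sum₂-+ : ∀ {m n} {f g : Fin m → Fin n → ℕ} → sum₂ (λ i j → f i j + g i j) ≡ sum₂ f + sum₂ g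
sum₂-+ {f = f} {g} = trans (sum-cong-≗ λ i → sum-+) sum-+

sum₂-*ˡ : ∀ {m n} c (f : Fin m → Fin n → ℕ) → sum₂ (λ i j → c * f i j) ≡ c * sum₂ f
sum₂-*ˡ c f = trans (sum-cong-≗ λ i → sum-*ˡ c (f i)) (sum-*ˡ c _)

sum₂-const : ∀ m n c → sum₂ {m} {n} (λ _ _ → c) ≡ m * (n * c)
sum₂-const m n c = trans (sum-cong-≗ λ _ → sum-const n c) (sum-const m (n * c))

sum₂-product : ∀ {m n} (f : Fin m → ℕ) (g : Fin n → ℕ) → sum₂ (λ i j → f i * g j) ≡ sum f * sum g
sum₂-product f g = trans (sum-cong-≗ λ i → sum-*ˡ (f i) g) (sum-*ʳ (sum g) f)

opaque
  sum₂<⇒∃0 : ∀ {m n} {f : Fin m → Fin n → ℕ} → sum₂ f < m * n → ∃ λ i → ∃ λ j → f i j ≡ 0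
  sum₂<⇒∃0 {m} {n} {f} p with sum<⇒∃< (subst (sum₂ f <_) (sym (sum-const m n)) p)
  ... | i , q with sum<⇒∃0 q
  ...   | j , r = i , j , r

  sum₂-pos : ∀ {m n} {f : Fin m → Fin n → ℕ} → 0 < sum₂ f → ∃ λ i → ∃ λ j → 0 < f i j
  sum₂-pos p with sum-pos p
  ... | i , q with sum-pos q
  ...   | j , r = i , j , r

δ : ∀ {n} → Fin n → Fin n → ℕ
δ x v = ι (does (x F.≟ v))

δ-refl : ∀ {n} (x : Fin n) → δ x x ≡ 1
δ-refl x = cong ι (dec-true (x F.≟ x) refl)

δ-≢ : ∀ {n} {x v : Fin n} → x ≢ v → δ x v ≡ 0
δ-≢ {x = x} {v} x≢v = cong ι (dec-false (x F.≟ v) x≢v)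

δ-≡ : ∀ {n} {x v : Fin n} → 0 < δ x v → x ≡ v
δ-≡ {x = x} {v} p with x F.≟ v
... | yes x≡v = x≡v
... | no  _   = contradiction p λ ()

sum-δ₁ : ∀ {n} (x : Fin n) → sum (δ x) ≡ 1
sum-δ₁ x = trans (sum-cong-≗ λ v → sym (*-identityʳ (δ x v))) (sum-δ x (λ _ → 1))

opaque
  split-off : ∀ {n} {f : Fin n → ℕ} x → 0 < f x →
    ∃ λ r → (∀ v → f v ≡ δ x v + r v) × sum f ≡ suc (sum r)
  split-off {n} {f} x p = r , split , trans (sum-cong-≗ split) (trans sum-+ (cong (_+ sum r) (sum-δ₁ x)))
    where
    r : Fin n → ℕ
    r v = f v ∸ δ x v
    δ≤f : ∀ v → δ x v ≤ f v
    δ≤f v with x F.≟ v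
    ... | yes refl = p
    ... | no  _    = z≤n
    split : ∀ v → f v ≡ δ x v + r v
    split v = sym (m+[n∸m]≡n (δ≤f v))

take-out : ∀ {n} {f : Fin n → ℕ} x → f x ≡ 1 →
  ∃ λ r → (∀ v → f v ≡ δ x v + r v) × sum f ≡ suc (sum r)
take-out x p = split-off x (≤-reflexive (sym p))

rest-at : ∀ {n} {f r : Fin n → ℕ} {x y} → (∀ v → f v ≡ δ x v + r v) → x ≢ y → f y ≡ 1 → r y ≡ 1
rest-at {r = r} {x} {y} split x≢y p = trans (sym (trans (split y) (cong (_+ r y) (δ-≢ x≢y)))) p

peel : ∀ {n k} {f : Fin n → ℕ} → sum f ≡ suc k → ∃ λ x → ∃ λ r → (∀ v → f v ≡ δ x v + r v) × sum r ≡ k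
peel {f = f} eq = first , proj₁ rest , proj₁ (proj₂ rest) , suc-injective (trans (sym (proj₂ (proj₂ rest))) eq)
  where
  positive : ∃ λ x → 0 < f x
  positive = sum-pos (≤-trans (s≤s z≤n) (≤-reflexive (sym eq)))
  first = proj₁ positive
  rest = split-off {f = f} first (proj₂ positive)

-- Multiplicities express both membership and absence of repetition: a list bounded by a 0-1
-- function is a repetition-free list inside that set, and the constant value 1 means that every
-- vertex is listed exactly once.
mult : ∀ {n} → List (Fin n) → Fin n → ℕ
mult []       v = 0
mult (x ∷ xs) v = δ x v + mult xs v

mult-++ : ∀ {n} (xs ys : List (Fin n)) v → mult (xs ++ ys) v ≡ mult xs v + mult ys v
mult-++ []       ys v = refl
mult-++ (x ∷ xs) ys v = trans (cong (δ x v +_) (mult-++ xs ys v)) (sym (+-assoc (δ x v) _ _))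

sum-mult : ∀ {n} (xs : List (Fin n)) → sum (mult xs) ≡ length xs
sum-mult {n} []   = trans (sum-const n 0) (*-zeroʳ n)
sum-mult (x ∷ xs) = trans sum-+ (cong₂ _+_ (sum-δ₁ x) (sum-mult xs))

sum-family : ∀ {k n} (f : Fin k → Fin n) (g : Fin n → ℕ) →
  sum (λ i → g (f i)) ≡ sum λ v → sum (λ i → δ (f i) v) * g v
sum-family f g = begin
  sum (λ i → g (f i))                       ≡⟨ sum-cong-≗ (λ i → sum-δ (f i) g) ⟨
  sum (λ i → sum λ v → δ (f i) v * g v)     ≡⟨ ∑-comm (λ i v → δ (f i) v * g v) ⟩
  sum (λ v → sum λ i → δ (f i) v * g v)     ≡⟨ sum-cong-≗ (λ v → sum-*ʳ (g v) λ i → δ (f i) v) ⟩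
  sum (λ v → sum (λ i → δ (f i) v) * g v)   ∎
  where open ≡-Reasoning

-- This transfers counts over vertices to counts over positions of a list: a family without
-- repetitions inside a set samples `g` at most once on each element of the set.
sum-family-≤ : ∀ {k n} (f : Fin k → Fin n) (w g : Fin n → ℕ) →
  (∀ v → sum (λ i → δ (f i) v) ≤ w v) → sum (λ i → g (f i)) ≤ sum λ v → w v * g v
sum-family-≤ f w g p = ≤-trans (≤-reflexive (sum-family f g)) (sum-mono λ v → *-monoˡ-≤ (g v) (p v))

-- Rearranging a cyclic arrangement by exchanges

pattern 10F = suc 9F
pattern 11F = suc 10F
pattern 12F = suc 11F

-- No measure of progress is needed: a step may alter the state arbitrarily as long as no satisfied
-- index is lost, so each index has to be treated only once.
saturate : ∀ {K} {St : Set} (P : St → Fin K → Set) →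
  (∀ s i → ∃ λ s′ → P s′ i × (∀ j → P s j → P s′ j)) → St → ∃ λ s → ∀ i → P s i
saturate {zero}  P step s = s , λ ()
saturate {suc K} P step s with saturate {K} (λ s i → P s (suc i)) step′ s
  where
  step′ : ∀ s i → ∃ λ s′ → P s′ (suc i) × (∀ j → P s (suc j) → P s′ (suc j))
  step′ s i with step s (suc i)
  ... | s′ , p , q = s′ , p , q ∘ suc
... | s′ , all with step s′ zero
...   | s″ , p , q = s″ , λ { zero → p ; (suc i) → q (suc i) (all i) }

-- A union bound: the `k` constraints exclude at most `k * (K * c)` of the `K * K` pairs, which is
-- fewer than all.
avoid : ∀ {k K} c (f : Fin k → Fin K → Fin K → ℕ) → (∀ t → sum₂ (f t) ≤ K * c) → k * c < K →
  ∃ λ i → ∃ λ j → ∀ t → f t i j ≡ 0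
avoid {k} {K} c f bounds p = i , j , sum-zero eq
  where
  slack : suc (k * (K * c)) ≤ K * K
  slack = begin
    suc (k * (K * c))   ≡⟨ cong suc (rearrange k K c) ⟩
    suc (K * (k * c))   ≤⟨ +-monoˡ-≤ (K * (k * c)) (≤-trans (s≤s z≤n) p) ⟩
    K + K * (k * c)     ≡⟨ *-suc K (k * c) ⟨
    K * suc (k * c)     ≤⟨ *-monoʳ-≤ K p ⟩
    K * K               ∎
    where
    open ≤-Reasoning
    rearrange : ∀ k K c → k * (K * c) ≡ K * (k * c)
    rearrange = solve-∀
  total≤ : sum₂ (λ i j → sum λ t → f t i j) ≤ k * (K * c)
  total≤ = begin
    sum₂ (λ i j → sum λ t → f t i j)        ≡⟨ sum-cong-≗ (λ i → ∑-comm λ j t → f t i j) ⟩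
    sum (λ i → sum λ t → sum λ j → f t i j) ≡⟨ ∑-comm (λ i t → sum λ j → f t i j) ⟩
    sum (λ t → sum₂ (f t))                  ≤⟨ sum≤ (K * c) bounds ⟩
    k * (K * c)                             ∎
    where open ≤-Reasoning
  found : ∃ λ i → ∃ λ j → sum (λ t → f t i j) ≡ 0
  found = sum₂<⇒∃0 (≤-trans (s≤s total≤) slack)
  i = proj₁ found
  j = proj₁ (proj₂ found)
  eq = proj₂ (proj₂ found)

module _ {K : ℕ} where

  opaque
    transposed : Fin K → Fin K → Permutation′ K → Permutation′ K
    transposed i j π = transpose i j ∘ₚ π

    transposed-l : ∀ i j π → transposed i j π ⟨$⟩ʳ i ≡ π ⟨$⟩ʳ j
    transposed-l i j π rewrite dec-true (i F.≟ i) refl = refl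

    transposed-r : ∀ i j π → transposed i j π ⟨$⟩ʳ j ≡ π ⟨$⟩ʳ i
    transposed-r i j π with j F.≟ i
    ... | yes refl = refl
    ... | no  _ rewrite dec-true (j F.≟ j) refl = refl

    transposed-other : ∀ i j π {k} → k ≢ i → k ≢ j → transposed i j π ⟨$⟩ʳ k ≡ π ⟨$⟩ʳ k
    transposed-other i j π {k} k≢i k≢j rewrite dec-false (k F.≟ i) k≢i | dec-false (k F.≟ j) k≢j = refl

  rows : ∀ {c} {f : Fin K → Fin K → ℕ} → (∀ i → sum (f i) ≤ c) → sum₂ f ≤ K * c
  rows {c} = sum≤ c

  cols : ∀ {c} {f : Fin K → Fin K → ℕ} → (∀ j → sum (λ i → f i j) ≤ c) → sum₂ f ≤ K * c
  cols {c} {f} p = ≤-trans (≤-reflexive (∑-comm f)) (sum≤ c p)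

  permuted : ∀ {c} (f : Fin K → ℕ) π → sum f ≤ c → sum (λ i → f (π ⟨$⟩ʳ i)) ≤ c
  permuted f π p = ≤-trans (≤-reflexive (sum-permute f π)) p

  -- A sparse case of Hall's theorem, by exchanges: to repair `i`, swap its partner with that of
  -- some `j`. Each of the two new pairs rules out at most `r` choices of `j`. The choice `j = i`
  -- survives only if `i` was good already.
  matching : ∀ r (rel : Fin K → Fin K → ℕ) → (∀ i → sum (rel i) ≤ r) →
    (∀ a → sum (λ i → rel i a) ≤ r) → r + r < K → ∃ λ π → ∀ i → rel i (π ⟨$⟩ʳ i) ≡ 0
  matching r rel row col 2r<K = saturate (λ π i → rel i (π ⟨$⟩ʳ i) ≡ 0) step idₚ
    where
    step : ∀ π i → ∃ λ π′ → rel i (π′ ⟨$⟩ʳ i) ≡ 0 × (∀ k → rel k (π ⟨$⟩ʳ k) ≡ 0 → rel k (π′ ⟨$⟩ʳ k) ≡ 0)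
    step π i with sum<⇒∃0 {f = λ j → rel i (π ⟨$⟩ʳ j) + rel j (π ⟨$⟩ʳ i)}
      (≤-trans (s≤s (≤-trans (≤-reflexive sum-+) (+-mono-≤ (permuted (rel i) π (row i)) (col _)))) 2r<K)
    ... | j , eq = transposed i j π , fixed , kept
      where
      fixed : rel i (transposed i j π ⟨$⟩ʳ i) ≡ 0
      fixed rewrite transposed-l i j π = m+n≡0⇒m≡0 _ eq
      kept : ∀ k → rel k (π ⟨$⟩ʳ k) ≡ 0 → rel k (transposed i j π ⟨$⟩ʳ k) ≡ 0
      kept k p with k F.≟ i | k F.≟ j
      ... | yes refl | _ = fixed
      ... | no _ | yes refl rewrite transposed-r i j π = m+n≡0⇒n≡0 (rel i _) eq
      ... | no k≢i | no k≢j rewrite transposed-other i j π k≢i k≢j = p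

-- Slot (b , i) is the half b of block i; the block gets the item a and its slot the item m.
-- In stage one all pairs (slot, a) and (slot, m) are made good, i.e. few completions are bad.
-- A slot (b , i₀) is then repaired by exchanging the m-items of (b , i₀) and (b , i) and the
-- a-items of i and j: every affected slot keeps a good pair or gets one that is free to vary.
module Rearrangement {K : ℕ} (bad : Bool → Fin K → Fin K → Fin K → ℕ) (g h : ℕ)
  (slot-bad : ∀ b i → sum₂ (λ m a → bad b i m a) ≤ g)
  (a-bad    : ∀ b a → sum₂ (λ i m → bad b i m a) ≤ g)
  (m-bad    : ∀ b m → sum₂ (λ i a → bad b i m a) ≤ g)
  (g≤h² : g ≤ h * h) (0<h : 0 < h) (13h<K : 13 * h < K) where

  private instance
    h≢0 : NonZero h
    h≢0 = >-nonZero 0<h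

  badA badM : Bool → Fin K → Fin K → ℕ
  badA b i a = leq (suc h) (sum λ m → bad b i m a)
  badM b i m = leq (suc h) (sum λ a → bad b i m a)

  -- Markov with equal threshold and bound: a total of at most `h * h` leaves at most `h` rows
  -- heavier than `h`. This is why one parameter `h` serves both purposes.
  few : (f : Fin K → Fin K → ℕ) → sum₂ f ≤ g → sum (λ i → leq (suc h) (sum (f i))) ≤ h
  few f p = *-cancelʳ-≤ _ h h (begin
    sum (λ i → leq (suc h) (sum (f i))) * h   ≡⟨ sum-*ʳ h _ ⟨
    sum (λ i → leq (suc h) (sum (f i)) * h)   ≤⟨ sum-mono (λ i → markov h (sum (f i))) ⟩
    sum₂ f                                    ≤⟨ p ⟩
    g                                         ≤⟨ g≤h² ⟩
    h * h                                     ∎)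
    where open ≤-Reasoning

  A-row : ∀ b i → sum (badA b i) ≤ h
  A-row b i = few (λ a m → bad b i m a) (≤-trans (≤-reflexive (∑-comm _)) (slot-bad b i))
  A-col : ∀ b a → sum (λ i → badA b i a) ≤ h
  A-col b a = few (λ i m → bad b i m a) (a-bad b a)
  M-row : ∀ b i → sum (badM b i) ≤ h
  M-row b i = few (λ m a → bad b i m a) (slot-bad b i)
  M-col : ∀ b m → sum (λ i → badM b i m) ≤ h
  M-col b m = few (λ i a → bad b i m a) (m-bad b m)

  13h≥ : ∀ c {_ : T (c ≤ᵇ 13)} → c * h < K
  13h≥ c {p} = ≤-trans (s≤s (*-monoˡ-≤ h (≤ᵇ⇒≤ c 13 p))) 13h<K

  -- The invariant does not say that any slot is an edge. It keeps the two pairs at every slot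
  -- extendable in almost all ways, which is what makes each later repair possible.
  record State : Set where
    field
      α     : Permutation′ K
      μ     : Bool → Permutation′ K
      goodA : ∀ b i → badA b i (α ⟨$⟩ʳ i) ≡ 0
      goodM : ∀ b i → badM b i (μ b ⟨$⟩ʳ i) ≡ 0
  open State

  initial : State
  -- The A-item of a block serves both of its slots, so the two relations are added and the degree
  -- bound doubles.
  initial with matching (h + h) (λ i a → badA true i a + badA false i a)
                 (λ i → ≤-trans (≤-reflexive sum-+) (+-mono-≤ (A-row true i) (A-row false i)))
                 (λ a → ≤-trans (≤-reflexive sum-+) (+-mono-≤ (A-col true a) (A-col false a)))
                 (subst (_< K) (four h) (13h≥ 4))
    where
    four : ∀ h → 4 * h ≡ h + h + (h + h)
    four = solve-∀
  ... | π , good = record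
    { α = π
    ; μ = λ b → proj₁ (matchM b)
    ; goodA = λ { true i → m+n≡0⇒m≡0 _ (good i) ; false i → m+n≡0⇒n≡0 (badA true i (π ⟨$⟩ʳ i)) (good i) }
    ; goodM = λ b → proj₂ (matchM b) }
    where
    two : ∀ h → 2 * h ≡ h + h
    two = solve-∀
    matchM : ∀ b → ∃ λ ρ → ∀ i → badM b i (ρ ⟨$⟩ʳ i) ≡ 0
    matchM b = matching h (badM b) (M-row b) (M-col b) (subst (_< K) (two h) (13h≥ 2))

  Fine : State → Bool → Fin K → Set
  Fine s b i = bad b i (μ s b ⟨$⟩ʳ i) (α s ⟨$⟩ʳ i) ≡ 0

  update : Bool → Permutation′ K → (Bool → Permutation′ K) → Bool → Permutation′ K
  update true  σ τ true  = σ
  update true  σ τ false = τ false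
  update false σ τ true  = τ true
  update false σ τ false = σ

  update-same : ∀ b σ τ → update b σ τ b ≡ σ
  update-same true  σ τ = refl
  update-same false σ τ = refl

  update-not : ∀ b σ τ → update b σ τ (not b) ≡ τ (not b)
  update-not true  σ τ = refl
  update-not false σ τ = refl

  same-or-not : ∀ b c → c ≡ b ⊎ c ≡ not b
  same-or-not true  true  = inj₁ refl
  same-or-not true  false = inj₂ refl
  same-or-not false true  = inj₂ refl
  same-or-not false false = inj₁ refl

  module Repair (s : State) (b : Bool) (i₀ : Fin K) where
    A : Fin K → Fin K
    A = α s ⟨$⟩ʳ_
    M : Bool → Fin K → Fin K
    M c = μ s c ⟨$⟩ʳ_

    unit : ∀ {f : Fin K → ℕ} → sum f ≡ 1 → sum f ≤ h
    unit eq = ≤-trans (≤-reflexive eq) 0<h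

    A-good : ∀ c i → sum (λ m → bad c i m (A i)) ≤ h
    A-good c i = ≤-pred (leq-false {suc h} (goodA s c i))
    M-good : ∀ c i → sum (λ a → bad c i (M c i) a) ≤ h
    M-good c i = ≤-pred (leq-false {suc h} (goodM s c i))

    -- Constraints 0 and 1 keep the A-item of block `i₀` in place. Constraints 2 and 3 make slot
    -- `(b , i₀)` an edge with a good new pair, 4 to 8 do the same for the two slots of block `i`,
    -- and 9 to 12 for those of block `j`. The case `i = j` is allowed.
    constraint : Fin 13 → Fin K → Fin K → ℕ
    constraint 0F i j = δ i₀ i
    constraint 1F i j = δ i₀ j
    constraint 2F i j = bad b i₀ (M b i) (A i₀)
    constraint 3F i j = badM b i₀ (M b i)
    constraint 4F i j = bad b i (M b i₀) (A j)
    constraint 5F i j = badM b i (M b i₀)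
    constraint 6F i j = badA true i (A j)
    constraint 7F i j = badA false i (A j)
    constraint 8F i j = bad (not b) i (M (not b) i) (A j)
    constraint 9F i j = badA true j (A i)
    constraint 10F i j = badA false j (A i)
    constraint 11F i j = bad true j (M true j) (A i)
    constraint 12F i j = bad false j (M false j) (A i)

    h≤K : h ≤ K
    h≤K = <⇒≤ (subst (_< K) (*-identityˡ h) (13h≥ 1))

    bound : ∀ t → sum₂ (constraint t) ≤ K * h
    bound 0F = cols (λ j → unit (sum-δ₁ i₀))
    bound 1F = rows (λ i → unit (sum-δ₁ i₀))
    bound 2F = cols (λ j → permuted (λ m → bad b i₀ m (A i₀)) (μ s b) (A-good b i₀))
    bound 3F = cols (λ j → permuted (badM b i₀) (μ s b) (M-row b i₀))
    -- The item displaced from `i₀` meets a slot and an A-item that both vary, so the total `m-bad`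
    -- is available here. Providing this freedom is the purpose of the second index `j`: the pair of
    -- slot `i` and the displaced item need not be good beforehand.
    bound 4F = ≤-trans (sum-mono λ i → permuted (λ a → bad b i (M b i₀) a) (α s) ≤-refl)
          (≤-trans (m-bad b (M b i₀)) (≤-trans g≤h² (*-monoˡ-≤ h h≤K)))
    bound 5F = cols (λ j → M-col b (M b i₀))
    bound 6F = rows (λ i → permuted (badA true i) (α s) (A-row true i))
    bound 7F = rows (λ i → permuted (badA false i) (α s) (A-row false i))
    bound 8F = rows (λ i → permuted (λ a → bad (not b) i (M (not b) i) a) (α s) (M-good (not b) i))
    bound 9F = rows (λ i → A-col true (A i))
    bound 10F = rows (λ i → A-col false (A i))
    bound 11F = cols (λ j → permuted (λ a → bad true j (M true j) a) (α s) (M-good true j))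
    bound 12F = cols (λ j → permuted (λ a → bad false j (M false j) a) (α s) (M-good false j))

    δ-≢′ : ∀ {x y : Fin K} → δ x y ≡ 0 → x ≢ y
    δ-≢′ {x} eq refl = contradiction (trans (sym eq) (δ-refl x)) λ ()

    module Move {i j : Fin K} (clear : ∀ t → constraint t i j ≡ 0) where
      i₀≢i : i₀ ≢ i
      i₀≢i = δ-≢′ (clear 0F)
      i₀≢j : i₀ ≢ j
      i₀≢j = δ-≢′ (clear 1F)
      α′ = transposed i j (α s)
      μ′ = update b (transposed i₀ i (μ s b)) (μ s)
      A′ : Fin K → Fin K
      A′ = α′ ⟨$⟩ʳ_
      M′ : Bool → Fin K → Fin K
      M′ c = μ′ c ⟨$⟩ʳ_
      A-i : A′ i ≡ A j
      A-i = transposed-l i j (α s)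
      A-j : A′ j ≡ A i
      A-j = transposed-r i j (α s)
      A-other : ∀ {k} → k ≢ i → k ≢ j → A′ k ≡ A k
      A-other = transposed-other i j (α s)
      A-i₀ : A′ i₀ ≡ A i₀
      A-i₀ = A-other i₀≢i i₀≢j
      Mb : ∀ k → M′ b k ≡ transposed i₀ i (μ s b) ⟨$⟩ʳ k
      Mb k = cong (_⟨$⟩ʳ k) (update-same b _ (μ s))
      Mb-i₀ : M′ b i₀ ≡ M b i
      Mb-i₀ = trans (Mb i₀) (transposed-l i₀ i (μ s b))
      Mb-i : M′ b i ≡ M b i₀
      Mb-i = trans (Mb i) (transposed-r i₀ i (μ s b))
      Mb-other : ∀ {k} → k ≢ i₀ → k ≢ i → M′ b k ≡ M b k
      Mb-other p q = trans (Mb _) (transposed-other i₀ i (μ s b) p q)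
      M-not : ∀ k → M′ (not b) k ≡ M (not b) k
      M-not k = cong (_⟨$⟩ʳ k) (update-not b _ (μ s))
      M-other : ∀ c {k} → k ≢ i₀ → k ≢ i → M′ c k ≡ M c k
      M-other c {k} p q with same-or-not b c
      ... | inj₁ refl = Mb-other p q
      ... | inj₂ refl = M-not k

      badA-i : ∀ c → badA c i (A j) ≡ 0
      badA-i true  = (clear 6F)
      badA-i false = (clear 7F)
      badA-j : ∀ c → badA c j (A i) ≡ 0
      badA-j true  = (clear 9F)
      badA-j false = (clear 10F)
      bad-j : ∀ c → bad c j (M c j) (A i) ≡ 0
      bad-j true  = (clear 11F)
      bad-j false = (clear 12F)

      goodA′ : ∀ c k → badA c k (A′ k) ≡ 0
      goodA′ c k = cases (k F.≟ i) (k F.≟ j)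
        where
        cases : Dec (k ≡ i) → Dec (k ≡ j) → badA c k (A′ k) ≡ 0
        cases (yes refl) _ = trans (cong (badA c i) A-i) (badA-i c)
        cases (no _) (yes refl) = trans (cong (badA c j) A-j) (badA-j c)
        cases (no k≢i) (no k≢j) = trans (cong (badA c k) (A-other k≢i k≢j)) (goodA s c k)

      goodM′ : ∀ c k → badM c k (M′ c k) ≡ 0
      goodM′ c k = cases (same-or-not b c) (k F.≟ i₀) (k F.≟ i)
        where
        cases : c ≡ b ⊎ c ≡ not b → Dec (k ≡ i₀) → Dec (k ≡ i) → badM c k (M′ c k) ≡ 0
        cases (inj₂ refl) _ _ = trans (cong (badM c k) (M-not k)) (goodM s c k)
        cases (inj₁ refl) (yes refl) _ = trans (cong (badM c i₀) Mb-i₀) (clear 3F)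
        cases (inj₁ refl) (no _) (yes refl) = trans (cong (badM c i) Mb-i) (clear 5F)
        cases (inj₁ refl) (no p) (no q) = trans (cong (badM c k) (Mb-other p q)) (goodM s c k)

      s′ : State
      s′ = record { α = α′ ; μ = μ′ ; goodA = goodA′ ; goodM = goodM′ }

      rewrite-bad : ∀ {c k m a} → M′ c k ≡ m → A′ k ≡ a → bad c k m a ≡ 0 → Fine s′ c k
      rewrite-bad refl refl p = p

      kept : ∀ c k → Fine s c k → Fine s′ c k
      kept c k p = cases (k F.≟ i₀) (k F.≟ i) (k F.≟ j) (same-or-not b c)
        where
        cases : Dec (k ≡ i₀) → Dec (k ≡ i) → Dec (k ≡ j) → c ≡ b ⊎ c ≡ not b → Fine s′ c k
        cases (yes refl) _ _ (inj₁ refl) = rewrite-bad Mb-i₀ A-i₀ (clear 2F)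
        cases (yes refl) _ _ (inj₂ refl) = rewrite-bad (M-not i₀) A-i₀ p
        cases (no _) (yes refl) _ (inj₁ refl) = rewrite-bad Mb-i A-i (clear 4F)
        cases (no _) (yes refl) _ (inj₂ refl) = rewrite-bad (M-not i) A-i (clear 8F)
        cases (no x) (no y) (yes refl) _ = rewrite-bad (M-other c x y) A-j (bad-j c)
        cases (no x) (no y) (no z) _ = rewrite-bad (M-other c x y) (A-other y z) p

      moved : ∃ λ s′ → Fine s′ b i₀ × (∀ c k → Fine s c k → Fine s′ c k)
      moved = s′ , rewrite-bad Mb-i₀ A-i₀ (clear 2F) , kept

    repair : ∃ λ s′ → Fine s′ b i₀ × (∀ c k → Fine s c k → Fine s′ c k)
    repair = apply (avoid h constraint bound 13h<K)
      where
      apply : (∃ λ i → ∃ λ j → ∀ t → constraint t i j ≡ 0) →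
        ∃ λ s′ → Fine s′ b i₀ × (∀ c k → Fine s c k → Fine s′ c k)
      apply (i , j , clear) = Move.moved clear

  open Repair using (repair)

  rearrangement : ∃ λ s → ∀ i b → Fine s b i
  rearrangement = saturate (λ s i → ∀ b → Fine s b i) step initial
    where
    step : ∀ s i → ∃ λ s′ → (∀ b → Fine s′ b i) × (∀ j → (∀ b → Fine s b j) → ∀ b → Fine s′ b j)
    step s i = second (repair s true i)
      where
      Result : State → State → Set
      Result s s′ = (∀ b → Fine s′ b i) × (∀ j → (∀ b → Fine s b j) → ∀ b → Fine s′ b j)
      third : ∀ s₁ → Fine s₁ true i → (∀ c k → Fine s c k → Fine s₁ c k) →
        (∃ λ s₂ → Fine s₂ false i × (∀ c k → Fine s₁ c k → Fine s₂ c k)) → ∃ (Result s)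
      third s₁ p keep (s₂ , q , keep′) = s₂ , (λ { true → keep′ true i p ; false → q }) ,
        λ j all b → keep′ b j (keep b j (all b))
      second : (∃ λ s₁ → Fine s₁ true i × (∀ c k → Fine s c k → Fine s₁ c k)) → ∃ (Result s)
      second (s₁ , p , keep) = third s₁ p keep (repair s₁ false i)

-- Degrees as sums over ordered pairs

module _ {a} {A : Set a} where

  sumL : (A → ℕ) → List A → ℕ
  sumL f []       = 0
  sumL f (x ∷ xs) = f x + sumL f xs

  sumL-++ : ∀ f xs ys → sumL f (xs ++ ys) ≡ sumL f xs + sumL f ys
  sumL-++ f []       ys = refl
  sumL-++ f (x ∷ xs) ys = trans (cong (f x +_) (sumL-++ f xs ys)) (sym (+-assoc (f x) _ _))

  sumL-cong : ∀ {f g} xs → (∀ x → f x ≡ g x) → sumL f xs ≡ sumL g xs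
  sumL-cong []       p = refl
  sumL-cong (x ∷ xs) p = cong₂ _+_ (p x) (sumL-cong xs p)

  sumL-mono : ∀ {f g} xs → (∀ x → f x ≤ g x) → sumL f xs ≤ sumL g xs
  sumL-mono []       p = z≤n
  sumL-mono (x ∷ xs) p = +-mono-≤ (p x) (sumL-mono xs p)

  sumL-*ˡ : ∀ c f xs → sumL (λ x → c * f x) xs ≡ c * sumL f xs
  sumL-*ˡ c f []       = sym (*-zeroʳ c)
  sumL-*ˡ c f (x ∷ xs) = trans (cong (c * f x +_) (sumL-*ˡ c f xs)) (sym (*-distribˡ-+ c (f x) _))

  sumL-sum : ∀ {n} (f : Fin n → A → ℕ) xs → sum (λ v → sumL (f v) xs) ≡ sumL (λ x → sum λ v → f v x) xs
  sumL-sum {n} f [] = trans (sum-const n 0) (*-zeroʳ n)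
  sumL-sum f (x ∷ xs) = trans sum-+ (cong (sum (λ v → f v x) +_) (sumL-sum f xs))

  length-filter-filter : ∀ {p q} {P : A → Set p} {Q : A → Set q} (Q? : Decidable Q) (P? : Decidable P) xs →
    length (filter Q? (filter P? xs)) ≡ sumL (λ x → ι (does (P? x)) * ι (does (Q? x))) xs
  length-filter-filter Q? P? [] = refl
  length-filter-filter Q? P? (x ∷ xs) with does (P? x)
  ... | false = length-filter-filter Q? P? xs
  ... | true with does (Q? x)
  ...   | false = length-filter-filter Q? P? xs
  ...   | true  = cong suc (length-filter-filter Q? P? xs)

does-T : ∀ {b} (d : Dec (T b)) → does d ≡ b
does-T {true}  (yes _) = refl
does-T {true}  (no ¬t) = contradiction _ ¬t
does-T {false} (no _)  = refl

sumL-map : ∀ {a b} {A : Set a} {B : Set b} (f : B → ℕ) (g : A → B) xs → sumL f (map g xs) ≡ sumL (f ∘ g) xs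
sumL-map f g []       = refl
sumL-map f g (x ∷ xs) = cong (f (g x) +_) (sumL-map f g xs)

-- Equality as a number, computed along the vectors so that it reduces together with the recursion
-- of `allSubsets`.
same : ∀ {n} → Subset n → Subset n → ℕ
same []          []          = 1
same (true ∷ s)  (true ∷ t)  = same s t
same (false ∷ s) (false ∷ t) = same s t
same (true ∷ s)  (false ∷ t) = 0
same (false ∷ s) (true ∷ t)  = 0

same-refl : ∀ {n} (s : Subset n) → same s s ≡ 1
same-refl []          = refl
same-refl (true ∷ s)  = same-refl s
same-refl (false ∷ s) = same-refl s

same-≡ : ∀ {n} (s t : Subset n) → 0 < same s t → s ≡ t
same-≡ []          []          p = refl
same-≡ (true ∷ s)  (true ∷ t)  p = cong (true ∷_) (same-≡ s t p)
same-≡ (false ∷ s) (false ∷ t) p = cong (false ∷_) (same-≡ s t p)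

same≤1 : ∀ {n} (s t : Subset n) → same s t ≤ 1
same≤1 []          []          = s≤s z≤n
same≤1 (true ∷ s)  (true ∷ t)  = same≤1 s t
same≤1 (false ∷ s) (false ∷ t) = same≤1 s t
same≤1 (true ∷ s)  (false ∷ t) = z≤n
same≤1 (false ∷ s) (true ∷ t)  = z≤n

sumL-0 : ∀ {a} {A : Set a} (xs : List A) → sumL (λ _ → 0) xs ≡ 0
sumL-0 []       = refl
sumL-0 (x ∷ xs) = sumL-0 xs

-- This expresses that `allSubsets n` lists every subset exactly once, in the form that turns sums
-- over ordered tuples of vertices into sums over edges.
sumL-same : ∀ {n} (s : Subset n) (f : Subset n → ℕ) → sumL (λ t → same s t * f t) (allSubsets n) ≡ f s
sumL-same [] f = trans (+-identityʳ _) (*-identityˡ (f []))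
sumL-same {suc n} (true ∷ s) f = begin
  sumL (λ t → same (true ∷ s) t * f t) (map (false ∷_) (allSubsets n) ++ map (true ∷_) (allSubsets n))
    ≡⟨ sumL-++ _ (map (false ∷_) (allSubsets n)) _ ⟩
  sumL (λ t → same (true ∷ s) t * f t) (map (false ∷_) (allSubsets n)) + sumL _ (map (true ∷_) (allSubsets n))
    ≡⟨ cong₂ _+_ (sumL-map _ _ (allSubsets n)) (sumL-map _ _ (allSubsets n)) ⟩
  sumL (λ _ → 0) (allSubsets n) + sumL (λ t → same s t * f (true ∷ t)) (allSubsets n)
    ≡⟨ cong₂ _+_ (sumL-0 (allSubsets n)) (sumL-same s (f ∘ (true ∷_))) ⟩
  f (true ∷ s) ∎
  where open ≡-Reasoning
sumL-same {suc n} (false ∷ s) f = begin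
  sumL (λ t → same (false ∷ s) t * f t) (map (false ∷_) (allSubsets n) ++ map (true ∷_) (allSubsets n))
    ≡⟨ sumL-++ _ (map (false ∷_) (allSubsets n)) _ ⟩
  sumL (λ t → same (false ∷ s) t * f t) (map (false ∷_) (allSubsets n)) + sumL _ (map (true ∷_) (allSubsets n))
    ≡⟨ cong₂ _+_ (sumL-map _ _ (allSubsets n)) (sumL-map _ _ (allSubsets n)) ⟩
  sumL (λ t → same s t * f (false ∷ t)) (allSubsets n) + sumL (λ _ → 0) (allSubsets n)
    ≡⟨ cong₂ _+_ (sumL-same s (f ∘ (false ∷_))) (sumL-0 (allSubsets n)) ⟩
  f (false ∷ s) + 0 ≡⟨ +-identityʳ _ ⟩
  f (false ∷ s) ∎
  where open ≡-Reasoning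

χ : ∀ {n} → Subset n → Fin n → ℕ
χ s v = ι (V.lookup s v)

χ≤1 : ∀ {n} (s : Subset n) v → χ s v ≤ 1
χ≤1 s v = ι≤1 (V.lookup s v)

χ-ext : ∀ {n} (s t : Subset n) → (∀ v → χ s v ≡ χ t v) → s ≡ t
χ-ext []      []      p = refl
χ-ext (a ∷ s) (b ∷ t) p = cong₂ _∷_ (ι-injective a b (p zero)) (χ-ext s t (p ∘ suc))
  where
  ι-injective : ∀ a b → ι a ≡ ι b → a ≡ b
  ι-injective true  true  _ = refl
  ι-injective false false _ = refl

sum-χ : ∀ {n} (s : Subset n) → sum (χ s) ≡ ∣ s ∣
sum-χ []          = sum-empty _
sum-χ (true ∷ s)  = trans (sum-suc _) (cong suc (sum-χ s))
sum-χ (false ∷ s) = trans (sum-suc _) (sum-χ s)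

χ-∈ : ∀ {n} {s : Subset n} {v} → v ∈ s → χ s v ≡ 1
χ-∈ p = cong ι ([]=⇒lookup p)

∈-χ : ∀ {n} {s : Subset n} {v} → 0 < χ s v → v ∈ s
∈-χ {s = s} {v} p = lookup⇒[]= v s (lookup-true (V.lookup s v) p)
  where
  lookup-true : ∀ b → 0 < ι b → b ≡ true
  lookup-true true _ = refl

lookup-⁅⁆ : ∀ {n} (a v : Fin n) → V.lookup ⁅ a ⁆ v ≡ does (a F.≟ v)
lookup-⁅⁆ zero    zero    = refl
lookup-⁅⁆ zero    (suc v) = lookup-⊥ v
  where
  lookup-⊥ : ∀ {n} (v : Fin n) → V.lookup (V.replicate n outside) v ≡ false
  lookup-⊥ zero    = refl
  lookup-⊥ (suc v) = lookup-⊥ v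
lookup-⁅⁆ (suc a) zero    = refl
lookup-⁅⁆ (suc a) (suc v) = lookup-⁅⁆ a v

χ-triple : ∀ {n} (a b c v : Fin n) → χ (triple a b c) v ≡ ι (does (a F.≟ v) ∨ (does (b F.≟ v) ∨ does (c F.≟ v)))
χ-triple a b c v = cong ι (trans (lookup-zipWith _∨_ v ⁅ a ⁆ (⁅ b ⁆ ∪ ⁅ c ⁆))
  (cong₂ _∨_ (lookup-⁅⁆ a v) (trans (lookup-zipWith _∨_ v ⁅ b ⁆ ⁅ c ⁆) (cong₂ _∨_ (lookup-⁅⁆ b v) (lookup-⁅⁆ c v)))))

triple-swap₁₂ : ∀ {n} (a b c : Fin n) → triple a b c ≡ triple b a c
triple-swap₁₂ a b c = trans (sym (∪-assoc ⁅ a ⁆ ⁅ b ⁆ ⁅ c ⁆)) (trans (cong (_∪ ⁅ c ⁆) (∪-comm ⁅ a ⁆ ⁅ b ⁆)) (∪-assoc ⁅ b ⁆ ⁅ a ⁆ ⁅ c ⁆))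

triple-swap₂₃ : ∀ {n} (a b c : Fin n) → triple a b c ≡ triple a c b
triple-swap₂₃ a b c = cong (⁅ a ⁆ ∪_) (∪-comm ⁅ b ⁆ ⁅ c ⁆)

opaque
  -- Peeling three points off `χ s` writes it as a sum of three `δ`. As its values are at most 1,
  -- the points are distinct and the sum agrees with the disjunction that defines `triple`.
  three : ∀ {n} (s : Subset n) v → ∣ s ∣ ≡ 3 → χ s v ≡ 1 →
    ∃ λ y → ∃ λ z → y ≢ z × triple v y z ≡ s
  three s v size v∈s with take-out {f = χ s} v v∈s
  ... | r , e₁ , size₁ with peel {f = r} (suc-injective (trans (sym size₁) (trans (sum-χ s) size)))
  ...   | y , r′ , e₂ , size₂ with peel size₂
  ...     | z , r″ , e₃ , size₃ = y , z , y≢z , χ-ext _ _ λ u → trans (χ-triple v y z u) (or≡sum {does (v F.≟ u)} {does (y F.≟ u)} {does (z F.≟ u)} (χ-sum u) (ι≤1 _))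
    where
    χ-sum : ∀ u → χ s u ≡ δ v u + (δ y u + δ z u)
    χ-sum u = trans (e₁ u) (cong (δ v u +_) (trans (e₂ u) (cong (δ y u +_)
      (trans (e₃ u) (trans (cong (δ z u +_) (sum-zero size₃ u)) (+-identityʳ _))))))
    y≢z : y ≢ z
    y≢z refl = <⇒≱ {1} {2} (s≤s (s≤s z≤n)) (≤-trans
      (≤-trans (≤-reflexive (sym (cong₂ _+_ (δ-refl y) (δ-refl y)))) (m≤n+m _ (δ v y)))
      (≤-trans (≤-reflexive (sym (χ-sum y))) (ι≤1 _)))
    or≡sum : ∀ {a b c x} → x ≡ ι a + (ι b + ι c) → x ≤ 1 → ι (a ∨ (b ∨ c)) ≡ x
    or≡sum {true}  {true}  refl (s≤s ())
    or≡sum {true}  {false} {true} refl (s≤s ())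
    or≡sum {true}  {false} {false} refl _ = refl
    or≡sum {false} {true}  {true} refl (s≤s ())
    or≡sum {false} {true}  {false} refl _ = refl
    or≡sum {false} {false} {true} refl _ = refl
    or≡sum {false} {false} {false} refl _ = refl

-- The two orders of the remaining pair are different since `y ≢ z`; this is the factor 2 between
-- degrees and ordered pairs.
two-pairs : ∀ {n} (s : Subset n) v → ∣ s ∣ ≡ 3 → χ s v ≡ 1 → 2 ≤ sum₂ λ y z → same (triple v y z) s
two-pairs s v size v∈s with three s v size v∈s
... | y , z , y≢z , refl = begin
  2                                                    ≡⟨ cong₂ _+_ (unit y z) (unit z y) ⟨
  sum₂ (λ a b → δ y a * δ z b) + sum₂ (λ a b → δ z a * δ y b) ≡⟨ sum₂-+ ⟨
  sum₂ (λ a b → δ y a * δ z b + δ z a * δ y b)         ≤⟨ sum₂-mono hit ⟩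
  sum₂ (λ a b → same (triple v a b) (triple v y z))    ∎
  where
  open ≤-Reasoning
  unit : ∀ p q → sum₂ (λ a b → δ p a * δ q b) ≡ 1
  unit p q = trans (sum₂-product (δ p) (δ q)) (cong₂ _*_ (sum-δ₁ p) (sum-δ₁ q))
  hit : ∀ a b → δ y a * δ z b + δ z a * δ y b ≤ same (triple v a b) (triple v y z)
  hit a b with y F.≟ a | z F.≟ b | z F.≟ a | y F.≟ b
  ... | yes refl | _        | yes refl | _        = contradiction refl y≢z
  ... | yes refl | yes refl | no _     | _        = ≤-reflexive (sym (same-refl (triple v y z)))
  ... | yes _    | no _     | no _     | _        = z≤n
  ... | no _     | _        | yes refl | yes refl =
    ≤-reflexive (sym (trans (cong (λ t → same t (triple v y z)) (triple-swap₂₃ v z y)) (same-refl (triple v y z))))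
  ... | no _     | _        | yes _    | no _     = z≤n
  ... | no _     | _        | no _     | _        = z≤n

choose2 : ∀ x → 2 * (x C 2) + x ≡ x * x
choose2 zero    = refl
choose2 (suc x) = begin
  2 * (suc x C 2) + suc x           ≡⟨ cong (λ c → 2 * c + suc x) (trans (sym (nCk+nC[k+1]≡[n+1]C[k+1] x 1)) (cong (_+ x C 2) (nC1≡n x))) ⟩
  2 * (x + x C 2) + suc x           ≡⟨ regroup x (x C 2) ⟩
  2 * (x C 2) + x + (x + suc x)     ≡⟨ cong (_+ (x + suc x)) (choose2 x) ⟩
  x * x + (x + suc x)               ≡⟨ square x ⟩
  suc x * suc x                     ∎
  where
  open ≡-Reasoning
  regroup : ∀ x c → 2 * (x + c) + suc x ≡ 2 * c + x + (x + suc x)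
  regroup = solve-∀
  square : ∀ x → x * x + (x + suc x) ≡ suc x * suc x
  square = solve-∀

module Degrees {n} (H : Hypergraph3 n) where

  e : Fin n → Fin n → Fin n → ℕ
  e x y z = ι (edge H (triple x y z))

  e-swap₁₂ : ∀ x y z → e x y z ≡ e y x z
  e-swap₁₂ x y z = cong (ι ∘ edge H) (triple-swap₁₂ x y z)

  e-swap₂₃ : ∀ x y z → e x y z ≡ e x z y
  e-swap₂₃ x y z = cong (ι ∘ edge H) (triple-swap₂₃ x y z)

  e≤1 : ∀ x y z → e x y z ≤ 1
  e≤1 x y z = ι≤1 _

  -- A degenerate triple has at most two elements, so uniformity excludes it. With the symmetry of
  -- `e`, the vertices of any edge found later are distinct.
  e-diag : ∀ x y → e x x y ≡ 0
  e-diag x y with bit (e≤1 x x y)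
  ... | inj₁ eq = eq
  ... | inj₂ eq = contradiction (subst (_≤ 2) (uniform H _ (ι⇒T _ eq)) small) λ { (s≤s (s≤s ())) }
    where
    or≤ : ∀ a b → ι (a ∨ (a ∨ b)) ≤ ι a + ι b
    or≤ true  b = s≤s z≤n
    or≤ false b = ≤-refl
    small : ∣ triple x x y ∣ ≤ 2
    small = begin
      ∣ triple x x y ∣          ≡⟨ sum-χ (triple x x y) ⟨
      sum (χ (triple x x y))    ≡⟨ sum-cong-≗ (χ-triple x x y) ⟩
      sum (λ v → ι (does (x F.≟ v) ∨ (does (x F.≟ v) ∨ does (y F.≟ v)))) ≤⟨ sum-mono (λ v → or≤ (does (x F.≟ v)) (does (y F.≟ v))) ⟩
      sum (λ v → δ x v + δ y v) ≡⟨ sum-+ ⟩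
      sum (δ x) + sum (δ y)     ≡⟨ cong₂ _+_ (sum-δ₁ x) (sum-δ₁ y) ⟩
      2                         ∎
      where open ≤-Reasoning

  length-edges : ∀ {q} {Q : Subset n → Set q} (Q? : Decidable Q) (P? : ∀ s → Dec (T (edge H s))) xs →
    length (filter Q? (filter P? xs)) ≡ sumL (λ s → ι (edge H s) * ι (does (Q? s))) xs
  length-edges Q? P? xs = trans (length-filter-filter Q? P? xs)
    (sumL-cong xs λ s → cong (λ b → ι b * ι (does (Q? s))) {does (P? s)} {edge H s} (does-T (P? s)))

  degree-as-sum : ∀ v → degree H v ≡ sumL (λ s → ι (edge H s) * ι (does (v ∈? s))) (allSubsets n)
  degree-as-sum v = length-edges (v ∈?_) _ (allSubsets n)

  edgesIn-as-sum : ∀ B → edgesIn H B ≡ sumL (λ s → ι (edge H s) * ι (does (s ⊆? B))) (allSubsets n)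
  edgesIn-as-sum B = length-edges (_⊆? B) _ (allSubsets n)

  degree-pairs : ∀ v → 2 * degree H v ≤ sum₂ (e v)
  degree-pairs v = begin
    2 * degree H v
      ≡⟨ cong (2 *_) (degree-as-sum v) ⟩
    2 * sumL (λ s → ι (edge H s) * ι (does (v ∈? s))) (allSubsets n)
      ≡⟨ sumL-*ˡ 2 _ (allSubsets n) ⟨
    sumL (λ s → 2 * (ι (edge H s) * ι (does (v ∈? s)))) (allSubsets n)
      ≤⟨ sumL-mono (allSubsets n) pointwise ⟩
    sumL (λ s → sum₂ λ y z → same (triple v y z) s * ι (edge H s)) (allSubsets n)
      ≡⟨ sumL-sum (λ y s → sum λ z → same (triple v y z) s * ι (edge H s)) (allSubsets n) ⟨
    sum (λ y → sumL (λ s → sum λ z → same (triple v y z) s * ι (edge H s)) (allSubsets n))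
      ≡⟨ sum-cong-≗ (λ y → sumL-sum (λ z s → same (triple v y z) s * ι (edge H s)) (allSubsets n)) ⟨
    sum₂ (λ y z → sumL (λ s → same (triple v y z) s * ι (edge H s)) (allSubsets n))
      ≡⟨ sum₂-cong (λ y z → sumL-same (triple v y z) (ι ∘ edge H)) ⟩
    sum₂ (e v) ∎
    where
    open ≤-Reasoning
    pointwise : ∀ s → 2 * (ι (edge H s) * ι (does (v ∈? s))) ≤ sum₂ λ y z → same (triple v y z) s * ι (edge H s)
    pointwise s with edge H s in is-edge | v ∈? s
    ... | false | _       = z≤n
    ... | true  | no  _   = z≤n
    ... | true  | yes v∈s = ≤-trans (two-pairs s v (uniform H s (subst T (sym is-edge) _)) (χ-∈ v∈s))
      (≤-reflexive (sum₂-cong λ y z → sym (*-identityʳ _)))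

  sum₃ : (Fin n → Fin n → Fin n → ℕ) → ℕ
  sum₃ f = sum λ x → sum₂ (f x)

  -- An edge `s` inside `B` arises only from triples with all entries in `s`, of which there are 3 *
  -- 3 * 3. The crude 27 instead of 6 costs only a factor in β.
  edgesIn-triples : ∀ B → sum₃ (λ x y z → χ B x * (χ B y * (χ B z * e x y z))) ≤ 27 * edgesIn H B
  edgesIn-triples B = begin
    sum₃ (λ x y z → χ B x * (χ B y * (χ B z * e x y z)))
      ≡⟨ sum-cong-≗ (λ x → sum₂-cong λ y z → cong (λ w → χ B x * (χ B y * (χ B z * w))) (sumL-same (triple x y z) (ι ∘ edge H))) ⟨
    sum₃ (λ x y z → χ B x * (χ B y * (χ B z * sumL (λ s → same (triple x y z) s * ι (edge H s)) (allSubsets n))))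
      ≡⟨ sum-cong-≗ (λ x → sum₂-cong λ y z → push x y z) ⟩
    sum₃ (λ x y z → sumL (λ s → term x y z s) (allSubsets n))
      ≡⟨ sum-cong-≗ (λ x → sum-cong-≗ λ y → sumL-sum (λ z s → term x y z s) (allSubsets n)) ⟩
    sum (λ x → sum λ y → sumL (λ s → sum λ z → term x y z s) (allSubsets n))
      ≡⟨ sum-cong-≗ (λ x → sumL-sum (λ y s → sum λ z → term x y z s) (allSubsets n)) ⟩
    sum (λ x → sumL (λ s → sum₂ λ y z → term x y z s) (allSubsets n))
      ≡⟨ sumL-sum (λ x s → sum₂ λ y z → term x y z s) (allSubsets n) ⟩
    sumL (λ s → sum₃ λ x y z → term x y z s) (allSubsets n)
      ≤⟨ sumL-mono (allSubsets n) bound ⟩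
    sumL (λ s → 27 * (ι (edge H s) * ι (does (s ⊆? B)))) (allSubsets n)
      ≡⟨ sumL-*ˡ 27 _ (allSubsets n) ⟩
    27 * sumL (λ s → ι (edge H s) * ι (does (s ⊆? B))) (allSubsets n)
      ≡⟨ cong (27 *_) (edgesIn-as-sum B) ⟨
    27 * edgesIn H B ∎
    where
    open ≤-Reasoning
    term : Fin n → Fin n → Fin n → Subset n → ℕ
    term x y z s = χ B x * (χ B y * (χ B z * (same (triple x y z) s * ι (edge H s))))
    push : ∀ x y z → χ B x * (χ B y * (χ B z * sumL (λ s → same (triple x y z) s * ι (edge H s)) (allSubsets n)))
                     ≡ sumL (λ s → term x y z s) (allSubsets n)
    push x y z = sym (trans (sumL-*ˡ (χ B x) _ (allSubsets n)) (cong (χ B x *_)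
      (trans (sumL-*ˡ (χ B y) _ (allSubsets n)) (cong (χ B y *_) (sumL-*ˡ (χ B z) _ (allSubsets n))))))
    or-bits : ∀ {x} {a b c : Bool} → ι (a ∨ (b ∨ c)) ≡ x → (ι a ≡ 1 ⊎ ι b ≡ 1 ⊎ ι c ≡ 1) → x ≡ 1
    or-bits {a = true} refl _ = refl
    or-bits {a = false} {true} refl _ = refl
    or-bits {a = false} {false} {true} refl _ = refl
    or-bits {a = false} {false} {false} refl (inj₁ ())
    or-bits {a = false} {false} {false} refl (inj₂ (inj₁ ()))
    or-bits {a = false} {false} {false} refl (inj₂ (inj₂ ()))
    member : ∀ x y z u → (δ x u ≡ 1 ⊎ δ y u ≡ 1 ⊎ δ z u ≡ 1) → χ (triple x y z) u ≡ 1
    member x y z u = or-bits {a = does (x F.≟ u)} {does (y F.≟ u)} {does (z F.≟ u)} (sym (χ-triple x y z u))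
    cover : ∀ x y z → 0 < χ B x → 0 < χ B y → 0 < χ B z → triple x y z ⊆ B
    cover x y z px py pz {u} u∈ with x∈p∪q⁻ ⁅ x ⁆ (⁅ y ⁆ ∪ ⁅ z ⁆) u∈
    ... | inj₁ q rewrite x∈⁅y⁆⇒x≡y x q = ∈-χ px
    ... | inj₂ q with x∈p∪q⁻ ⁅ y ⁆ ⁅ z ⁆ q
    ...   | inj₁ r rewrite x∈⁅y⁆⇒x≡y y r = ∈-χ py
    ...   | inj₂ r rewrite x∈⁅y⁆⇒x≡y z r = ∈-χ pz
    weight : Subset n → Fin n → Fin n → Fin n → ℕ
    weight s x y z = ι (edge H s) * ι (does (s ⊆? B)) * (χ s x * (χ s y * χ s z))
    term-bit : ∀ s x y z → term x y z s ≤ 1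
    term-bit s x y z = *-mono-≤ (χ≤1 B x) (*-mono-≤ (χ≤1 B y) (*-mono-≤ (χ≤1 B z) (*-mono-≤ (same≤1 (triple x y z) s) (ι≤1 (edge H s)))))
    weight-1 : ∀ s x y z → triple x y z ≡ s → 0 < ι (edge H s) → triple x y z ⊆ B → weight s x y z ≡ 1
    weight-1 s x y z refl pe sub = cong₂ _*_
      (cong₂ _*_ (pos-bit (ι≤1 (edge H s)) pe) (cong ι (dec-true (s ⊆? B) sub)))
      (cong₂ _*_ (member x y z x (inj₁ (δ-refl x))) (cong₂ _*_ (member x y z y (inj₂ (inj₁ (δ-refl y)))) (member x y z z (inj₂ (inj₂ (δ-refl z))))))
    term≤ : ∀ s x y z → term x y z s ≤ weight s x y z
    term≤ s x y z = by-sign (term x y z s) refl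
      where
      by-sign : ∀ t → t ≡ term x y z s → t ≤ weight s x y z
      by-sign zero    eq = z≤n
      by-sign (suc t) eq = ≤-trans (≤-trans (≤-reflexive eq) (term-bit s x y z))
        (≤-reflexive (sym (weight-1 s x y z (same-≡ (triple x y z) s (proj₁ p₄)) (proj₂ p₄) (cover x y z (proj₁ p₁) (proj₁ p₂) (proj₁ p₃)))))
        where
        p₁ = pos-* (χ B x) (subst (0 <_) eq (s≤s z≤n))
        p₂ = pos-* (χ B y) (proj₂ p₁)
        p₃ = pos-* (χ B z) (proj₂ p₂)
        p₄ = pos-* (same (triple x y z) s) (proj₂ p₃)
    bound : ∀ s → sum₃ (λ x y z → term x y z s) ≤ 27 * (ι (edge H s) * ι (does (s ⊆? B)))
    bound s = begin
      sum₃ (λ x y z → term x y z s)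
        ≤⟨ sum-mono (λ x → sum₂-mono λ y z → term≤ s x y z) ⟩
      sum₃ (λ x y z → c * (χ s x * (χ s y * χ s z)))
        ≡⟨ sum-cong-≗ (λ x → trans (sum₂-*ˡ c _) (cong (c *_) (trans (sum₂-*ˡ (χ s x) _) (cong (χ s x *_) (sum₂-product (χ s) (χ s)))))) ⟩
      sum (λ x → c * (χ s x * (sum (χ s) * sum (χ s))))
        ≡⟨ trans (sum-*ˡ c _) (cong (c *_) (sum-*ʳ _ (χ s))) ⟩
      c * (sum (χ s) * (sum (χ s) * sum (χ s)))
        ≡⟨ cong (λ k → c * (k * (k * k))) (sum-χ s) ⟩
      c * (∣ s ∣ * (∣ s ∣ * ∣ s ∣))
        ≤⟨ final ⟩
      27 * c ∎
      where
      c = ι (edge H s) * ι (does (s ⊆? B))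
      final : c * (∣ s ∣ * (∣ s ∣ * ∣ s ∣)) ≤ 27 * c
      final with edge H s in is-edge
      ... | false = z≤n
      ... | true rewrite uniform H s (subst T (sym is-edge) _) = ≤-reflexive (*-comm (1 * ι (does (s ⊆? B))) 27)

  -- The degree hypothesis is doubled, since `sum₂ (e v)` counts ordered pairs; binomials become
  -- squares by `choose2` and subtractions move to the other side. The bound `m≤n+m∸n` is valid even
  -- where the difference in `threshold` is truncated.
  min-degree : ∀ N → n ≡ suc N → ∀ b → (3 * n) / 4 ≡ b → MinDegreeAtLeast H (threshold n) → ∀ v →
    N * N + (b + 2 * cConst n) ≤ sum₂ (e v) + (b * b + N)
  min-degree N refl b refl deg v = begin
    N * N + (b + 2 * c)                       ≡⟨ cong (_+ (b + 2 * c)) (choose2 N) ⟨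
    2 * (N C 2) + N + (b + 2 * c)             ≤⟨ linear 0 (*-monoʳ-≤ 2 (+-mono-≤ (deg v) (m≤n+m∸n (N C 2) (b C 2)))) (certificate (N C 2) (b C 2) (N C 2 ∸ b C 2) c N b (degree H v)) ⟩
    2 * degree H v + (2 * (b C 2) + b + N)    ≡⟨ cong (λ k → 2 * degree H v + (k + N)) (choose2 b) ⟩
    2 * degree H v + (b * b + N)              ≤⟨ +-monoˡ-≤ _ (degree-pairs v) ⟩
    sum₂ (e v) + (b * b + N)                  ∎
    where
    open ≤-Reasoning
    c = cConst n
    certificate : ∀ x y d c N b t → 2 * x + N + (b + 2 * c) + 2 * (t + (y + d)) + 0 ≡ 2 * t + (2 * y + b + N) + 2 * (d + c + x)
    certificate = solve-∀

-- The structure of nearly extremal hypergraphs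

leq-cases : ∀ x y → (leq x y ≡ 1 × x ≤ y) ⊎ (leq x y ≡ 0 × y < x)
leq-cases x y with bit (ι≤1 (x ≤ᵇ y))
... | inj₁ eq = inj₂ (eq , leq-false {x} {y} eq)
... | inj₂ eq = inj₁ (eq , leq-true {x} {y} eq)

leq-yes : ∀ {x y} → x ≤ y → leq x y ≡ 1
leq-yes {x} {y} p with leq-cases x y
... | inj₁ (eq , _) = eq
... | inj₂ (_ , q)  = contradiction p (<⇒≱ q)

leq-no : ∀ {x y} → y < x → leq x y ≡ 0
leq-no {x} {y} p with leq-cases x y
... | inj₁ (_ , q)  = contradiction q (<⇒≱ p)
... | inj₂ (eq , _) = eq

leq-complement : ∀ x y → leq x y + leq (suc y) x ≡ 1
leq-complement x y with leq-cases x y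
... | inj₁ (eq , p) = cong₂ _+_ eq (leq-no (s≤s p))
... | inj₂ (eq , p) = cong₂ _+_ eq (leq-yes p)

leq-* : ∀ t x → leq t x * t ≤ x
leq-* t x with leq-cases t x
... | inj₁ (eq , p) rewrite eq = ≤-trans (≤-reflexive (*-identityˡ t)) p
... | inj₂ (eq , p) rewrite eq = z≤n

module _ {m : ℕ} where

  -- Each vertex of `W` is the first entry of only `m` pairs, and `f` is at most 1 on each.
  change-set : ∀ (X Y W : Fin m → ℕ) (f : Fin m → Fin m → ℕ) → (∀ y → X y ≤ Y y + W y) →
    (∀ y z → f y z ≤ 1) → sum₂ (λ y z → X y * f y z) ≤ sum₂ (λ y z → Y y * f y z) + m * sum W
  change-set X Y W f X≤ f≤1 = begin
    sum₂ (λ y z → X y * f y z)                            ≤⟨ sum₂-mono pointwise ⟩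
    sum₂ (λ y z → Y y * f y z + W y)                      ≡⟨ sum₂-+ ⟩
    sum₂ (λ y z → Y y * f y z) + sum₂ {m} {m} (λ y z → W y) ≡⟨ cong (sum₂ (λ y z → Y y * f y z) +_) (trans (sum-cong-≗ λ y → sum-const m (W y)) (sum-*ˡ m W)) ⟩
    sum₂ (λ y z → Y y * f y z) + m * sum W                ∎
    where
    open ≤-Reasoning
    pointwise : ∀ y z → X y * f y z ≤ Y y * f y z + W y
    pointwise y z = ≤-trans (*-monoˡ-≤ (f y z) (X≤ y))
      (≤-trans (≤-reflexive (*-distribʳ-+ (f y z) (Y y) (W y))) (+-monoʳ-≤ (Y y * f y z) (*bit≤ (W y) (f≤1 y z))))

  -- The two entries are changed one after the other, with the order of summation reversed in
  -- between.
  change-sets : ∀ (X Y W : Fin m → ℕ) (f : Fin m → Fin m → ℕ) → (∀ y → X y ≤ 1) → (∀ y → Y y ≤ 1) →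
    (∀ y → X y ≤ Y y + W y) → (∀ y z → f y z ≤ 1) →
    sum₂ (λ y z → X y * (X z * f y z)) ≤ sum₂ (λ y z → Y y * (Y z * f y z)) + (m * sum W + m * sum W)
  change-sets X Y W f X≤1 Y≤1 X≤ f≤1 = begin
    sum₂ (λ y z → X y * (X z * f y z))
      ≤⟨ change-set X Y W (λ y z → X z * f y z) X≤ (λ y z → *-bit (X≤1 z) (f≤1 y z)) ⟩
    sum₂ (λ y z → Y y * (X z * f y z)) + m * sum W
      ≡⟨ cong (_+ m * sum W) (turn Y X) ⟩
    sum₂ (λ z y → X z * (Y y * f y z)) + m * sum W
      ≤⟨ +-monoˡ-≤ (m * sum W) (change-set X Y W (λ z y → Y y * f y z) X≤ (λ z y → *-bit (Y≤1 y) (f≤1 y z))) ⟩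
    sum₂ (λ z y → Y z * (Y y * f y z)) + m * sum W + m * sum W
      ≡⟨ cong (λ k → k + m * sum W + m * sum W) (turn Y Y) ⟨
    sum₂ (λ y z → Y y * (Y z * f y z)) + m * sum W + m * sum W
      ≡⟨ +-assoc _ (m * sum W) (m * sum W) ⟩
    sum₂ (λ y z → Y y * (Y z * f y z)) + (m * sum W + m * sum W) ∎
    where
    open ≤-Reasoning
    exchange : ∀ x y z → x * (y * z) ≡ y * (x * z)
    exchange = solve-∀
    turn : ∀ P Q → sum₂ (λ y z → P y * (Q z * f y z)) ≡ sum₂ (λ z y → Q z * (P y * f y z))
    turn P Q = trans (sum₂-cong λ y z → exchange (P y) (Q z) (f y z)) (∑-comm λ y z → Q z * (P y * f y z))

-- The vertices are split by D v, the number of ordered pairs of B₀ completing v to an edge: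
-- B holds the v with D v < θ, the rest is A, and Core ⊆ A holds those missing fewer than θ pairs.
-- W collects the vertices on which the partitions (A₀, B₀) and (Core, B) disagree.
module Structure (N : ℕ) (e : Fin (suc N) → Fin (suc N) → Fin (suc N) → ℕ)
  (e≤1 : ∀ x y z → e x y z ≤ 1) (e-swap₁₂ : ∀ x y z → e x y z ≡ e y x z)
  (B₀ : Fin (suc N) → ℕ) (B₀≤1 : ∀ v → B₀ v ≤ 1) (b₀ : ℕ) (sum-B₀ : sum B₀ ≡ b₀) (c X w θ : ℕ)
  (min-degree : ∀ v → N * N + (b₀ + 2 * c) ≤ sum₂ (e v) + (b₀ * b₀ + N))
  (extremal : sum (λ v → B₀ v * sum₂ (λ y z → B₀ y * (B₀ z * e v y z))) ≤ X)
  (small : suc N * (3 * suc N) + 2 * X < suc w * θ) (2θ≤b₀² : 2 * θ ≤ b₀ * b₀)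
  where

  n : ℕ
  n = suc N

  ē : Fin n → Fin n → Fin n → ℕ
  ē x y z = 1 ∸ e x y z

  e+ē : ∀ x y z → e x y z + ē x y z ≡ 1
  e+ē x y z = m+[n∸m]≡n (e≤1 x y z)

  ē≤1 : ∀ x y z → ē x y z ≤ 1
  ē≤1 x y z = m∸n≤m 1 (e x y z)

  ē-swap₁₂ : ∀ x y z → ē x y z ≡ ē y x z
  ē-swap₁₂ x y z = cong (1 ∸_) (e-swap₁₂ x y z)

  A₀ : Fin n → ℕ
  A₀ v = 1 ∸ B₀ v

  A₀+B₀ : ∀ v → A₀ v + B₀ v ≡ 1
  A₀+B₀ v = m∸n+n≡m (B₀≤1 v)

  D D̄ : Fin n → ℕ
  D v = sum₂ λ y z → B₀ y * (B₀ z * e v y z)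
  D̄ v = sum₂ λ y z → B₀ y * (B₀ z * ē v y z)

  D+D̄ : ∀ v → D v + D̄ v ≡ b₀ * b₀
  D+D̄ v = begin
    D v + D̄ v                         ≡⟨ sum₂-+ ⟨
    sum₂ (λ y z → B₀ y * (B₀ z * e v y z) + B₀ y * (B₀ z * ē v y z))
      ≡⟨ sum₂-cong (λ y z → trans (merge (B₀ y) (B₀ z) (e v y z) (ē v y z)) (trans (cong (B₀ y * B₀ z *_) (e+ē v y z)) (*-identityʳ _))) ⟩
    sum₂ (λ y z → B₀ y * B₀ z)        ≡⟨ sum₂-product B₀ B₀ ⟩
    sum B₀ * sum B₀                   ≡⟨ cong₂ _*_ sum-B₀ sum-B₀ ⟩
    b₀ * b₀                           ∎
    where
    open ≡-Reasoning
    merge : ∀ x y p q → x * (y * p) + x * (y * q) ≡ x * y * (p + q)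
    merge = solve-∀

  -- By the degree condition at most `b₀ * b₀ + 3 * n` ordered pairs are missing at `v`. Of these,
  -- `b₀ * b₀` minus `D v` lie inside the set `B₀`, which leaves `3 * n + D v` for the pairs
  -- starting in `A₀`.
  A₀-missing : ∀ v → sum₂ (λ y z → A₀ y * ē v y z) ≤ 3 * n + D v
  A₀-missing v = linear (2 + b₀ + 2 * c)
    (+-mono-≤ (min-degree v) (+-mono-≤ (≤-reflexive split) (+-mono-≤ (≤-reflexive (sym (D+D̄ v))) D̄≤)))
    (certificate N b₀ c (sum₂ (e v)) (sum₂ λ y z → A₀ y * ē v y z) (sum₂ λ y z → B₀ y * ē v y z) (D v) (D̄ v))
    where
    D̄≤ : D̄ v ≤ sum₂ (λ y z → B₀ y * ē v y z)
    D̄≤ = sum₂-mono λ y z → *-monoʳ-≤ (B₀ y) (bit*≤ (ē v y z) (B₀≤1 z))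
    pointwise : ∀ y z → e v y z + (A₀ y * ē v y z + B₀ y * ē v y z) ≡ 1
    pointwise y z = trans (cong (e v y z +_) (trans (sym (*-distribʳ-+ (ē v y z) (A₀ y) (B₀ y)))
      (trans (cong (_* ē v y z) (A₀+B₀ y)) (*-identityˡ _)))) (e+ē v y z)
    split : sum₂ (e v) + (sum₂ (λ y z → A₀ y * ē v y z) + sum₂ (λ y z → B₀ y * ē v y z)) ≡ suc N * suc N
    split = trans (cong (sum₂ (e v) +_) (sym sum₂-+)) (trans (sym sum₂-+)
      (trans (sum₂-cong pointwise) (trans (sum₂-const n n 1) (cong (n *_) (*-identityʳ n)))))
    certificate : ∀ N b c t x y d d̄ →
      x + (t + (b * b + N) + (suc N * suc N + (d + d̄ + y))) + (2 + b + 2 * c)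
      ≡ 3 * suc N + d + (N * N + (b + 2 * c) + (t + (x + y) + (b * b + d̄)))
    certificate = solve-∀

  -- Missing triples with one vertex in `A₀` and two in `B₀` are counted from a vertex `y` of `B₀`
  -- instead: there `A₀-missing` gives `3 * n + D y`, and the sum of `D` over `B₀` is small by
  -- extremality.
  sum-A₀D̄ : sum (λ v → A₀ v * D̄ v) ≤ n * (3 * n) + X
  sum-A₀D̄ = begin
    sum (λ v → A₀ v * D̄ v)
      ≡⟨ sum-cong-≗ (λ v → sum₂-*ˡ (A₀ v) λ y z → B₀ y * (B₀ z * ē v y z)) ⟨
    sum (λ v → sum₂ λ y z → A₀ v * (B₀ y * (B₀ z * ē v y z)))
      ≤⟨ sum-mono (λ v → sum₂-mono λ y z → pointwise v y z) ⟩
    sum (λ v → sum₂ λ y z → B₀ y * (A₀ v * ē y v z))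
      ≡⟨ ∑-comm (λ v y → sum λ z → B₀ y * (A₀ v * ē y v z)) ⟩
    sum (λ y → sum₂ λ v z → B₀ y * (A₀ v * ē y v z))
      ≡⟨ sum-cong-≗ (λ y → sum₂-*ˡ (B₀ y) λ v z → A₀ v * ē y v z) ⟩
    sum (λ y → B₀ y * sum₂ λ v z → A₀ v * ē y v z)
      ≤⟨ sum-mono (λ y → *-monoʳ-≤ (B₀ y) (A₀-missing y)) ⟩
    sum (λ y → B₀ y * (3 * n + D y))
      ≤⟨ sum-mono (λ y → ≤-trans (≤-reflexive (*-distribˡ-+ (B₀ y) (3 * n) (D y))) (+-monoˡ-≤ (B₀ y * D y) (bit*≤ (3 * n) (B₀≤1 y)))) ⟩
    sum (λ y → 3 * n + B₀ y * D y)
      ≡⟨ sum-+ ⟩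
    sum {n} (λ _ → 3 * n) + sum (λ y → B₀ y * D y)
      ≤⟨ +-mono-≤ (≤-reflexive (sum-const n (3 * n))) extremal ⟩
    n * (3 * n) + X ∎
    where
    open ≤-Reasoning
    exchange : ∀ x y z → x * (y * z) ≡ y * (x * z)
    exchange = solve-∀
    pointwise : ∀ v y z → A₀ v * (B₀ y * (B₀ z * ē v y z)) ≤ B₀ y * (A₀ v * ē y v z)
    pointwise v y z = ≤-trans (≤-reflexive (exchange (A₀ v) (B₀ y) (B₀ z * ē v y z)))
      (*-monoʳ-≤ (B₀ y) (*-monoʳ-≤ (A₀ v) (≤-trans (bit*≤ (ē v y z) (B₀≤1 z)) (≤-reflexive (ē-swap₁₂ v y z)))))

  opaque
    B A Core W : Fin n → ℕ
    B v = leq (suc (D v)) θ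
    A v = leq θ (D v)
    Core v = leq (suc (D̄ v)) θ
    W v = B₀ v * leq θ (D v) + A₀ v * leq θ (D̄ v)

    B≤1 : ∀ v → B v ≤ 1
    B≤1 v = ι≤1 _

    A≤1 : ∀ v → A v ≤ 1
    A≤1 v = ι≤1 _

    A+B : ∀ v → A v + B v ≡ 1
    A+B v = leq-complement θ (D v)

    B⇒D<θ : ∀ {v} → B v ≡ 1 → D v < θ
    B⇒D<θ {v} = leq-true {suc (D v)}

    A⇒θ≤D : ∀ {v} → A v ≡ 1 → θ ≤ D v
    A⇒θ≤D {v} = leq-true {θ}

    Core⇒D̄<θ : ∀ {v} → Core v ≡ 1 → D̄ v < θ
    Core⇒D̄<θ {v} = leq-true {suc (D̄ v)}

    Core≤1 : ∀ v → Core v ≤ 1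
    Core≤1 v = ι≤1 _

    W-heavy : ∀ {v} → θ ≤ D v → θ ≤ D̄ v → W v ≡ 1
    W-heavy {v} p q = begin
      B₀ v * leq θ (D v) + A₀ v * leq θ (D̄ v) ≡⟨ cong₂ (λ x y → B₀ v * x + A₀ v * y) (leq-yes p) (leq-yes q) ⟩
      B₀ v * 1 + A₀ v * 1 ≡⟨ cong₂ _+_ (*-identityʳ (B₀ v)) (*-identityʳ (A₀ v)) ⟩
      B₀ v + A₀ v         ≡⟨ +-comm (B₀ v) (A₀ v) ⟩
      A₀ v + B₀ v         ≡⟨ A₀+B₀ v ⟩
      1 ∎
      where open ≡-Reasoning

    -- There are at least `2 * θ` pairs in total, so the two counts cannot both be below `θ`; in
    -- particular `B` and `Core` are disjoint.
    D<θ⇒θ≤D̄ : ∀ {v} → D v < θ → θ ≤ D̄ v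
    D<θ⇒θ≤D̄ {v} p = linear 1 (+-mono-≤ p (+-mono-≤ 2θ≤b₀² (≤-reflexive (sym (D+D̄ v))))) (certificate θ (D v) (D̄ v) (b₀ * b₀))
      where
      certificate : ∀ t d d̄ b → t + (t + (b + (d + d̄))) + 1 ≡ d̄ + (suc d + (2 * t + b))
      certificate = solve-∀

    B≤B₀+W : ∀ v → B v ≤ B₀ v + W v
    B≤B₀+W v with leq-cases (suc (D v)) θ
    ... | inj₂ (eq , _) rewrite eq = z≤n
    ... | inj₁ (eq , D<θ) rewrite eq | leq-yes (D<θ⇒θ≤D̄ {v} D<θ) | *-identityʳ (A₀ v) =
      ≤-trans (≤-reflexive (trans (sym (A₀+B₀ v)) (+-comm (A₀ v) (B₀ v)))) (+-monoʳ-≤ (B₀ v) (m≤n+m (A₀ v) _))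

    B₀≤B+W : ∀ v → B₀ v ≤ B v + W v
    B₀≤B+W v with leq-cases θ (D v)
    ... | inj₁ (eq , p) rewrite eq | *-identityʳ (B₀ v) = ≤-trans (m≤m+n (B₀ v) _) (m≤n+m _ (B v))
    ... | inj₂ (eq , p) = ≤-trans (B₀≤1 v) (≤-trans (≤-reflexive (sym (leq-yes p))) (m≤m+n (B v) (W v)))

    A≤Core+W : ∀ v → A v ≤ Core v + W v
    A≤Core+W v with leq-cases (suc (D̄ v)) θ | leq-cases θ (D v)
    ... | inj₁ (eq , _) | _ = ≤-trans (A≤1 v) (≤-trans (≤-reflexive (sym eq)) (m≤m+n (Core v) (W v)))
    ... | inj₂ (_ , q) | inj₁ (_ , p) = ≤-trans (A≤1 v) (≤-trans (≤-reflexive (sym (W-heavy {v} p (≤-pred q)))) (m≤n+m (W v) (Core v)))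
    ... | inj₂ _ | inj₂ (eq , _) = ≤-trans (≤-reflexive eq) z≤n

    -- Each vertex of `W` contributes at least `θ` to the sum of `D` over `B₀` plus the sum of `D̄`
    -- over `A₀`. Both sums are under control, and `small` is the resulting Markov estimate.
    sum-W : sum W ≤ w
    sum-W = ≤-pred (*-cancelʳ-< θ (sum W) (suc w) (begin-strict
      sum W * θ                                   ≡⟨ sum-*ʳ θ W ⟨
      sum (λ v → W v * θ)                         ≤⟨ sum-mono pointwise ⟩
      sum (λ v → B₀ v * D v + A₀ v * D̄ v)         ≡⟨ sum-+ ⟩
      sum (λ v → B₀ v * D v) + sum (λ v → A₀ v * D̄ v) ≤⟨ +-mono-≤ extremal sum-A₀D̄ ⟩
      X + (n * (3 * n) + X)                       ≡⟨ reorder X (n * (3 * n)) ⟩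
      n * (3 * n) + 2 * X                         <⟨ small ⟩
      suc w * θ                                   ∎))
      where
      open ≤-Reasoning
      reorder : ∀ x y → x + (y + x) ≡ y + 2 * x
      reorder = solve-∀
      pull : ∀ p q r s t → (p * q + r * s) * t ≡ p * (q * t) + r * (s * t)
      pull = solve-∀
      pointwise : ∀ v → W v * θ ≤ B₀ v * D v + A₀ v * D̄ v
      pointwise v = ≤-trans (≤-reflexive (pull (B₀ v) (leq θ (D v)) (A₀ v) (leq θ (D̄ v)) θ))
        (+-mono-≤ (*-monoʳ-≤ (B₀ v) (leq-* θ (D v))) (*-monoʳ-≤ (A₀ v) (leq-* θ (D̄ v))))

  A≤A₀+W : ∀ v → A v ≤ A₀ v + W v
  A≤A₀+W v = linear 0 (+-mono-≤ (B₀≤B+W v) (+-mono-≤ (≤-reflexive (A+B v)) (≤-reflexive (sym (A₀+B₀ v)))))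
    (certificate (A v) (B v) (A₀ v) (B₀ v) (W v))
    where
    certificate : ∀ a b a₀ b₀ w → a + (b + w + (1 + (a₀ + b₀))) + 0 ≡ a₀ + w + (b₀ + (a + b + 1))
    certificate = solve-∀

  n*W≤ : n * sum W ≤ n * w
  n*W≤ = *-monoʳ-≤ n sum-W

  -- The entry `z` ranges over all vertices, so the same bound serves a vertex of `B` as a link and
  -- as a middle vertex.
  B-missing : ∀ {v} → B v ≡ 1 → sum₂ (λ y z → A y * ē v y z) ≤ 3 * n + θ + n * w
  B-missing {v} p = ≤-trans (change-set A A₀ W (ē v) A≤A₀+W (ē≤1 v))
    (+-mono-≤ (≤-trans (A₀-missing v) (+-monoʳ-≤ (3 * n) (<⇒≤ (B⇒D<θ p)))) n*W≤)

  B-degree : ∀ {v} → B v ≡ 1 → sum₂ (λ y z → B y * (B z * e v y z)) ≤ θ + (n * w + n * w)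
  B-degree {v} p = ≤-trans (change-sets B B₀ W (e v) B≤1 B₀≤1 B≤B₀+W (e≤1 v))
    (+-mono-≤ (<⇒≤ (B⇒D<θ p)) (+-mono-≤ n*W≤ n*W≤))

  Core-missing : ∀ {v} → Core v ≡ 1 → sum₂ (λ y z → B y * (B z * ē v y z)) ≤ θ + (n * w + n * w)
  Core-missing {v} p = ≤-trans (change-sets B B₀ W (ē v) B≤1 B₀≤1 B≤B₀+W (ē≤1 v))
    (+-mono-≤ (<⇒≤ (Core⇒D̄<θ p)) (+-mono-≤ n*W≤ n*W≤))

  A-degree : ∀ {v} → A v ≡ 1 → θ ≤ sum₂ (λ y z → B y * (B z * e v y z)) + (n * w + n * w)
  A-degree {v} p = ≤-trans (A⇒θ≤D p) (≤-trans (change-sets B₀ B W (e v) B₀≤1 B≤1 B₀≤B+W (e≤1 v))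
    (+-monoʳ-≤ (sum₂ λ y z → B y * (B z * e v y z)) (+-mono-≤ n*W≤ n*W≤)))

-- Greedy construction of segments

-- A loose path from its start is a list of (middle vertex , next link vertex) pairs.
module Segments {n} (e : Fin n → Fin n → Fin n → ℕ) (B : Fin n → ℕ) where

  Steps : Set
  Steps = List (Fin n × Fin n)

  Chain : Fin n → Steps → Fin n → Set
  Chain x []             z = x ≡ z
  Chain x ((m , l) ∷ ps) z = e x m l ≡ 1 × Chain l ps z

  flat : Steps → List (Fin n)
  flat []             = []
  flat ((m , l) ∷ ps) = m ∷ l ∷ flat ps

  -- A segment without steps is a single link vertex of `B`; such segments later fill up the number
  -- of blocks.
  record Segment : Set where
    field
      start end : Fin n
      steps     : Steps
      chain     : Chain start steps end
      start∈B   : B start ≡ 1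
      end∈B     : B end ≡ 1

    vertices : List (Fin n)
    vertices = start ∷ flat steps
  open Segment public

  allVertices : List Segment → List (Fin n)
  allVertices []       = []
  allVertices (s ∷ ss) = vertices s ++ allVertices ss

  length≤ : ∀ ss → length ss ≤ length (allVertices ss)
  length≤ []       = z≤n
  length≤ (s ∷ ss) = s≤s (≤-trans (length≤ ss) (≤-trans (m≤n+m _ (length (flat (steps s))))
    (≤-reflexive (sym (length-++ (flat (steps s)))))))

0<1*1*1 : ∀ {x y z} → x ≤ 1 → y ≤ 1 → z ≤ 1 → 0 < x * (y * z) → x ≡ 1 × y ≡ 1 × z ≡ 1
0<1*1*1 {x} {y} {z} p q r pos = pos-bit p (proj₁ s) , pos-bit q (proj₁ t) , pos-bit r (proj₂ t)
  where
  s = pos-* x pos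
  t = pos-* y (proj₂ s)

module ThreeGraph {n} (e : Fin n → Fin n → Fin n → ℕ)
  (e-swap₁₂ : ∀ x y z → e x y z ≡ e y x z) (e-swap₂₃ : ∀ x y z → e x y z ≡ e x z y)
  (e-diag : ∀ x y → e x x y ≡ 0) where

  e-diag₂₃ : ∀ x y → e x y y ≡ 0
  e-diag₂₃ x y = trans (e-swap₁₂ x y y) (trans (e-swap₂₃ y x y) (e-diag y x))

  distinct₂₃ : ∀ {x y z} → e x y z ≡ 1 → y ≢ z
  distinct₂₃ {x} {y} p refl = contradiction (trans (sym p) (e-diag₂₃ x y)) λ ()

  distinct₁₂ : ∀ {x y z} → e x y z ≡ 1 → x ≢ y
  distinct₁₂ {x} {y} {z} p refl = contradiction (trans (sym p) (e-diag x z)) λ ()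

  distinct₁₃ : ∀ {x y z} → e x y z ≡ 1 → x ≢ z
  distinct₁₃ {x} {y} {z} p = distinct₁₂ (trans (sym (e-swap₂₃ x y z)) p)

module Greedy {n} (e : Fin n → Fin n → Fin n → ℕ) (e≤1 : ∀ x y z → e x y z ≤ 1)
  (e-swap₁₂ : ∀ x y z → e x y z ≡ e y x z) (e-swap₂₃ : ∀ x y z → e x y z ≡ e x z y)
  (e-diag : ∀ x y → e x x y ≡ 0)
  (A B : Fin n → ℕ) (A+B : ∀ v → A v + B v ≡ 1) (w θ : ℕ)
  (A-degree : ∀ {v} → A v ≡ 1 → θ ≤ sum₂ (λ y z → B y * (B z * e v y z)) + (n * w + n * w))
  where

  open Segments e B
  open ThreeGraph e e-swap₁₂ e-swap₂₃ e-diag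

  A≤1 : ∀ v → A v ≤ 1
  A≤1 v = ≤-trans (m≤m+n (A v) (B v)) (≤-reflexive (A+B v))

  B≤1 : ∀ v → B v ≤ 1
  B≤1 v = ≤-trans (m≤n+m (B v) (A v)) (≤-reflexive (A+B v))

  record Partition (U : List (Fin n)) (R S : Fin n → ℕ) : Set where
    field
      total : ∀ v → mult U v + (R v + S v) ≡ 1
      R≤A   : ∀ v → R v ≤ A v
      S≤B   : ∀ v → S v ≤ B v

    B≤S+U : ∀ v → B v ≤ S v + mult U v
    B≤S+U v = linear 0 (+-mono-≤ (R≤A v) (+-mono-≤ (≤-reflexive (A+B v)) (≤-reflexive (sym (total v)))))
      (certificate (A v) (B v) (R v) (S v) (mult U v))
      where
      certificate : ∀ a b r s u → b + (a + (1 + (u + (r + s)))) + 0 ≡ s + u + (r + (a + b + 1))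
      certificate = solve-∀

    size : length U + (sum R + sum S) ≡ n
    size = begin
      length U + (sum R + sum S)                ≡⟨ cong₂ _+_ (sum-mult U) sum-+ ⟨
      sum (mult U) + sum (λ v → R v + S v)      ≡⟨ sum-+ ⟨
      sum (λ v → mult U v + (R v + S v))        ≡⟨ sum-cong-≗ total ⟩
      sum {n} (λ _ → 1)                         ≡⟨ trans (sum-const n 1) (*-identityʳ n) ⟩
      n                                         ∎
      where open ≡-Reasoning
  open Partition public

  use-R : ∀ {U R S} x → Partition U R S → R x ≡ 1 → ∃ λ R′ → Partition (x ∷ U) R′ S × sum R ≡ suc (sum R′)
  use-R {U} {R} {S} x P p = R′ , record
    { total = λ v → trans (trans (shift (δ x v) (mult U v) (R′ v) (S v)) (cong (λ r → mult U v + (r + S v)) (sym (split v)))) (total P v)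
    ; R≤A = λ v → ≤-trans (m≤n+m (R′ v) (δ x v)) (≤-trans (≤-reflexive (sym (split v))) (R≤A P v))
    ; S≤B = S≤B P } , count
    where
    t = take-out {f = R} x p
    R′ = proj₁ t
    split = proj₁ (proj₂ t)
    count = proj₂ (proj₂ t)
    shift : ∀ d u r s → d + u + (r + s) ≡ u + (d + r + s)
    shift = solve-∀

  use-S : ∀ {U R S} x → Partition U R S → S x ≡ 1 → ∃ λ S′ → Partition (x ∷ U) R S′ ×
    (∀ v → S v ≡ δ x v + S′ v) × sum S ≡ suc (sum S′)
  use-S {U} {R} {S} x P p = S′ , record
    { total = λ v → trans (trans (shift (δ x v) (mult U v) (R v) (S′ v)) (cong (λ s → mult U v + (R v + s)) (sym (split v)))) (total P v)
    ; R≤A = R≤A P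
    ; S≤B = λ v → ≤-trans (m≤n+m (S′ v) (δ x v)) (≤-trans (≤-reflexive (sym (split v))) (S≤B P v)) } , split , count
    where
    t = take-out {f = S} x p
    S′ = proj₁ t
    split = proj₁ (proj₂ t)
    count = proj₂ (proj₂ t)
    shift : ∀ d u r s → d + u + (r + s) ≡ u + (r + (d + s))
    shift = solve-∀

  same-support : ∀ {U U′ R S} → (∀ v → mult U′ v ≡ mult U v) → Partition U R S → Partition U′ R S
  same-support {R = R} {S} eq P = record
    { total = λ v → trans (cong (_+ (R v + S v)) (eq v)) (total P v) ; R≤A = R≤A P ; S≤B = S≤B P }

  record Pair (U : List (Fin n)) (R S : Fin n → ℕ) (a : Fin n) : Set where
    field
      y z   : Fin n
      joined  : e a y z ≡ 1
      y∈B   : B y ≡ 1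
      z∈B   : B z ≡ 1
      S′    : Fin n → ℕ
      rest  : Partition (y ∷ z ∷ U) R S′
      count : sum S ≡ 2 + sum S′

  opaque
    -- At least `θ` minus `2 * (n * w)` ordered pairs inside `B` complete `a` to an edge, and each
    -- used vertex spoils at most `2 * n` of them.
    pick-pair : ∀ {U R S} a → A a ≡ 1 → Partition U R S → 2 * (n * w + n * length U) < θ → Pair U R S a
    pick-pair {U} {R} {S} a a∈A P room = record
      { y = y ; z = z ; joined = joined ; y∈B = in-B y Sy ; z∈B = in-B z Sz
      ; S′ = proj₁ without-y ; rest = proj₁ (proj₂ without-y)
      ; count = trans (proj₂ (proj₂ (proj₂ without-z))) (cong suc (proj₂ (proj₂ (proj₂ without-y)))) }
      where
      S≤1 : ∀ v → S v ≤ 1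
      S≤1 v = ≤-trans (S≤B P v) (B≤1 v)
      many : 0 < sum₂ (λ y z → S y * (S z * e a y z))
      many = linear 0 (+-mono-≤ room (+-mono-≤ (A-degree a∈A) (≤-trans
          (change-sets B S (mult U) (e a) B≤1 S≤1 (B≤S+U P) (e≤1 a))
          (≤-reflexive (cong (λ k → sum₂ (λ y z → S y * (S z * e a y z)) + (n * k + n * k)) (sum-mult U))))))
        (certificate θ (n * w) (n * length U) (sum₂ λ y z → B y * (B z * e a y z)) (sum₂ λ y z → S y * (S z * e a y z)))
        where
        certificate : ∀ t p q b s → 1 + (t + (b + (p + p) + (s + (q + q)))) + 0 ≡ s + (suc (2 * (p + q)) + (t + b))
        certificate = solve-∀
      found : ∃ λ y → ∃ λ z → 0 < S y * (S z * e a y z)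
      found = sum₂-pos many
      y z : Fin n
      y = proj₁ found
      z = proj₁ (proj₂ found)
      facts : S y ≡ 1 × S z ≡ 1 × e a y z ≡ 1
      facts = 0<1*1*1 (S≤1 y) (S≤1 z) (e≤1 a y z) (proj₂ (proj₂ found))
      Sy : S y ≡ 1
      Sy = proj₁ facts
      Sz : S z ≡ 1
      Sz = proj₁ (proj₂ facts)
      joined : e a y z ≡ 1
      joined = proj₂ (proj₂ facts)
      in-B : ∀ v → S v ≡ 1 → B v ≡ 1
      in-B v p = pos-bit (B≤1 v) (≤-trans (≤-reflexive (sym p)) (S≤B P v))
      without-z : ∃ λ S′ → Partition (z ∷ U) R S′ × (∀ v → S v ≡ δ z v + S′ v) × sum S ≡ suc (sum S′)
      without-z = use-S z P Sz
      without-y : ∃ λ S′ → Partition (y ∷ z ∷ U) R S′ × (∀ v → proj₁ without-z v ≡ δ y v + S′ v) × sum (proj₁ without-z) ≡ suc (sum S′)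
      without-y = use-S y (proj₁ (proj₂ without-z)) (rest-at (proj₁ (proj₂ (proj₂ without-z))) (distinct₂₃ joined ∘ sym) Sy)

  -- j counts the segments through a single A-vertex still to be built. At j = 0 the balance says that
  -- S fills the cycle exactly: its 3 (sum R) slots for B-vertices are one link and two middles for
  -- each vertex of R, and each segment already built supplies one of these links.
  record State (j u : ℕ) : Set where
    field
      segments : List Segment
      R S      : Fin n → ℕ
      part     : Partition (allVertices segments) R S
      balance  : sum S + length segments + 2 * j ≡ 3 * sum R
      few      : length (allVertices segments) ≤ u
  open State public

  -- The segment y, a, z has its A-vertex in the middle. It removes 1 from `sum R` and 2 from
  -- `sum S` and adds a segment, so the excess of `3 * sum R` over the first two terms of `balance`
  -- drops by 2.
  one-A-segment : ∀ {j u} → 2 * (n * w + n * suc u) < θ → State (suc j) u → State j (3 + u)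
  one-A-segment {j} {u} room st = record
    { segments = segment ∷ segments st ; R = R′ ; S = S′ ; part = part′ ; balance = balance′ ; few = +-monoʳ-≤ 3 (few st) }
    where
    U = allVertices (segments st)
    someA : ∃ λ a → 0 < R st a
    someA = sum-pos (positive (sum (R st)) (≤-trans (≤-trans (s≤s z≤n) (m≤n+m (2 * suc j) _)) (≤-reflexive (balance st))))
      where
      positive : ∀ k → 0 < 3 * k → 0 < k
      positive (suc k) _ = s≤s z≤n
    a = proj₁ someA
    Ra : R st a ≡ 1
    Ra = pos-bit (≤-trans (R≤A (part st) a) (A≤1 a)) (proj₂ someA)
    a∈A : A a ≡ 1
    a∈A = pos-bit (A≤1 a) (≤-trans (proj₂ someA) (R≤A (part st) a))
    used-a = use-R a (part st) Ra
    R′ = proj₁ used-a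
    pair : Pair (a ∷ U) R′ (S st) a
    pair = pick-pair a a∈A (proj₁ (proj₂ used-a))
      (≤-<-trans (*-monoʳ-≤ 2 (+-monoʳ-≤ (n * w) (*-monoʳ-≤ n (s≤s (few st))))) room)
    open Pair pair using (y; z; joined; y∈B; z∈B; S′; rest; count)
    segment : Segment
    segment = record { start = y ; end = z ; steps = (a , z) ∷ []
      ; chain = trans (e-swap₁₂ y a z) joined , refl ; start∈B = y∈B ; end∈B = z∈B }
    part′ : Partition (y ∷ a ∷ z ∷ U) R′ S′
    part′ = same-support (λ v → swap (δ y v) (δ a v) (δ z v) (mult U v)) rest
      where
      swap : ∀ p q r u → p + (q + (r + u)) ≡ p + (r + (q + u))
      swap = solve-∀
    balance′ : sum S′ + suc (length (segments st)) + 2 * j ≡ 3 * sum R′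
    balance′ = +-cancelʳ-≡ 3 _ _ (trans (certificate (sum S′) (length (segments st)) j)
      (trans (cong (λ s → s + length (segments st) + 2 * suc j) (sym count))
      (trans (balance st) (trans (cong (3 *_) (proj₂ (proj₂ used-a))) (certificate′ (sum R′))))))
      where
      certificate : ∀ s l j → s + suc l + 2 * j + 3 ≡ 2 + s + l + 2 * suc j
      certificate = solve-∀
      certificate′ : ∀ r → 3 * suc r ≡ 3 * r + 3
      certificate′ = solve-∀

  A-segments : ∀ j {u v} → 3 * j + u ≤ v → 2 * (n * w + n * v) < θ → State j u → State 0 v
  A-segments zero    {u} {v} fit room st = record
    { segments = segments st ; R = R st ; S = S st ; part = part st ; balance = balance st ; few = ≤-trans (few st) fit }
  A-segments (suc j) {u} {v} fit room st = A-segments j fit′ room (one-A-segment room′ st)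
    where
    fit′ : 3 * j + (3 + u) ≤ v
    fit′ = ≤-trans (≤-reflexive (regroup j u)) fit
      where
      regroup : ∀ j u → 3 * j + (3 + u) ≡ 3 * suc j + u
      regroup = solve-∀
    room′ : 2 * (n * w + n * suc u) < θ
    room′ = ≤-<-trans (*-monoʳ-≤ 2 (+-monoʳ-≤ (n * w) (*-monoʳ-≤ n (≤-trans (m≤n+m (suc u) (3 * j + 2)) (≤-trans (≤-reflexive (regroup j u)) fit))))) room
      where
      regroup : ∀ j u → 3 * j + 2 + suc u ≡ 3 * suc j + u
      regroup = solve-∀

  -- All that is known of `a` is that it has many edges to pairs of `B`. It becomes the inner link
  -- of y, z, a, y′, z′: four vertices of `B` and one new segment against one vertex of `A` leave
  -- the balance unchanged.
  absorb-one : ∀ {u} a → (st : State 0 u) → R st a ≡ 1 → 2 * (n * w + n * (3 + u)) < θ →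
    ∃ λ (st′ : State 0 (5 + u)) → (∀ v → R st v ≡ δ a v + R st′ v)
  absorb-one {u} a st Ra room = record
    { segments = segment ∷ segments st ; R = R′ ; S = S″ ; part = part′ ; balance = balance′ ; few = +-monoʳ-≤ 5 (few st) } , proj₁ (proj₂ taken)
    where
    U = allVertices (segments st)
    taken = take-out {f = R st} a Ra
    a∈A : A a ≡ 1
    a∈A = pos-bit (A≤1 a) (≤-trans (≤-reflexive (sym Ra)) (R≤A (part st) a))
    used-a = use-R a (part st) Ra
    R′ = proj₁ used-a
    room₁ : ∀ {k} → k ≤ 3 → 2 * (n * w + n * (k + length U)) < θ
    room₁ k≤3 = ≤-<-trans (*-monoʳ-≤ 2 (+-monoʳ-≤ (n * w) (*-monoʳ-≤ n (+-mono-≤ k≤3 (few st))))) room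
    pair₁ : Pair (a ∷ U) R′ (S st) a
    pair₁ = pick-pair a a∈A (proj₁ (proj₂ used-a)) (room₁ {1} (s≤s z≤n))
    open Pair pair₁ using (y; z)
    S′ = Pair.S′ pair₁
    pair₂ : Pair (y ∷ z ∷ a ∷ U) R′ S′ a
    pair₂ = pick-pair a a∈A (Pair.rest pair₁) (room₁ {3} ≤-refl)
    y′ = Pair.y pair₂
    z′ = Pair.z pair₂
    S″ = Pair.S′ pair₂
    segment : Segment
    segment = record { start = y ; end = z′ ; steps = (z , a) ∷ (y′ , z′) ∷ []
      ; chain = trans (e-swap₂₃ y z a) (trans (e-swap₁₂ y a z) (Pair.joined pair₁)) , Pair.joined pair₂ , refl
      ; start∈B = Pair.y∈B pair₁ ; end∈B = Pair.z∈B pair₂ }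
    part′ : Partition (y ∷ z ∷ a ∷ y′ ∷ z′ ∷ U) R′ S″
    part′ = same-support (λ v → swap (δ y v) (δ z v) (δ a v) (δ y′ v) (δ z′ v) (mult U v)) (Pair.rest pair₂)
      where
      swap : ∀ p q r s t u → p + (q + (r + (s + (t + u)))) ≡ s + (t + (p + (q + (r + u))))
      swap = solve-∀
    balance′ : sum S″ + suc (length (segments st)) + 2 * 0 ≡ 3 * sum R′
    balance′ = +-cancelʳ-≡ 3 _ _ (trans (certificate (sum S″) (length (segments st)))
      (trans (cong (λ s → s + length (segments st) + 2 * 0) (sym (trans (Pair.count pair₁) (cong (2 +_) (Pair.count pair₂)))))
      (trans (balance st) (trans (cong (3 *_) (proj₂ (proj₂ used-a))) (certificate′ (sum R′))))))
      where
      certificate : ∀ s l → s + suc l + 2 * 0 + 3 ≡ 2 + (2 + s) + l + 2 * 0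
      certificate = solve-∀
      certificate′ : ∀ r → 3 * suc r ≡ 3 * r + 3
      certificate′ = solve-∀

  module Absorb (X : Fin n → ℕ) (X≤1 : ∀ v → X v ≤ 1) where

    -- The bound `k` on the number of vertices still to be absorbed drops at each step, and each
    -- step uses five new vertices.
    absorb : ∀ k {u v} → (st : State 0 u) → sum (λ a → R st a * X a) ≤ k → 5 * k + u ≤ v →
      2 * (n * w + n * v) < θ → ∃ λ (st′ : State 0 v) → ∀ a → R st′ a * X a ≡ 0
    absorb k {u} {v} st ≤k fit room = by-size (sum (λ a → R st a * X a)) refl
      where
      by-size : ∀ s → s ≡ sum (λ a → R st a * X a) → ∃ λ (st′ : State 0 v) → ∀ a → R st′ a * X a ≡ 0
      by-size zero eq = record
        { segments = segments st ; R = R st ; S = S st ; part = part st ; balance = balance st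
        ; few = ≤-trans (few st) (≤-trans (m≤n+m u (5 * k)) fit) } , sum-zero (sym eq)
      by-size (suc s) eq = next k ≤k fit
        where
        found : ∃ λ a → 0 < R st a * X a
        found = sum-pos (subst (0 <_) eq (s≤s z≤n))
        a = proj₁ found
        Ra : R st a ≡ 1
        Ra = pos-bit (≤-trans (R≤A (part st) a) (A≤1 a)) (proj₁ (pos-* (R st a) (proj₂ found)))
        Xa : X a ≡ 1
        Xa = pos-bit (X≤1 a) (proj₂ (pos-* (R st a) (proj₂ found)))
        next : ∀ k → sum (λ a → R st a * X a) ≤ k → 5 * k + u ≤ v → ∃ λ (st′ : State 0 v) → ∀ a → R st′ a * X a ≡ 0
        next zero    ≤0 fit = contradiction (subst (_≤ 0) (sym eq) ≤0) λ ()
        next (suc k) ≤k fit = absorb k (proj₁ one) decreased (≤-trans (≤-reflexive (regroup k u)) fit) room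
          where
          regroup : ∀ k u → 5 * k + (5 + u) ≡ 5 * suc k + u
          regroup = solve-∀
          one = absorb-one a st Ra (≤-<-trans (*-monoʳ-≤ 2 (+-monoʳ-≤ (n * w) (*-monoʳ-≤ n
            (≤-trans (m≤n+m (3 + u) (5 * k + 2)) (≤-trans (≤-reflexive (regroup′ k u)) fit))))) room)
            where
            regroup′ : ∀ k u → 5 * k + 2 + (3 + u) ≡ 5 * suc k + u
            regroup′ = solve-∀
          decreased : sum (λ a → R (proj₁ one) a * X a) ≤ k
          decreased = ≤-pred (≤-trans (≤-reflexive (sym smaller)) ≤k)
            where
            smaller : sum (λ x → R st x * X x) ≡ suc (sum λ x → R (proj₁ one) x * X x)
            smaller = trans (sum-cong-≗ λ x → trans (cong (_* X x) (proj₂ one x)) (*-distribʳ-+ (X x) (δ a x) (R (proj₁ one) x)))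
              (trans sum-+ (cong (_+ sum (λ x → R (proj₁ one) x * X x)) (trans (sum-δ a X) Xa)))

-- Segments inside B

module Inside {n} (e : Fin n → Fin n → Fin n → ℕ) (e≤1 : ∀ x y z → e x y z ≤ 1)
  (e-swap₁₂ : ∀ x y z → e x y z ≡ e y x z) (e-swap₂₃ : ∀ x y z → e x y z ≡ e x z y)
  (e-diag : ∀ x y → e x x y ≡ 0)
  (B : Fin n → ℕ) (B≤1 : ∀ v → B v ≤ 1)
  where

  open Segments e B
  open ThreeGraph e e-swap₁₂ e-swap₂₃ e-diag

  d : Fin n → ℕ
  d v = sum₂ λ y z → B y * (B z * e v y z)

  -- The field `count` says that the segments have `j` edges altogether, as a segment has one vertex
  -- more than twice its edges. Disjoint edges and longer paths are thereby treated alike.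
  record Interior (j : ℕ) : Set where
    field
      segments : List Segment
      R        : Fin n → ℕ
      inside   : ∀ v → mult (allVertices segments) v + R v ≡ B v
      count    : length (allVertices segments) ≡ 2 * j + length segments
      few      : length (allVertices segments) ≤ 3 * j
  open Interior

  record Edge (R : Fin n → ℕ) : Set where
    field
      x y z : Fin n
      Rx    : R x ≡ 1
      Ry    : R y ≡ 1
      Rz    : R z ≡ 1
      joined  : e x y z ≡ 1
      R′    : Fin n → ℕ
      split : ∀ v → R v ≡ δ x v + (δ y v + (δ z v + R′ v))
      size  : sum R ≡ 3 + sum R′

  exchange : ∀ x y z → x * (y * z) ≡ y * (x * z)
  exchange = solve-∀

  sum₃-mixed : ∀ (U : Fin n → ℕ) → sum (λ v → B v * sum₂ λ y z → U y * (B z * e v y z)) ≡ sum λ y → U y * d y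
  sum₃-mixed U = begin
    sum (λ v → B v * sum₂ λ y z → U y * (B z * e v y z))
      ≡⟨ sum-cong-≗ (λ v → trans (sym (sum₂-*ˡ (B v) _)) (sum₂-cong λ y z →
           trans (exchange (B v) (U y) (B z * e v y z)) (cong (λ k → U y * (B v * (B z * k))) (e-swap₁₂ v y z)))) ⟩
    sum (λ v → sum₂ λ y z → U y * (B v * (B z * e y v z)))
      ≡⟨ ∑-comm (λ v y → sum λ z → U y * (B v * (B z * e y v z))) ⟩
    sum (λ y → sum₂ λ v z → U y * (B v * (B z * e y v z)))
      ≡⟨ sum-cong-≗ (λ y → sum₂-*ˡ (U y) _) ⟩
    sum (λ y → U y * d y) ∎
    where open ≡-Reasoning

  sum₂-turn : ∀ (U : Fin n → ℕ) v → sum₂ (λ y z → B y * (U z * e v y z)) ≡ sum₂ (λ y z → U y * (B z * e v y z))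
  sum₂-turn U v = trans (∑-comm λ y z → B y * (U z * e v y z)) (sum₂-cong λ z y →
    trans (exchange (B y) (U z) (e v y z)) (cong (λ k → U z * (B y * k)) (e-swap₂₃ v y z)))

  opaque
    -- The vertices of `R` are completed by at least `sum R * L` ordered pairs inside `B`. The pairs
    -- with an entry in `U` are counted from that entry, where at most `M` ordered pairs are
    -- available; this gives at most `2 * (length U * M)` in total.
    find-edge : ∀ {U R} L M → (∀ v → mult U v + R v ≡ B v) → (∀ v → B v ≡ 1 → L ≤ d v) →
      (∀ v → mult U v * d v ≤ mult U v * M) → 2 * (length U * M) < sum R * L → Edge R
    find-edge {U} {R} L M inside L≤d d≤M room = record
      { x = x ; y = y ; z = z ; Rx = proj₁ facts ; Ry = proj₁ (proj₂ facts) ; Rz = proj₁ (proj₂ (proj₂ facts)) ; joined = joined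
      ; R′ = proj₁ without-z
      ; split = λ v → trans (proj₁ (proj₂ without-x) v) (cong (δ x v +_)
          (trans (proj₁ (proj₂ without-y) v) (cong (δ y v +_) (proj₁ (proj₂ without-z) v))))
      ; size = trans (proj₂ (proj₂ without-x)) (cong suc (trans (proj₂ (proj₂ without-y)) (cong suc (proj₂ (proj₂ without-z))))) }
      where
      u : Fin n → ℕ
      u = mult U
      R≤B : ∀ v → R v ≤ B v
      R≤B v = ≤-trans (m≤n+m (R v) (u v)) (≤-reflexive (inside v))
      R≤1 : ∀ v → R v ≤ 1
      R≤1 v = ≤-trans (R≤B v) (B≤1 v)
      RRR mixed : ℕ
      RRR = sum λ v → sum₂ λ y z → R v * (R y * (R z * e v y z))
      mixed = sum λ v → B v * sum₂ λ y z → u y * (B z * e v y z)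
      mixed≤ : mixed ≤ length U * M
      mixed≤ = ≤-trans (≤-reflexive (sum₃-mixed u)) (≤-trans (sum-mono d≤M)
        (≤-reflexive (trans (sum-*ʳ M u) (cong (_* M) (sum-mult U)))))
      expand : ∀ v → d v ≤ sum₂ (λ y z → R y * (R z * e v y z)) + (sum₂ (λ y z → u y * (B z * e v y z)) + sum₂ (λ y z → u y * (B z * e v y z)))
      expand v = ≤-trans (sum₂-mono λ y z → pointwise (u y) (R y) (B y) (u z) (R z) (B z) (e v y z) (inside y) (inside z))
        (≤-reflexive (trans sum₂-+ (cong (sum₂ (λ y z → R y * (R z * e v y z)) +_)
          (trans sum₂-+ (cong (sum₂ (λ y z → u y * (B z * e v y z)) +_) (sum₂-turn u v))))))
        where
        ring : ∀ u r u′ r′ e → (u + r) * ((u′ + r′) * e) + u * (u′ * e) ≡ r * (r′ * e) + (u * ((u′ + r′) * e) + (u + r) * (u′ * e))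
        ring = solve-∀
        pointwise : ∀ u r b u′ r′ b′ e → u + r ≡ b → u′ + r′ ≡ b′ → b * (b′ * e) ≤ r * (r′ * e) + (u * (b′ * e) + b * (u′ * e))
        pointwise u r _ u′ r′ _ e refl refl = ≤-trans (m≤m+n _ (u * (u′ * e))) (≤-reflexive (ring u r u′ r′ e))
      low : ∀ v → R v * L ≤ R v * d v
      low v = by-bit (bit (R≤1 v))
        where
        by-bit : R v ≡ 0 ⊎ R v ≡ 1 → R v * L ≤ R v * d v
        by-bit (inj₁ eq) = subst (λ k → k * L ≤ k * d v) (sym eq) z≤n
        by-bit (inj₂ eq) = *-monoʳ-≤ (R v) (L≤d v (pos-bit (B≤1 v) (≤-trans (≤-reflexive (sym eq)) (R≤B v))))
      upper : ∀ v → R v * d v ≤ sum₂ (λ y z → R v * (R y * (R z * e v y z))) + (B v * sum₂ (λ y z → u y * (B z * e v y z)) + B v * sum₂ (λ y z → u y * (B z * e v y z)))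
      upper v = ≤-trans (*-monoʳ-≤ (R v) (expand v)) (≤-trans (≤-reflexive (*-distribˡ-+ (R v) _ _))
        (+-mono-≤ (≤-reflexive (sym (sum₂-*ˡ (R v) _))) (≤-trans (≤-reflexive (*-distribˡ-+ (R v) _ _)) (+-mono-≤ (*-monoˡ-≤ _ (R≤B v)) (*-monoˡ-≤ _ (R≤B v))))))
      bound : sum R * L ≤ RRR + (mixed + mixed)
      bound = begin
        sum R * L                 ≡⟨ sum-*ʳ L R ⟨
        sum (λ v → R v * L)       ≤⟨ sum-mono (λ v → ≤-trans (low v) (upper v)) ⟩
        sum (λ v → sum₂ (λ y z → R v * (R y * (R z * e v y z))) + (B v * sum₂ (λ y z → u y * (B z * e v y z)) + B v * sum₂ (λ y z → u y * (B z * e v y z))))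
                                  ≡⟨ trans sum-+ (cong (RRR +_) sum-+) ⟩
        RRR + (mixed + mixed)     ∎
        where open ≤-Reasoning
      many : 0 < RRR
      many = linear 0 (+-mono-≤ room (+-mono-≤ bound (+-mono-≤ mixed≤ mixed≤))) (certificate (length U * M) (sum R * L) RRR mixed)
        where
        certificate : ∀ k l r m → 1 + (l + (r + (m + m) + (k + k))) + 0 ≡ r + (suc (2 * k) + (l + (m + m)))
        certificate = solve-∀
      first : ∃ λ x → 0 < sum₂ λ y z → R x * (R y * (R z * e x y z))
      first = sum-pos many
      x : Fin n
      x = proj₁ first
      others : ∃ λ y → ∃ λ z → 0 < R x * (R y * (R z * e x y z))
      others = sum₂-pos (proj₂ first)
      y z : Fin n
      y = proj₁ others
      z = proj₁ (proj₂ others)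
      facts : R x ≡ 1 × R y ≡ 1 × R z ≡ 1 × e x y z ≡ 1
      facts = pos-bit (R≤1 x) (proj₁ (pos-* (R x) (proj₂ (proj₂ others)))) ,
        0<1*1*1 (R≤1 y) (R≤1 z) (e≤1 x y z) (proj₂ (pos-* (R x) (proj₂ (proj₂ others))))
      joined : e x y z ≡ 1
      joined = proj₂ (proj₂ (proj₂ facts))
      without-x : ∃ λ r → (∀ v → R v ≡ δ x v + r v) × sum R ≡ suc (sum r)
      without-x = take-out {f = R} x (proj₁ facts)
      X Y : Fin n → ℕ
      X = proj₁ without-x
      without-y : ∃ λ r → (∀ v → X v ≡ δ y v + r v) × sum X ≡ suc (sum r)
      without-y = take-out {f = X} y (rest-at {f = R} {X} (proj₁ (proj₂ without-x)) (distinct₁₂ joined) (proj₁ (proj₂ facts)))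
      Y = proj₁ without-y
      without-z : ∃ λ r → (∀ v → Y v ≡ δ z v + r v) × sum Y ≡ suc (sum r)
      without-z = take-out {f = Y} z (rest-at {f = X} {Y} (proj₁ (proj₂ without-y)) (distinct₂₃ joined)
        (rest-at {f = R} {X} (proj₁ (proj₂ without-x)) (distinct₁₃ joined) (proj₁ (proj₂ (proj₂ facts)))))

  in-B : ∀ {u r} v → u + r ≡ B v → r ≡ 1 → B v ≡ 1
  in-B {u} {r} v eq p = pos-bit (B≤1 v) (≤-trans (≤-reflexive (sym p)) (≤-trans (m≤n+m r u) (≤-reflexive eq)))

  one-step : ∀ x y z → B x ≡ 1 → B z ≡ 1 → e x y z ≡ 1 → Segment
  one-step x y z x∈B z∈B joined = record
    { start = x ; end = z ; steps = (y , z) ∷ [] ; chain = joined , refl ; start∈B = x∈B ; end∈B = z∈B }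

  two-step : ∀ x y z y′ z′ → B x ≡ 1 → B z′ ≡ 1 → e x y z ≡ 1 → e z y′ z′ ≡ 1 → Segment
  two-step x y z y′ z′ x∈B z∈B joined edge′ = record
    { start = x ; end = z′ ; steps = (y , z) ∷ (y′ , z′) ∷ [] ; chain = joined , edge′ , refl ; start∈B = x∈B ; end∈B = z∈B }

  module Disjoint (L M : ℕ) (L≤d : ∀ v → B v ≡ 1 → L ≤ d v) (d≤M : ∀ v → B v ≡ 1 → d v ≤ M) where

    -- After `i` edges, `3 * i` vertices are used; the term `3 * i * L` stands for their absence
    -- from the remaining sum.
    disjoint : ∀ j → (∀ i → i < j → 2 * (3 * i * M) + 3 * i * L < sum B * L) →
      ∃ λ (I : Interior j) → length (segments I) ≡ j
    disjoint zero    room = record { segments = [] ; R = B ; inside = λ v → refl ; count = refl ; few = z≤n } , refl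
    disjoint (suc j) room = extend (disjoint j λ i i<j → room i (m≤n⇒m≤1+n i<j))
      where
      extend : (∃ λ (I : Interior j) → length (segments I) ≡ j) → ∃ λ (I : Interior (suc j)) → length (segments I) ≡ suc j
      extend (I , len) = record
        { segments = segment ∷ segments I ; R = R′ ; inside = inside′
        ; count = trans (cong (3 +_) (count I)) (regroup j (length (segments I)))
        ; few = ≤-trans (+-monoʳ-≤ 3 (few I)) (≤-reflexive (sym (*-suc 3 j))) } , cong suc len
        where
        U = allVertices (segments I)
        regroup : ∀ j l → 3 + (2 * j + l) ≡ 2 * suc j + suc l
        regroup = solve-∀
        |U| : length U ≡ 3 * j
        |U| = trans (count I) (trans (cong (2 * j +_) len) (thrice j))
          where
          thrice : ∀ j → 2 * j + j ≡ 3 * j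
          thrice = solve-∀
        sums : 3 * j + sum (R I) ≡ sum B
        sums = trans (cong (_+ sum (R I)) (trans (sym |U|) (sym (sum-mult U)))) (trans (sym sum-+) (sum-cong-≗ (inside I)))
        d≤ : ∀ v → mult U v * d v ≤ mult U v * M
        d≤ v = by-sign (mult U v) refl
          where
          by-sign : ∀ k → k ≡ mult U v → k * d v ≤ k * M
          by-sign zero    eq = z≤n
          by-sign (suc k) eq = *-monoʳ-≤ (suc k) (d≤M v (pos-bit (B≤1 v) (≤-trans (s≤s z≤n)
            (≤-trans (≤-reflexive eq) (≤-trans (m≤m+n (mult U v) (R I v)) (≤-reflexive (inside I v)))))))
        room′ : 2 * (length U * M) < sum (R I) * L
        room′ = +-cancelʳ-< (3 * j * L) _ _ (subst₂ _<_ (cong (λ k → 2 * (k * M) + 3 * j * L) (sym |U|))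
          (trans (cong (_* L) (trans (sym sums) (+-comm (3 * j) (sum (R I))))) (*-distribʳ-+ L (sum (R I)) (3 * j))) (room j ≤-refl))
        found : Edge (R I)
        found = find-edge {U} {R I} L M (inside I) L≤d d≤ room′
        open Edge found using (x; y; z; Rx; Rz; joined; R′; split)
        segment : Segment
        segment = one-step x y z (in-B x (inside I x) Rx) (in-B z (inside I z) Rz) joined
        inside′ : ∀ v → mult (x ∷ y ∷ z ∷ U) v + R′ v ≡ B v
        inside′ v = trans (swap (δ x v) (δ y v) (δ z v) (mult U v) (R′ v)) (trans (cong (mult U v +_) (sym (split v))) (inside I v))
          where
          swap : ∀ a b c u r → a + (b + (c + u)) + r ≡ u + (a + (b + (c + r)))
          swap = solve-∀

  -- Two edges inside B sharing at most one vertex: either some u off a first edge {x, y, z} has an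
  -- edge meeting {x, y, z} at most once, or every such u forms an edge with two of the pairs of {x, y, z}.
  module Two (4≤d : ∀ v → B v ≡ 1 → 4 ≤ d v) (5≤B : 5 ≤ sum B) where

    first : Edge B
    first = find-edge {[]} {B} 4 0 (λ v → refl) 4≤d (λ v → z≤n) (≤-trans (s≤s z≤n) (*-monoˡ-≤ 4 5≤B))
    open Edge first using (x; y; z; joined) renaming (R′ to S; split to B-split; Rx to x∈B; Ry to y∈B; Rz to z∈B; size to B-size)

    C : Fin n → ℕ
    C v = δ x v + (δ y v + δ z v)

    B≡C+S : ∀ v → B v ≡ C v + S v
    B≡C+S v = trans (B-split v) (regroup (δ x v) (δ y v) (δ z v) (S v))
      where
      regroup : ∀ a b c r → a + (b + (c + r)) ≡ a + (b + c) + r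
      regroup = solve-∀

    S∈B : ∀ {v} → S v ≡ 1 → B v ≡ 1
    S∈B {v} p = in-B v (sym (B≡C+S v)) p

    S≤1 : ∀ v → S v ≤ 1
    S≤1 v = ≤-trans (≤-trans (m≤n+m (S v) (C v)) (≤-reflexive (sym (B≡C+S v)))) (B≤1 v)

    -- The equation for `C` says that s, t, r reorder the first edge. As u and p lie off it, the two
    -- edges form the path u, p, s, t, r.
    share : ∀ {u p s t r} → S u ≡ 1 → S p ≡ 1 → B r ≡ 1 → (∀ v → δ s v + (δ t v + δ r v) ≡ C v) →
      e s t r ≡ 1 → e u p s ≡ 1 → Interior 2
    share {u} {p} {s} {t} {r} Su Sp r∈B C≡ str ups = record
      { segments = two-step u p s t r (S∈B Su) r∈B ups str ∷ []
      ; R = proj₁ without-p ; inside = inside′ ; count = refl ; few = n≤1+n 5 }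
      where
      without-u = take-out {f = S} u Su
      without-p = take-out {f = proj₁ without-u} p (rest-at (proj₁ (proj₂ without-u)) (distinct₁₂ ups) Sp)
      inside′ : ∀ v → mult (u ∷ p ∷ s ∷ t ∷ r ∷ []) v + proj₁ without-p v ≡ B v
      inside′ v = begin
        δ u v + (δ p v + (δ s v + (δ t v + (δ r v + 0)))) + proj₁ without-p v
          ≡⟨ regroup (δ u v) (δ p v) (δ s v) (δ t v) (δ r v) (proj₁ without-p v) ⟩
        δ s v + (δ t v + δ r v) + (δ u v + (δ p v + proj₁ without-p v))
          ≡⟨ cong₂ _+_ (C≡ v) (trans (cong (δ u v +_) (sym (proj₁ (proj₂ without-p) v))) (sym (proj₁ (proj₂ without-u) v))) ⟩
        C v + S v ≡⟨ B≡C+S v ⟨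
        B v ∎
        where
        open ≡-Reasoning
        regroup : ∀ u p s t r k → u + (p + (s + (t + (r + 0)))) + k ≡ s + (t + r) + (u + (p + k))
        regroup = solve-∀

    -- Here the first edge only supplies three vertices: the path u, p, s, q, u′ consists of two
    -- other edges meeting in s.
    bridge : ∀ {u u′ p s q} → S u ≡ 1 → S u′ ≡ 1 → u ≢ u′ → (∀ v → δ p v + (δ s v + δ q v) ≡ C v) →
      e u p s ≡ 1 → e u′ s q ≡ 1 → Interior 2
    bridge {u} {u′} {p} {s} {q} Su Su′ u≢u′ C≡ ups usq = record
      { segments = two-step u p s q u′ (S∈B Su) (S∈B Su′) ups (trans (e-swap₂₃ s q u′) (trans (e-swap₁₂ s u′ q) usq)) ∷ []
      ; R = proj₁ without-u′ ; inside = inside′ ; count = refl ; few = n≤1+n 5 }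
      where
      without-u = take-out {f = S} u Su
      without-u′ = take-out {f = proj₁ without-u} u′ (rest-at (proj₁ (proj₂ without-u)) u≢u′ Su′)
      inside′ : ∀ v → mult (u ∷ p ∷ s ∷ q ∷ u′ ∷ []) v + proj₁ without-u′ v ≡ B v
      inside′ v = begin
        δ u v + (δ p v + (δ s v + (δ q v + (δ u′ v + 0)))) + proj₁ without-u′ v
          ≡⟨ regroup (δ u v) (δ p v) (δ s v) (δ q v) (δ u′ v) (proj₁ without-u′ v) ⟩
        δ p v + (δ s v + δ q v) + (δ u v + (δ u′ v + proj₁ without-u′ v))
          ≡⟨ cong₂ _+_ (C≡ v) (trans (cong (δ u v +_) (sym (proj₁ (proj₂ without-u′) v))) (sym (proj₁ (proj₂ without-u) v))) ⟩
        C v + S v ≡⟨ B≡C+S v ⟨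
        B v ∎
        where
        open ≡-Reasoning
        regroup : ∀ u p s q w k → u + (p + (s + (q + (w + 0)))) + k ≡ p + (s + q) + (u + (w + k))
        regroup = solve-∀

    apart : ∀ {u p q} → S u ≡ 1 → S p ≡ 1 → S q ≡ 1 → e u p q ≡ 1 → Interior 2
    apart {u} {p} {q} Su Sp Sq upq = record
      { segments = one-step x y z x∈B z∈B joined ∷ one-step u p q (S∈B Su) (S∈B Sq) upq ∷ []
      ; R = proj₁ without-q ; inside = inside′ ; count = refl ; few = ≤-refl }
      where
      without-u = take-out {f = S} u Su
      without-p = take-out {f = proj₁ without-u} p (rest-at (proj₁ (proj₂ without-u)) (distinct₁₂ upq) Sp)
      without-q = take-out {f = proj₁ without-p} q (rest-at (proj₁ (proj₂ without-p)) (distinct₂₃ upq)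
        (rest-at (proj₁ (proj₂ without-u)) (distinct₁₃ upq) Sq))
      inside′ : ∀ v → mult (x ∷ y ∷ z ∷ u ∷ p ∷ q ∷ []) v + proj₁ without-q v ≡ B v
      inside′ v = begin
        δ x v + (δ y v + (δ z v + (δ u v + (δ p v + (δ q v + 0))))) + proj₁ without-q v
          ≡⟨ regroup (δ x v) (δ y v) (δ z v) (δ u v) (δ p v) (δ q v) (proj₁ without-q v) ⟩
        C v + (δ u v + (δ p v + (δ q v + proj₁ without-q v)))
          ≡⟨ cong (C v +_) (trans (cong (δ u v +_) (trans (cong (δ p v +_) (sym (proj₁ (proj₂ without-q) v))) (sym (proj₁ (proj₂ without-p) v)))) (sym (proj₁ (proj₂ without-u) v))) ⟩
        C v + S v ≡⟨ B≡C+S v ⟨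
        B v ∎
        where
        open ≡-Reasoning
        regroup : ∀ a b c u p q k → a + (b + (c + (u + (p + (q + 0))))) + k ≡ a + (b + c) + (u + (p + (q + k)))
        regroup = solve-∀

    sum-C : ∀ (g : Fin n → ℕ) → sum (λ p → C p * g p) ≡ g x + (g y + g z)
    sum-C g = begin
      sum (λ p → C p * g p)
        ≡⟨ sum-cong-≗ (λ p → expand (δ x p) (δ y p) (δ z p) (g p)) ⟩
      sum (λ p → δ x p * g p + (δ y p * g p + δ z p * g p))
        ≡⟨ trans sum-+ (cong (sum (λ p → δ x p * g p) +_) sum-+) ⟩
      sum (λ p → δ x p * g p) + (sum (λ p → δ y p * g p) + sum (λ p → δ z p * g p))
        ≡⟨ cong₂ _+_ (sum-δ x g) (cong₂ _+_ (sum-δ y g) (sum-δ z g)) ⟩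
      g x + (g y + g z) ∎
      where
      open ≡-Reasoning
      expand : ∀ a b c g → (a + (b + c)) * g ≡ a * g + (b * g + c * g)
      expand = solve-∀

    pairs : Fin n → ℕ
    pairs u = e u x y + (e u x z + e u y z)

    sum-CC : ∀ u → sum₂ (λ p q → C p * (C q * e u p q)) ≡ 2 * pairs u
    sum-CC u = begin
      sum₂ (λ p q → C p * (C q * e u p q))
        ≡⟨ sum-cong-≗ (λ p → trans (sum-*ˡ (C p) _) (cong (C p *_) (sum-C (e u p)))) ⟩
      sum (λ p → C p * (e u p x + (e u p y + e u p z)))
        ≡⟨ sum-C (λ p → e u p x + (e u p y + e u p z)) ⟩
      (e u x x + (e u x y + e u x z)) + ((e u y x + (e u y y + e u y z)) + (e u z x + (e u z y + e u z z)))
        ≡⟨ cong₂ _+_ (cong (_+ (e u x y + e u x z)) (e-diag₂₃ u x))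
             (cong₂ _+_ (cong₂ _+_ (e-swap₂₃ u y x) (cong (_+ e u y z) (e-diag₂₃ u y)))
               (cong₂ _+_ (e-swap₂₃ u z x) (cong₂ _+_ (e-swap₂₃ u z y) (e-diag₂₃ u z)))) ⟩
      (0 + (e u x y + e u x z)) + ((e u x y + (0 + e u y z)) + (e u x z + (e u y z + 0)))
        ≡⟨ collect (e u x y) (e u x z) (e u y z) ⟩
      2 * pairs u ∎
      where
      open ≡-Reasoning
      collect : ∀ a b c → (0 + (a + b)) + ((a + (0 + c)) + (b + (c + 0))) ≡ 2 * (a + (b + c))
      collect = solve-∀

    outside-edge : Fin n → ℕ
    outside-edge u = sum₂ λ p q → S p * (B q * e u p q)

    d≤ : ∀ u → d u ≤ 2 * pairs u + (outside-edge u + outside-edge u)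
    d≤ u = ≤-trans (sum₂-mono λ p q → pointwise (C p) (S p) (B p) (C q) (S q) (B q) (e u p q) (B≡C+S p) (B≡C+S q))
      (≤-reflexive (trans sum₂-+ (cong₂ _+_ (sum-CC u) (trans sum₂-+ (cong (outside-edge u +_) (sum₂-turn S u))))))
      where
      ring : ∀ u r u′ r′ e → (r + u) * ((r′ + u′) * e) + u * (u′ * e) ≡ r * (r′ * e) + (u * ((r′ + u′) * e) + (r + u) * (u′ * e))
      ring = solve-∀
      pointwise : ∀ r u b r′ u′ b′ e → b ≡ r + u → b′ ≡ r′ + u′ → b * (b′ * e) ≤ r * (r′ * e) + (u * (b′ * e) + b * (u′ * e))
      pointwise r u _ r′ u′ _ e refl refl = ≤-trans (m≤m+n _ (u * (u′ * e))) (≤-reflexive (ring u r u′ r′ e))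

    C-yxz : ∀ v → δ y v + (δ x v + δ z v) ≡ C v
    C-yxz v = perm (δ y v) (δ x v) (δ z v)
      where
      perm : ∀ a b c → a + (b + c) ≡ b + (a + c)
      perm = solve-∀
    C-zxy : ∀ v → δ z v + (δ x v + δ y v) ≡ C v
    C-zxy v = perm (δ z v) (δ x v) (δ y v)
      where
      perm : ∀ a b c → a + (b + c) ≡ b + (c + a)
      perm = solve-∀

    meets-once : ∀ {u p q} → S u ≡ 1 → S p ≡ 1 → B q ≡ 1 → e u p q ≡ 1 → Interior 2
    meets-once {u} {p} {q} Su Sp q∈B upq = by-cases (x F.≟ q) (y F.≟ q) (z F.≟ q)
      where
      by-cases : Dec (x ≡ q) → Dec (y ≡ q) → Dec (z ≡ q) → Interior 2
      by-cases (yes refl) _ _ = share Su Sp z∈B (λ v → refl) joined upq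
      by-cases (no _) (yes refl) _ = share Su Sp z∈B C-yxz (trans (e-swap₁₂ y x z) joined) upq
      by-cases (no _) (no _) (yes refl) = share Su Sp y∈B C-zxy (trans (e-swap₁₂ z x y) (trans (e-swap₂₃ x z y) joined)) upq
      by-cases (no x≢q) (no y≢q) (no z≢q) = apart Su Sp Sq upq
        where
        Sq : S q ≡ 1
        Sq = trans (sym (trans (B≡C+S q) (cong (_+ S q) (cong₂ _+_ (δ-≢ x≢q) (cong₂ _+_ (δ-≢ y≢q) (δ-≢ z≢q)))))) q∈B

    analyse : ∀ {u} → S u ≡ 1 → Interior 2 ⊎ 2 ≤ pairs u
    analyse {u} Su = by-sign (outside-edge u) refl
      where
      by-sign : ∀ k → k ≡ outside-edge u → Interior 2 ⊎ 2 ≤ pairs u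
      -- If no edge at `u` has a further vertex in `S`, all of its at least 4 ordered pairs lie
      -- inside the first edge, so at least 2 unordered ones do.
      by-sign zero eq = inj₂ (*-cancelˡ-≤ 2 (≤-trans (4≤d u (S∈B Su)) (≤-trans (d≤ u)
        (≤-reflexive (trans (cong (λ k → 2 * pairs u + (k + k)) (sym eq)) (+-identityʳ _))))))
      by-sign (suc k) eq = inj₁ (use (sum₂-pos (subst (0 <_) eq (s≤s z≤n))))
        where
        use : (∃ λ p → ∃ λ q → 0 < S p * (B q * e u p q)) → Interior 2
        use (p , q , pos) = meets-once Su (proj₁ f) (proj₁ (proj₂ f)) (proj₂ (proj₂ f))
          where
          f = 0<1*1*1 (S≤1 p) (B≤1 q) (e≤1 u p q) pos

    2≤S : 2 ≤ sum S
    2≤S = +-cancelˡ-≤ 3 _ _ (≤-trans 5≤B (≤-reflexive B-size))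

    -- With two of the three pairs available to each of `u` and `u′`, different pairs can be chosen
    -- for them. Two different pairs of a three-element set share exactly one vertex and cover the
    -- set, as `bridge` requires.
    connect : ∀ {u u′} → S u ≡ 1 → S u′ ≡ 1 → u ≢ u′ → 2 ≤ pairs u → 2 ≤ pairs u′ → Interior 2
    connect {u} {u′} Su Su′ u≢u′ p p′ = by-bits (bit (e≤1 u x y)) (bit (e≤1 u x z)) (bit (e≤1 u′ x y)) (bit (e≤1 u′ x z)) (bit (e≤1 u′ y z))
      where
      absurd : ∀ {a b c} → a ≡ 0 → b ≡ 0 → c ≤ 1 → 2 ≤ a + (b + c) → Interior 2
      absurd refl refl c≤1 q = contradiction (≤-trans q c≤1) λ { (s≤s ()) }
      C-xzy : ∀ v → δ x v + (δ z v + δ y v) ≡ C v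
      C-xzy v = cong (δ x v +_) (+-comm (δ z v) (δ y v))
      by-bits : e u x y ≡ 0 ⊎ e u x y ≡ 1 → e u x z ≡ 0 ⊎ e u x z ≡ 1 → e u′ x y ≡ 0 ⊎ e u′ x y ≡ 1 →
        e u′ x z ≡ 0 ⊎ e u′ x z ≡ 1 → e u′ y z ≡ 0 ⊎ e u′ y z ≡ 1 → Interior 2
      by-bits (inj₂ a) _ _ (inj₂ b′) _ = bridge Su Su′ u≢u′ C-yxz (trans (e-swap₂₃ u y x) a) b′
      by-bits (inj₂ a) _ _ (inj₁ _) (inj₂ c′) = bridge Su Su′ u≢u′ (λ v → refl) a c′
      by-bits (inj₂ a) _ _ (inj₁ b′) (inj₁ c′) = absurd b′ c′ (e≤1 u′ x y)
        (≤-trans p′ (≤-reflexive (rotate (e u′ x y) (e u′ x z) (e u′ y z))))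
        where
        rotate : ∀ a b c → a + (b + c) ≡ b + (c + a)
        rotate = solve-∀
      by-bits (inj₁ a) (inj₁ b) _ _ _ = absurd a b (e≤1 u y z) p
      by-bits (inj₁ _) (inj₂ b) (inj₂ a′) _ _ = bridge Su Su′ u≢u′ C-zxy (trans (e-swap₂₃ u z x) b) a′
      by-bits (inj₁ _) (inj₂ b) (inj₁ _) _ (inj₂ c′) = bridge Su Su′ u≢u′ C-xzy b (trans (e-swap₂₃ u′ z y) c′)
      by-bits (inj₁ _) (inj₂ b) (inj₁ a′) _ (inj₁ c′) = absurd a′ c′ (e≤1 u′ x z)
        (≤-trans p′ (≤-reflexive (cong (e u′ x y +_) (+-comm (e u′ x z) (e u′ y z)))))

    two : Interior 2
    two = finish (analyse Su) (analyse Su′)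
      where
      some-u : ∃ λ u → 0 < S u
      some-u = sum-pos (≤-trans (s≤s z≤n) 2≤S)
      u = proj₁ some-u
      Su : S u ≡ 1
      Su = pos-bit (S≤1 u) (proj₂ some-u)
      without-u = take-out {f = S} u Su
      S′ = proj₁ without-u
      some-u′ : ∃ λ u′ → 0 < S′ u′
      some-u′ = sum-pos (≤-pred (≤-trans 2≤S (≤-reflexive (proj₂ (proj₂ without-u)))))
      u′ = proj₁ some-u′
      Su≡ : S u′ ≡ δ u u′ + S′ u′
      Su≡ = proj₁ (proj₂ without-u) u′
      Su′ : S u′ ≡ 1
      Su′ = pos-bit (S≤1 u′) (≤-trans (proj₂ some-u′) (≤-trans (m≤n+m (S′ u′) (δ u u′)) (≤-reflexive (sym Su≡))))
      u≢u′ : u ≢ u′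
      u≢u′ eq = contradiction (≤-trans (+-mono-≤ (≤-reflexive (sym (trans (cong (δ u) (sym eq)) (δ-refl u)))) (proj₂ some-u′))
        (≤-trans (≤-reflexive (sym Su≡)) (S≤1 u′))) λ { (s≤s ()) }
      finish : Interior 2 ⊎ 2 ≤ pairs u → Interior 2 ⊎ 2 ≤ pairs u′ → Interior 2
      finish (inj₁ I) _ = I
      finish (inj₂ _) (inj₁ I) = I
      finish (inj₂ p) (inj₂ p′) = connect Su Su′ u≢u′ p p′

-- Closing the segments up to a cycle

mult-sumL : ∀ {n} (xs : List (Fin n)) v → mult xs v ≡ sumL (λ x → δ x v) xs
mult-sumL []       v = refl
mult-sumL (x ∷ xs) v = cong (δ x v +_) (mult-sumL xs v)

enumerate : ∀ {n} k (f : Fin n → ℕ) → sum f ≡ k → ∃ λ xs → ∀ v → mult xs v ≡ f v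
enumerate zero    f eq = [] , λ v → sym (sum-zero eq v)
enumerate (suc k) f eq = cons (peel {f = f} eq)
  where
  cons : (∃ λ x → ∃ λ r → (∀ v → f v ≡ δ x v + r v) × sum r ≡ k) → ∃ λ xs → ∀ v → mult xs v ≡ f v
  cons (x , r , split , size) = x ∷ proj₁ rest , λ v → trans (cong (δ x v +_) (proj₂ rest v)) (sym (split v))
    where rest = enumerate k r size

sum-lookup : ∀ {a} {A : Set a} (g : A → ℕ) xs → sum (λ i → g (lookup xs i)) ≡ sumL g xs
sum-lookup g []       = sum-empty _
sum-lookup g (x ∷ xs) = trans (sum-suc _) (cong (g x +_) (sum-lookup g xs))

opaque
  family : ∀ {a} {A : Set a} {K} (xs : List A) → length xs ≡ K →
    ∃ λ (f : Fin K → A) → ∀ g → sum (λ i → g (f i)) ≡ sumL g xs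
  family xs refl = lookup xs , λ g → sum-lookup g xs

  fin-family : ∀ {n K} (xs : List (Fin n)) → length xs ≡ K →
    ∃ λ (f : Fin K → Fin n) → ∀ v → sum (λ i → δ (f i) v) ≡ mult xs v
  fin-family xs len = proj₁ (family xs len) , λ v → trans (proj₂ (family xs len) (λ x → δ x v)) (sym (mult-sumL xs v))

  split-list : ∀ {a} {A : Set a} k {l} (xs : List A) → length xs ≡ k + l →
    ∃ λ ys → ∃ λ zs → ys ++ zs ≡ xs × length ys ≡ k × length zs ≡ l
  split-list k {l} xs eq = take k xs , drop k xs , take++drop≡id k xs ,
    trans (length-take k xs) (m≤n⇒m⊓n≡m (≤-trans (m≤m+n k l) (≤-reflexive (sym eq)))) ,
    trans (length-drop k xs) (trans (cong (_∸ k) eq) (m+n∸m≡n k l))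

module _ {n : ℕ} where

  first : ∀ {K} → (Fin K → Fin n) → Fin n → Fin n
  first {zero}  st last = last
  first {suc K} st last = st zero

  -- The cyclic successor, by recursion instead of modular arithmetic: the final index is sent to
  -- `last`, which is later taken to be the first entry.
  next : ∀ {K} → (Fin K → Fin n) → Fin n → Fin K → Fin n
  next st last zero    = first (st ∘ suc) last
  next st last (suc i) = next (st ∘ suc) last i

  sum-next : ∀ {K} (g : Fin n → ℕ) (st : Fin K → Fin n) last →
    g (first st last) + sum (λ i → g (next st last i)) ≡ sum (λ i → g (st i)) + g last
  sum-next {zero}  g st last = trans (cong (g last +_) (sum-empty _)) (trans (+-identityʳ (g last)) (cong (_+ g last) (sym (sum-empty _))))
  sum-next {suc K} g st last = begin
    g (st zero) + sum (λ i → g (next st last i))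
      ≡⟨ cong (g (st zero) +_) (sum-suc _) ⟩
    g (st zero) + (g (first (st ∘ suc) last) + sum (λ i → g (next (st ∘ suc) last i)))
      ≡⟨ cong (g (st zero) +_) (sum-next g (st ∘ suc) last) ⟩
    g (st zero) + (sum (λ i → g (st (suc i))) + g last)
      ≡⟨ +-assoc (g (st zero)) _ _ ⟨
    g (st zero) + sum (λ i → g (st (suc i))) + g last
      ≡⟨ cong (_+ g last) (sum-suc _) ⟨
    sum (λ i → g (st i)) + g last ∎
    where open ≡-Reasoning

  next-prop : ∀ {K} (P : Fin n → Set) (st : Fin K → Fin n) last → (∀ i → P (st i)) → P last → ∀ i → P (next st last i)
  next-prop P st last Pst Plast i = go st Pst i
    where
    go-first : ∀ {K} (st : Fin K → Fin n) → (∀ i → P (st i)) → P (first st last)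
    go-first {zero}  st Pst = Plast
    go-first {suc K} st Pst = Pst zero
    go : ∀ {K} (st : Fin K → Fin n) → (∀ i → P (st i)) → ∀ i → P (next st last i)
    go st Pst zero    = go-first (st ∘ suc) (Pst ∘ suc)
    go st Pst (suc i) = go (st ∘ suc) (Pst ∘ suc) i

module Finish {n} (e : Fin n → Fin n → Fin n → ℕ) (e≤1 : ∀ x y z → e x y z ≤ 1)
  (e-swap₁₂ : ∀ x y z → e x y z ≡ e y x z) (e-swap₂₃ : ∀ x y z → e x y z ≡ e x z y)
  (A B Core : Fin n → ℕ) (A+B : ∀ v → A v + B v ≡ 1) (g h : ℕ)
  (B-missing : ∀ {v} → B v ≡ 1 → sum₂ (λ y z → A y * (1 ∸ e v y z)) ≤ g)
  (Core-missing : ∀ {v} → Core v ≡ 1 → sum₂ (λ y z → B y * (B z * (1 ∸ e v y z))) ≤ g)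
  (g≤h² : g ≤ h * h) (0<h : 0 < h)
  where

  open Segments e B

  ē : Fin n → Fin n → Fin n → ℕ
  ē x y z = 1 ∸ e x y z

  ē-swap₁₂ : ∀ x y z → ē x y z ≡ ē y x z
  ē-swap₁₂ x y z = cong (1 ∸_) (e-swap₁₂ x y z)

  ē-swap₂₃ : ∀ x y z → ē x y z ≡ ē x z y
  ē-swap₂₃ x y z = cong (1 ∸_) (e-swap₂₃ x y z)

  chain-++ : ∀ {x y z} ps {qs} → Chain x ps y → Chain y qs z → Chain x (ps ++ qs) z
  chain-++ []             refl    d = d
  chain-++ ((m , l) ∷ ps) (p , c) d = p , chain-++ ps c d

  mult-flat-++ : ∀ ps qs v → mult (flat (ps ++ qs)) v ≡ mult (flat ps) v + mult (flat qs) v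
  mult-flat-++ []             qs v = refl
  mult-flat-++ ((m , l) ∷ ps) qs v = trans (cong (λ k → δ m v + (δ l v + k)) (mult-flat-++ ps qs v))
    (regroup (δ m v) (δ l v) (mult (flat ps) v) (mult (flat qs) v))
    where
    regroup : ∀ a b c d → a + (b + (c + d)) ≡ a + (b + c) + d
    regroup = solve-∀

  concatenate : ∀ {K} → (Fin K → Steps) → Steps
  concatenate {zero}  q = []
  concatenate {suc K} q = q zero ++ concatenate (q ∘ suc)

  chain-concatenate : ∀ {K} (st : Fin K → Fin n) last q → (∀ i → Chain (st i) (q i) (next st last i)) →
    Chain (first st last) (concatenate q) last
  chain-concatenate {zero}  st last q c = refl
  chain-concatenate {suc K} st last q c = chain-++ (q zero) (c zero) (chain-concatenate (st ∘ suc) last (q ∘ suc) (c ∘ suc))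

  mult-concatenate : ∀ {K} (q : Fin K → Steps) v → mult (flat (concatenate q)) v ≡ sum λ i → mult (flat (q i)) v
  mult-concatenate {zero}  q v = sym (sum-empty _)
  mult-concatenate {suc K} q v = trans (mult-flat-++ (q zero) (concatenate (q ∘ suc)) v)
    (trans (cong (mult (flat (q zero)) v +_) (mult-concatenate (q ∘ suc) v)) (sym (sum-suc _)))

  mult-allVertices : ∀ ss v → mult (allVertices ss) v ≡ sumL (λ s → mult (vertices s) v) ss
  mult-allVertices []       v = refl
  mult-allVertices (s ∷ ss) v = trans (mult-++ (vertices s) (allVertices ss) v) (cong (mult (vertices s) v +_) (mult-allVertices ss v))

  allVertices-++ : ∀ ss ts v → mult (allVertices (ss ++ ts)) v ≡ mult (allVertices ss) v + mult (allVertices ts) v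
  allVertices-++ ss ts v = trans (mult-allVertices (ss ++ ts) v) (trans (sumL-++ (λ s → mult (vertices s) v) ss ts)
    (sym (cong₂ _+_ (mult-allVertices ss v) (mult-allVertices ts v))))

  end-is-vertex : ∀ {x z} ps → Chain x ps z → ∀ v → δ z v ≤ δ x v + mult (flat ps) v
  end-is-vertex {x} []             refl    v = m≤m+n (δ x v) 0
  end-is-vertex {x} ((m , l) ∷ ps) (p , c) v = ≤-trans (end-is-vertex ps c v)
    (≤-trans (m≤n+m _ (δ m v)) (m≤n+m _ (δ x v)))

  B≤1 : ∀ v → B v ≤ 1
  B≤1 v = ≤-trans (m≤n+m (B v) (A v)) (≤-reflexive (A+B v))

  trivial-segments : ∀ xs → (∀ v → mult xs v ≤ B v) →
    ∃ λ ss → length ss ≡ length xs × ∀ v → mult (allVertices ss) v ≡ mult xs v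
  trivial-segments []       p = [] , refl , λ v → refl
  trivial-segments (x ∷ xs) p = segment ∷ proj₁ rest , cong suc (proj₁ (proj₂ rest)) , λ v → cong (δ x v +_) (proj₂ (proj₂ rest) v)
    where
    x∈B : B x ≡ 1
    x∈B = pos-bit (B≤1 x) (≤-trans (≤-trans (≤-reflexive (sym (δ-refl x))) (m≤m+n (δ x x) _)) (p x))
    segment : Segment
    segment = record { start = x ; end = x ; steps = [] ; chain = refl ; start∈B = x∈B ; end∈B = x∈B }
    rest = trivial-segments xs λ v → ≤-trans (m≤n+m _ (δ x v)) (p v)

  double-family : ∀ {k l} (f : Fin k → Fin n) (f′ : Fin l → Fin n) (X Y : Fin n → ℕ) (F : Fin n → Fin n → ℕ) →
    (∀ v → sum (λ i → δ (f i) v) ≤ X v) → (∀ v → sum (λ i → δ (f′ i) v) ≤ Y v) →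
    sum₂ (λ i j → F (f i) (f′ j)) ≤ sum₂ (λ y z → X y * (Y z * F y z))
  double-family f f′ X Y F p q = ≤-trans (sum-family-≤ f X (λ y → sum λ j → F y (f′ j)) p)
    (sum-mono λ y → ≤-trans (*-monoʳ-≤ (X y) (sum-family-≤ f′ Y (F y) q)) (≤-reflexive (sym (sum-*ˡ (X y) _))))

  module Assemble (segs : List Segment) (R S : Fin n → ℕ)
    (total : ∀ v → mult (allVertices segs) v + (R v + S v) ≡ 1)
    (R≤A : ∀ v → R v ≤ A v) (S≤B : ∀ v → S v ≤ B v) (R⇒Core : ∀ v → R v ≡ 1 → Core v ≡ 1)
    (K P : ℕ) (sum-R : sum R ≡ K) (|segs| : length segs ≡ P) (sum-S : sum S + P ≡ 3 * K) (P≤K : P ≤ K)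
    (13h<K : 13 * h < K)
    where

    As Bs : List (Fin n)
    As = proj₁ (enumerate (sum R) R refl)
    Bs = proj₁ (enumerate (sum S) S refl)
    mult-As : ∀ v → mult As v ≡ R v
    mult-As = proj₂ (enumerate (sum R) R refl)
    mult-Bs : ∀ v → mult Bs v ≡ S v
    mult-Bs = proj₂ (enumerate (sum S) S refl)

    |As| : length As ≡ K
    |As| = trans (sym (sum-mult As)) (trans (sum-cong-≗ mult-As) sum-R)

    -- Each of the `K` blocks needs one segment and two middle vertices from `B`. As `P` segments
    -- exist, the remaining `K ∸ P` become trivial ones.
    |Bs| : length Bs ≡ (K ∸ P) + (K + K)
    |Bs| = +-cancelʳ-≡ P _ _ (begin
      length Bs + P               ≡⟨ cong (_+ P) (trans (sym (sum-mult Bs)) (sum-cong-≗ mult-Bs)) ⟩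
      sum S + P                   ≡⟨ sum-S ⟩
      3 * K                       ≡⟨ regroup K ⟩
      K + (K + K)                 ≡⟨ cong (_+ (K + K)) (m∸n+n≡m P≤K) ⟨
      K ∸ P + P + (K + K)         ≡⟨ regroup′ (K ∸ P) P (K + K) ⟩
      K ∸ P + (K + K) + P         ∎)
      where
      open ≡-Reasoning
      regroup : ∀ K → 3 * K ≡ K + (K + K)
      regroup = solve-∀
      regroup′ : ∀ a b c → a + b + c ≡ a + c + b
      regroup′ = solve-∀

    split₁ : ∃ λ ys → ∃ λ zs → ys ++ zs ≡ Bs × length ys ≡ K ∸ P × length zs ≡ K + K
    split₁ = split-list (K ∸ P) Bs |Bs|
    Xs Ms : List (Fin n)
    Xs = proj₁ split₁
    Ms = proj₁ (proj₂ split₁)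
    split₂ : ∃ λ ys → ∃ λ zs → ys ++ zs ≡ Ms × length ys ≡ K × length zs ≡ K
    split₂ = split-list K Ms (proj₂ (proj₂ (proj₂ (proj₂ split₁))))
    Ms₁ Ms₂ : List (Fin n)
    Ms₁ = proj₁ split₂
    Ms₂ = proj₁ (proj₂ split₂)

    mult-split : ∀ v → mult Xs v + (mult Ms₁ v + mult Ms₂ v) ≡ S v
    mult-split v = begin
      mult Xs v + (mult Ms₁ v + mult Ms₂ v) ≡⟨ cong (mult Xs v +_) (mult-++ Ms₁ Ms₂ v) ⟨
      mult Xs v + mult (Ms₁ ++ Ms₂) v       ≡⟨ cong (λ l → mult Xs v + mult l v) (proj₁ (proj₂ (proj₂ split₂))) ⟩
      mult Xs v + mult Ms v                 ≡⟨ mult-++ Xs Ms v ⟨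
      mult (Xs ++ Ms) v                     ≡⟨ cong (λ l → mult l v) (proj₁ (proj₂ (proj₂ split₁))) ⟩
      mult Bs v                             ≡⟨ mult-Bs v ⟩
      S v                                   ∎
      where open ≡-Reasoning

    Xs≤B : ∀ v → mult Xs v ≤ B v
    Xs≤B v = ≤-trans (≤-trans (m≤m+n (mult Xs v) _) (≤-reflexive (mult-split v))) (S≤B v)

    trivials : ∃ λ ss → length ss ≡ length Xs × ∀ v → mult (allVertices ss) v ≡ mult Xs v
    trivials = trivial-segments Xs Xs≤B

    segments : List Segment
    segments = segs ++ proj₁ trivials

    |segments| : length segments ≡ K
    |segments| = trans (length-++ segs) (trans (cong₂ _+_ |segs| (trans (proj₁ (proj₂ trivials)) (proj₁ (proj₂ (proj₂ (proj₂ split₁))))))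
      (m+[n∸m]≡n P≤K))

    seg-family : ∃ λ (f : Fin K → Segment) → ∀ g → sum (λ i → g (f i)) ≡ sumL g segments
    seg-family = family segments |segments|
    s : Fin K → Segment
    s = proj₁ seg-family

    sum-vertices : ∀ v → sum (λ i → mult (vertices (s i)) v) ≡ mult (allVertices segs) v + mult Xs v
    sum-vertices v = trans (proj₂ seg-family (λ t → mult (vertices t) v)) (trans (sym (mult-allVertices segments v))
      (trans (allVertices-++ segs (proj₁ trivials) v) (cong (mult (allVertices segs) v +_) (proj₂ (proj₂ trivials) v))))

    a-family : ∃ λ (f : Fin K → Fin n) → ∀ v → sum (λ i → δ (f i) v) ≡ mult As v
    a-family = fin-family As |As|
    a : Fin K → Fin n
    a = proj₁ a-family
    Mlist : Bool → List (Fin n)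
    Mlist true  = Ms₁
    Mlist false = Ms₂
    |Mlist| : ∀ b → length (Mlist b) ≡ K
    |Mlist| true  = proj₁ (proj₂ (proj₂ (proj₂ split₂)))
    |Mlist| false = proj₂ (proj₂ (proj₂ (proj₂ split₂)))
    Mlist≤S : ∀ b v → mult (Mlist b) v ≤ S v
    Mlist≤S true  v = ≤-trans (m≤m+n (mult Ms₁ v) (mult Ms₂ v)) (≤-trans (m≤n+m _ (mult Xs v)) (≤-reflexive (mult-split v)))
    Mlist≤S false v = ≤-trans (m≤n+m (mult Ms₂ v) (mult Ms₁ v)) (≤-trans (m≤n+m _ (mult Xs v)) (≤-reflexive (mult-split v)))
    M-family : ∀ (b : Bool) → ∃ λ (f : Fin K → Fin n) → ∀ v → sum (λ i → δ (f i) v) ≡ mult (Mlist b) v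
    M-family b = fin-family (Mlist b) (|Mlist| b)
    M : Bool → Fin K → Fin n
    M b = proj₁ (M-family b)
    sum-M : ∀ v → sum (λ i → δ (M true i) v) + sum (λ i → δ (M false i) v) ≡ mult Ms₁ v + mult Ms₂ v
    sum-M v = cong₂ _+_ (proj₂ (M-family true) v) (proj₂ (M-family false) v)

    a≤A : ∀ v → sum (λ i → δ (a i) v) ≤ A v
    a≤A v = ≤-trans (≤-reflexive (trans (proj₂ a-family v) (mult-As v))) (R≤A v)
    M≤B : ∀ b v → sum (λ i → δ (M b i) v) ≤ B v
    M≤B b v = ≤-trans (≤-trans (≤-reflexive (proj₂ (M-family b) v)) (Mlist≤S b v)) (S≤B v)

    occurs : ∀ {k} (f : Fin k → Fin n) i → 1 ≤ sum (λ j → δ (f j) (f i))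
    occurs f i = ≤-trans (≤-reflexive (sym (δ-refl (f i)))) (term≤sum (λ j → δ (f j) (f i)) i)

    a∈Core : ∀ i → Core (a i) ≡ 1
    a∈Core i = R⇒Core (a i) (≤-antisym (≤-trans (≤-trans (m≤m+n (R (a i)) (S (a i))) (m≤n+m _ (mult (allVertices segs) (a i)))) (≤-reflexive (total (a i))))
      (≤-trans (occurs a i) (≤-reflexive (trans (proj₂ a-family (a i)) (mult-As (a i))))))
    M∈B : ∀ b i → B (M b i) ≡ 1
    M∈B b i = pos-bit (B≤1 (M b i)) (≤-trans (occurs (M b) i) (M≤B b (M b i)))

    st : Fin K → Fin n
    st i = start (s i)

    K>0 : 0 < K
    K>0 = ≤-trans (s≤s z≤n) 13h<K

    zeroth : Fin K
    zeroth = fromℕ< K>0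
    last : Fin n
    -- The default `st zeroth` never takes effect: `K` is positive, so `last` is the start of the
    -- first segment and the chain of blocks closes up.
    last = first st (st zeroth)

    closes : first st last ≡ last
    closes = first-const st
      where
      first-const : ∀ {K} (st : Fin K → Fin n) {x} → first st (first st x) ≡ first st x
      first-const {zero}  st = refl
      first-const {suc K} st = refl

    last∈B : B last ≡ 1
    last∈B = first-prop st (λ i → start∈B (s i)) (start∈B (s zeroth))
      where
      first-prop : ∀ {K} (f : Fin K → Fin n) {x} → (∀ i → B (f i) ≡ 1) → B x ≡ 1 → B (first f x) ≡ 1
      first-prop {zero}  f p q = q
      first-prop {suc K} f p q = p zero

    -- A block runs from the end of its segment over a middle vertex to a vertex of `A`, and over
    -- another middle vertex to the start of the next segment. `L b i` is the link in `B` of each of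
    -- these two edges; the other link is the shared A-vertex.
    L : Bool → Fin K → Fin n
    L true  i = end (s i)
    L false i = next st last i

    L∈B : ∀ b i → B (L b i) ≡ 1
    L∈B true  i = end∈B (s i)
    L∈B false i = next-prop (λ x → B x ≡ 1) st last (λ j → start∈B (s j)) last∈B i

    sum-next-st : ∀ v → sum (λ i → δ (next st last i) v) ≡ sum (λ i → δ (st i) v)
    sum-next-st v = +-cancelˡ-≡ (δ last v) _ _ (trans (cong (λ x → δ x v + sum (λ i → δ (next st last i) v)) (sym closes))
      (trans (sum-next (λ x → δ x v) st last) (+-comm (sum (λ i → δ (st i) v)) (δ last v))))

    vertices≤1 : ∀ v → sum (λ i → mult (vertices (s i)) v) ≤ 1
    vertices≤1 v = ≤-trans (≤-reflexive (sum-vertices v)) (≤-trans (+-monoʳ-≤ (mult (allVertices segs) v)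
      (≤-trans (≤-trans (m≤m+n (mult Xs v) _) (≤-reflexive (mult-split v))) (m≤n+m (S v) (R v)))) (≤-reflexive (total v)))

    L≤1 : ∀ b v → sum (λ i → δ (L b i) v) ≤ 1
    L≤1 true  v = ≤-trans (sum-mono λ i → end-is-vertex (steps (s i)) (chain (s i)) v) (vertices≤1 v)
    L≤1 false v = ≤-trans (≤-reflexive (sum-next-st v)) (≤-trans (sum-mono λ i → m≤m+n (δ (st i) v) _) (vertices≤1 v))

    L≤B : ∀ b v → sum (λ i → δ (L b i) v) ≤ B v
    L≤B b v = by-sign (sum (λ i → δ (L b i) v)) refl
      where
      by-sign : ∀ k → k ≡ sum (λ i → δ (L b i) v) → k ≤ B v
      by-sign zero    eq = z≤n
      by-sign (suc k) eq = ≤-trans (≤-trans (≤-reflexive eq) (L≤1 b v)) (≤-reflexive (sym v∈B))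
        where
        hit : ∃ λ i → 0 < δ (L b i) v
        hit = sum-pos (subst (0 <_) eq (s≤s z≤n))
        v∈B : B v ≡ 1
        v∈B = trans (cong B (sym (δ-≡ (proj₂ hit)))) (L∈B b (proj₁ hit))

    bad : Bool → Fin K → Fin K → Fin K → ℕ
    bad b i m k = ē (L b i) (M b m) (a k)

    via-A : ∀ {k} v (f : Fin k → Fin n) → (∀ x → sum (λ i → δ (f i) x) ≤ 1) → B v ≡ 1 → sum₂ (λ j i → ē v (a j) (f i)) ≤ g
    via-A v f f≤1 v∈B = ≤-trans (double-family a f A (λ _ → 1) (ē v) a≤A f≤1)
      (≤-trans (≤-reflexive (sum₂-cong λ y z → cong (A y *_) (*-identityˡ (ē v y z)))) (B-missing v∈B))

    -- Each of the three bounds fixes one vertex of a slot. A link or middle vertex in `B` is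
    -- handled by `B-missing`; a fixed A-item requires `Core-missing`, which is why no exceptional
    -- vertex may be left.
    slot-bad : ∀ b i → sum₂ (λ m k → bad b i m k) ≤ g
    slot-bad b i = ≤-trans (≤-reflexive (trans (∑-comm λ m k → bad b i m k) (sum₂-cong λ k m → ē-swap₂₃ (L b i) (M b m) (a k))))
      (via-A (L b i) (M b) (λ x → ≤-trans (M≤B b x) (B≤1 x)) (L∈B b i))

    a-bad : ∀ b k → sum₂ (λ i m → bad b i m k) ≤ g
    a-bad b k = ≤-trans (≤-reflexive (sum₂-cong λ i m → trans (ē-swap₂₃ (L b i) (M b m) (a k)) (ē-swap₁₂ (L b i) (a k) (M b m))))
      (≤-trans (double-family (L b) (M b) B B (ē (a k)) (L≤B b) (M≤B b)) (Core-missing (a∈Core k)))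

    m-bad : ∀ b m → sum₂ (λ i k → bad b i m k) ≤ g
    m-bad b m = ≤-trans (≤-reflexive (trans (∑-comm λ i k → bad b i m k)
        (sum₂-cong λ k i → trans (ē-swap₁₂ (L b i) (M b m) (a k)) (ē-swap₂₃ (M b m) (L b i) (a k)))))
      (via-A (M b m) (L b) (L≤1 b) (M∈B b m))

    module Re = Rearrangement bad g h slot-bad a-bad m-bad g≤h² 0<h 13h<K

    cycle : ∃ λ x → ∃ λ ps → Chain x ps x × ∀ v → mult (flat ps) v ≡ 1
    cycle = build Re.rearrangement
      where
      build : (∃ λ s → ∀ i b → Re.Fine s b i) → ∃ λ x → ∃ λ ps → Chain x ps x × ∀ v → mult (flat ps) v ≡ 1
      build (r , fine) = last , concatenate q , subst (λ x → Chain x (concatenate q) last) closes (chain-concatenate st last q q-chain) , all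
        where
        m : Bool → Fin K → Fin n
        m b i = M b (Re.State.μ r b ⟨$⟩ʳ i)
        k : Fin K → Fin n
        k i = a (Re.State.α r ⟨$⟩ʳ i)
        q : Fin K → Steps
        q i = steps (s i) ++ (m true i , k i) ∷ (m false i , next st last i) ∷ []
        joined : ∀ b i → e (L b i) (m b i) (k i) ≡ 1
        joined b i = ≤-antisym (e≤1 _ _ _) (m∸n≡0⇒m≤n (fine i b))
        q-chain : ∀ i → Chain (st i) (q i) (next st last i)
        q-chain i = chain-++ (steps (s i)) (chain (s i)) (joined true i ,
          trans (e-swap₁₂ (k i) (m false i) (next st last i)) (trans (e-swap₂₃ (m false i) (k i) (next st last i))
            (trans (e-swap₁₂ (m false i) (next st last i) (k i)) (joined false i))) , refl)
        all : ∀ v → mult (flat (concatenate q)) v ≡ 1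
        all v = begin
          mult (flat (concatenate q)) v
            ≡⟨ mult-concatenate q v ⟩
          sum (λ i → mult (flat (q i)) v)
            ≡⟨ sum-cong-≗ (λ i → trans (mult-flat-++ (steps (s i)) _ v) (spread (mult (flat (steps (s i))) v) (δ (m true i) v) (δ (k i) v) (δ (m false i) v) (δ (next st last i) v))) ⟩
          sum (λ i → (δ (next st last i) v + mult (flat (steps (s i))) v) + ((δ (m true i) v + δ (m false i) v) + δ (k i) v))
            ≡⟨ trans sum-+ (cong₂ _+_ sum-+ (trans sum-+ (cong (_+ sum (λ i → δ (k i) v)) sum-+))) ⟩
          sum (λ i → δ (next st last i) v) + sum (λ i → mult (flat (steps (s i))) v) + ((sum (λ i → δ (m true i) v) + sum (λ i → δ (m false i) v)) + sum (λ i → δ (k i) v))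
            ≡⟨ cong₂ _+_ (trans (cong (_+ sum (λ i → mult (flat (steps (s i))) v)) (sum-next-st v)) (sym sum-+))
                 (cong₂ _+_ (cong₂ _+_ (permute (M true) (Re.State.μ r true)) (permute (M false) (Re.State.μ r false))) (permute a (Re.State.α r))) ⟩
          sum (λ i → mult (vertices (s i)) v) + ((sum (λ i → δ (M true i) v) + sum (λ i → δ (M false i) v)) + sum (λ i → δ (a i) v))
            ≡⟨ cong₂ _+_ (sum-vertices v) (cong₂ _+_ (sum-M v) (trans (proj₂ a-family v) (mult-As v))) ⟩
          mult (allVertices segs) v + mult Xs v + ((mult Ms₁ v + mult Ms₂ v) + R v)
            ≡⟨ collect (mult (allVertices segs) v) (mult Xs v) (mult Ms₁ v + mult Ms₂ v) (R v) ⟩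
          mult (allVertices segs) v + (R v + (mult Xs v + (mult Ms₁ v + mult Ms₂ v)))
            ≡⟨ cong (λ t → mult (allVertices segs) v + (R v + t)) (mult-split v) ⟩
          mult (allVertices segs) v + (R v + S v)
            ≡⟨ total v ⟩
          1 ∎
          where
          open ≡-Reasoning
          spread : ∀ f a b c d → f + (a + (b + (c + (d + 0)))) ≡ d + f + ((a + c) + b)
          spread = solve-∀
          collect : ∀ u x m r → u + x + (m + r) ≡ u + (r + (x + m))
          collect = solve-∀
          permute : ∀ (f : Fin K → Fin n) (π : Permutation′ K) → sum (λ i → δ (f (π ⟨$⟩ʳ i)) v) ≡ sum (λ i → δ (f i) v)
          permute f π = sum-permute (λ i → δ (f i) v) π

-- From chains to loose Hamilton cycles

-- A positive number of preimages gives surjectivity, and after one preimage is taken out nothing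
-- remains for a second.
cover-once⇒permutation : ∀ {n} (f : Fin n → Fin n) → (∀ v → sum (λ j → δ (f j) v) ≡ 1) →
  ∃ λ (π : Permutation′ n) → ∀ j → π ⟨$⟩ʳ j ≡ f j
cover-once⇒permutation {n} f once = permutation f g fg (λ j → injective (fg (f j))) , λ j → refl
  where
  hit : ∀ v → ∃ λ j → 0 < δ (f j) v
  hit v = sum-pos (≤-reflexive (sym (once v)))
  g : Fin n → Fin n
  g v = proj₁ (hit v)
  fg : ∀ v → f (g v) ≡ v
  fg v = δ-≡ (proj₂ (hit v))
  injective : ∀ {a b} → f a ≡ f b → a ≡ b
  injective {a} {b} eq = by-cases (a F.≟ b)
    where
    v = f a
    without : ∃ λ r → (∀ j → δ (f j) v ≡ δ a j + r j) × sum (λ j → δ (f j) v) ≡ suc (sum r)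
    without = take-out {f = λ j → δ (f j) v} a (δ-refl v)
    by-cases : Dec (a ≡ b) → a ≡ b
    by-cases (yes p) = p
    by-cases (no a≢b) = contradiction
      (trans (sym (rest-at (proj₁ (proj₂ without)) a≢b (trans (cong (λ x → δ x v) (sym eq)) (δ-refl v))))
        (sum-zero (suc-injective (trans (sym (proj₂ (proj₂ without))) (once v))) b)) λ ()

double : ℕ → ℕ
double zero    = 0
double (suc i) = suc (suc (double i))

double≡2* : ∀ i → double i ≡ 2 * i
double≡2* zero    = refl
double≡2* (suc i) = trans (cong (2 +_) (double≡2* i)) (sym (*-suc 2 i))

module Cycle {n} (H : Hypergraph3 n) (B : Fin n → ℕ) where
  open Degrees H
  open Segments e B

  -- The vertex at a given position of the path; positions beyond the end are assigned the last
  -- link.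
  at : Fin n → Steps → ℕ → Fin n
  at x ps             zero          = x
  at x []             (suc k)       = x
  at x ((m , l) ∷ ps) 1             = m
  at x ((m , l) ∷ ps) (suc (suc k)) = at l ps k

  at-edge : ∀ {x z} ps → Chain x ps z → ∀ {i} → i < length ps →
    e (at x ps (double i)) (at x ps (suc (double i))) (at x ps (double (suc i))) ≡ 1
  at-edge ((m , l) ∷ ps) (p , c) {zero}  _         = p
  at-edge ((m , l) ∷ ps) (p , c) {suc i} (s≤s i<) = at-edge ps c i<

  at-end : ∀ {x z} ps → Chain x ps z → at x ps (double (length ps)) ≡ z
  at-end []             refl    = refl
  at-end ((m , l) ∷ ps) (p , c) = at-end ps c

  -- The positions counted include the start and omit the end, whereas `flat` does the opposite. For
  -- a closed chain the two corrections cancel.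
  at-covers : ∀ {x z} ps → Chain x ps z → ∀ v →
    sum {double (length ps)} (λ j → δ (at x ps (toℕ j)) v) + δ z v ≡ δ x v + mult (flat ps) v
  at-covers {x} []         refl    v = trans (cong (_+ δ x v) (sum-empty _)) (sym (+-identityʳ (δ x v)))
  at-covers {x} {z} ((m , l) ∷ ps) (p , c) v = begin
    sum {double (length ((m , l) ∷ ps))} (λ j → δ (at x ((m , l) ∷ ps) (toℕ j)) v) + δ z v
      ≡⟨ cong (_+ δ z v) (trans (sum-suc _) (cong (δ x v +_) (sum-suc _))) ⟩
    δ x v + (δ m v + sum {double (length ps)} (λ j → δ (at l ps (toℕ j)) v)) + δ z v
      ≡⟨ regroup (δ x v) (δ m v) _ (δ z v) ⟩
    δ x v + (δ m v + (sum {double (length ps)} (λ j → δ (at l ps (toℕ j)) v) + δ z v))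
      ≡⟨ cong (λ k → δ x v + (δ m v + k)) (at-covers ps c v) ⟩
    δ x v + mult (flat ((m , l) ∷ ps)) v ∎
    where
    open ≡-Reasoning
    regroup : ∀ a b c d → a + (b + c) + d ≡ a + (b + (c + d))
    regroup = solve-∀

  length-flat : ∀ ps → length (flat ps) ≡ double (length ps)
  length-flat []             = refl
  length-flat ((m , l) ∷ ps) = cong (2 +_) (length-flat ps)

  hamilton : NonZero n → ∀ x ps → Chain x ps x → (∀ v → mult (flat ps) v ≡ 1) → LooseHamiltonCycle H
  hamilton nz x ps c once = nz , divides k (trans n≡ (trans (double≡2* k) (*-comm 2 k))) , σ , edges′
    where
    k = length ps
    n≡ : n ≡ double k
    n≡ = begin
      n                        ≡⟨ trans (sum-const n 1) (*-identityʳ n) ⟨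
      sum {n} (λ _ → 1)        ≡⟨ sum-cong-≗ once ⟨
      sum (mult (flat ps))     ≡⟨ sum-mult (flat ps) ⟩
      length (flat ps)         ≡⟨ length-flat ps ⟩
      double k                 ∎
      where open ≡-Reasoning
    covers : ∀ v → sum {n} (λ j → δ (at x ps (toℕ j)) v) ≡ 1
    covers v = trans (cong (λ N → sum {N} (λ j → δ (at x ps (toℕ j)) v)) n≡)
      (trans (+-cancelʳ-≡ (δ x v) _ _ (trans (at-covers ps c v) (+-comm (δ x v) _))) (once v))
    perm : ∃ λ (π : Permutation′ n) → ∀ j → π ⟨$⟩ʳ j ≡ at x ps (toℕ j)
    perm = cover-once⇒permutation (λ j → at x ps (toℕ j)) covers
    σ : Permutation′ n
    σ = proj₁ perm
    instance
      n≢0 : NonZero n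
      n≢0 = nz
    σ-mod : ∀ i → σ ⟨$⟩ʳ (i mod n) ≡ at x ps (i % n)
    σ-mod i = trans (proj₂ perm (i mod n)) (cong (at x ps) (F.toℕ-fromℕ< (m%n<n i n)))
    σ< : ∀ {i} → i < n → σ ⟨$⟩ʳ (i mod n) ≡ at x ps i
    σ< {i} i<n = trans (σ-mod i) (cong (at x ps) (m<n⇒m%n≡m i<n))
    σ≤ : ∀ {i} → i ≤ n → σ ⟨$⟩ʳ (i mod n) ≡ at x ps i
    σ≤ {i} i≤n = by-cases (m≤n⇒m<n∨m≡n i≤n)
      where
      by-cases : i < n ⊎ i ≡ n → σ ⟨$⟩ʳ (i mod n) ≡ at x ps i
      by-cases (inj₁ i<n) = σ< i<n
      -- Only the last edge reaches position `n`, which wraps around to 0; the chain is closed, so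
      -- the same vertex stands there.
      by-cases (inj₂ refl) = trans (σ-mod n) (trans (cong (at x ps) (n%n≡0 n)) (sym (trans (cong (at x ps) n≡) (at-end ps c))))
    n/2≡ : n / 2 ≡ k
    n/2≡ = trans (cong (_/ 2) (trans n≡ (trans (double≡2* k) (*-comm 2 k)))) (m*n/n≡m k 2)
    edges′ : ∀ i → i < n / 2 → T (edge H (triple (σ ⟨$⟩ʳ ((2 * i) mod n)) (σ ⟨$⟩ʳ ((2 * i + 1) mod n)) (σ ⟨$⟩ʳ ((2 * i + 2) mod n))))
    edges′ i i< = ι⇒T _ (trans (cong₃ (σ≤ {2 * i} (≤-trans (≤-trans (n≤1+n _) (n≤1+n _)) two))
        (σ≤ {2 * i + 1} (≤-trans (≤-reflexive (+-comm (2 * i) 1)) (≤-trans (n≤1+n _) two))) (σ≤ {2 * i + 2} (≤-trans (≤-reflexive (+-comm (2 * i) 2)) two)))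
      (trans (cong₃ (cong (at x ps) (sym (double≡2* i))) (cong (at x ps) (trans (+-comm (2 * i) 1) (cong suc (sym (double≡2* i)))))
        (cong (at x ps) (trans (+-comm (2 * i) 2) (cong (2 +_) (sym (double≡2* i)))))) (at-edge ps c i<k)))
      where
      i<k : i < k
      i<k = subst (i <_) n/2≡ i<
      two : 2 + 2 * i ≤ n
      two = ≤-trans (≤-reflexive (sym (*-suc 2 i))) (≤-trans (*-monoʳ-≤ 2 i<k) (≤-reflexive (sym (trans n≡ (double≡2* k)))))
      cong₃ : ∀ {x x′ y y′ z z′} → x ≡ x′ → y ≡ y′ → z ≡ z′ → e x y z ≡ e x′ y′ z′
      cong₃ refl refl refl = refl

-- Degrees inside B

module InsideDegree (N : ℕ) (e : Fin (suc N) → Fin (suc N) → Fin (suc N) → ℕ) (e≤1 : ∀ x y z → e x y z ≤ 1)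
  (e-swap₁₂ : ∀ x y z → e x y z ≡ e y x z) (e-swap₂₃ : ∀ x y z → e x y z ≡ e x z y)
  (e-diag : ∀ x y → e x x y ≡ 0)
  (B : Fin (suc N) → ℕ) (B≤1 : ∀ v → B v ≤ 1) (b₀ c b : ℕ) (sum-B : sum B ≡ suc b)
  (min-degree : ∀ v → N * N + (b₀ + 2 * c) ≤ sum₂ (e v) + (b₀ * b₀ + N))
  where

  open ThreeGraph e e-swap₁₂ e-swap₂₃ e-diag

  n : ℕ
  n = suc N

  sum-diagonal : ∀ (f : Fin n → ℕ) → (∀ v → f v ≤ 1) → sum₂ (λ y z → δ y z * (f y * f z)) ≡ sum f
  sum-diagonal f f≤1 = sum-cong-≗ λ y → trans (sum-δ y (λ z → f y * f z)) (idem (bit (f≤1 y)))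
    where
    idem : ∀ {x} → x ≡ 0 ⊎ x ≡ 1 → x * x ≡ x
    idem (inj₁ refl) = refl
    idem (inj₂ refl) = refl

  -- Of the ordered pairs of distinct vertices other than `v`, those not contained in `B` number
  -- `N * N` minus `N` minus `b * b` plus `b`. Even if all of them complete `v` to edges, the
  -- remaining edges at `v` lie inside `B`.
  inside-degree : ∀ v → B v ≡ 1 → b * b + (b₀ + 2 * c) ≤ sum₂ (λ y z → B y * (B z * e v y z)) + (b₀ * b₀ + b)
  inside-degree v v∈B = linear 0 (+-mono-≤ (min-degree v) summed)
    (certificate N b₀ c b (sum₂ (e v)) (sum₂ λ y z → B y * (B z * e v y z)))
    where
    without : ∃ λ r → (∀ u → B u ≡ δ v u + r u) × sum B ≡ suc (sum r)
    without = take-out {f = B} v v∈B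
    others : ∃ λ r → (∀ u → 1 ≡ δ v u + r u) × sum {n} (λ _ → 1) ≡ suc (sum r)
    others = take-out {f = λ _ → 1} v refl
    B′ o : Fin n → ℕ
    B′ = proj₁ without
    o = proj₁ others
    sum-B′ : sum B′ ≡ b
    sum-B′ = suc-injective (trans (sym (proj₂ (proj₂ without))) sum-B)
    sum-o : sum o ≡ N
    sum-o = suc-injective (trans (sym (proj₂ (proj₂ others))) (trans (sum-const n 1) (*-identityʳ n)))
    B′≤1 : ∀ u → B′ u ≤ 1
    B′≤1 u = ≤-trans (≤-trans (m≤n+m (B′ u) (δ v u)) (≤-reflexive (sym (proj₁ (proj₂ without) u)))) (B≤1 u)
    o≤1 : ∀ u → o u ≤ 1
    o≤1 u = ≤-trans (m≤n+m (o u) (δ v u)) (≤-reflexive (sym (proj₁ (proj₂ others) u)))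
    B′≡B : ∀ {u} → v ≢ u → B′ u ≡ B u
    B′≡B {u} v≢u = sym (trans (proj₁ (proj₂ without) u) (cong (_+ B′ u) (δ-≢ v≢u)))
    o≡1 : ∀ {u} → v ≢ u → o u ≡ 1
    o≡1 {u} v≢u = sym (trans (proj₁ (proj₂ others) u) (cong (_+ o u) (δ-≢ v≢u)))
    B′v≡0 : B′ v ≡ 0
    B′v≡0 = suc-injective (trans (cong (_+ B′ v) (sym (δ-refl v))) (trans (sym (proj₁ (proj₂ without) v)) v∈B))

    -- `o` and `B′` are the vertices other than `v`, among all and inside `B`. The terms with
    -- `δ y z` subtract the diagonals by standing on opposite sides.
    Pointwise : Fin n → Fin n → Set
    Pointwise y z = e v y z + (B′ y * B′ z + δ y z * (o y * o z)) ≤ B y * (B z * e v y z) + (o y * o z + δ y z * (B′ y * B′ z))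
    pointwise : ∀ y z → Pointwise y z
    pointwise y z = by-cases (y F.≟ z) (v F.≟ y) (v F.≟ z)
      where
      drop-δ : e v y z + B′ y * B′ z ≤ B y * (B z * e v y z) + o y * o z → δ y z ≡ 0 → Pointwise y z
      drop-δ p eq = subst (λ d → e v y z + (B′ y * B′ z + d * (o y * o z)) ≤ B y * (B z * e v y z) + (o y * o z + d * (B′ y * B′ z))) (sym eq)
        (subst₂ (λ s t → e v y z + s ≤ B y * (B z * e v y z) + t) (sym (+-identityʳ _)) (sym (+-identityʳ _)) p)
      bits : ∀ {x y z} → x ≤ 1 → y ≤ 1 → z ≤ 1 → z + x * y ≤ x * (y * z) + 1
      bits {x} {y} {z} p q r = go (bit p) (bit q) (bit r)
        where
        go : x ≡ 0 ⊎ x ≡ 1 → y ≡ 0 ⊎ y ≡ 1 → z ≡ 0 ⊎ z ≡ 1 → z + x * y ≤ x * (y * z) + 1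
        go (inj₁ refl) _ _ = ≤-trans (≤-reflexive (+-identityʳ z)) r
        go (inj₂ refl) (inj₁ refl) _ = ≤-trans (≤-reflexive (+-identityʳ z)) r
        go (inj₂ refl) (inj₂ refl) (inj₁ refl) = ≤-refl
        go (inj₂ refl) (inj₂ refl) (inj₂ refl) = ≤-refl
      by-cases : Dec (y ≡ z) → Dec (v ≡ y) → Dec (v ≡ z) → Pointwise y z
      by-cases (yes refl) _ _ = subst₂ (λ k d → k + (B′ y * B′ y + d * (o y * o y)) ≤ B y * (B y * k) + (o y * o y + d * (B′ y * B′ y)))
        (sym (e-diag₂₃ v y)) (sym (δ-refl y)) (≤-trans (≤-reflexive (regroup (B′ y * B′ y) (o y * o y))) (m≤n+m _ (B y * (B y * 0))))
        where
        regroup : ∀ p q → 0 + (p + 1 * q) ≡ q + 1 * p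
        regroup = solve-∀
      by-cases (no y≢z) (yes refl) _ = drop-δ (subst₂ (λ k l → k + l * B′ z ≤ B y * (B z * k) + o y * o z) (sym (e-diag y z)) (sym B′v≡0) z≤n) (δ-≢ y≢z)
      by-cases (no y≢z) (no _) (yes refl) = drop-δ (subst₂ (λ k l → k + B′ y * l ≤ B y * (B z * k) + o y * o z)
        (sym (trans (e-swap₂₃ z y z) (e-diag z y))) (sym B′v≡0) (≤-trans (≤-reflexive (*-zeroʳ (B′ y))) z≤n)) (δ-≢ y≢z)
      by-cases (no y≢z) (no v≢y) (no v≢z) = drop-δ (subst₂ (λ s t → e v y z + s ≤ B y * (B z * e v y z) + t)
        (sym (cong₂ _*_ (B′≡B v≢y) (B′≡B v≢z))) (sym (cong₂ _*_ (o≡1 v≢y) (o≡1 v≢z))) (bits (B≤1 y) (B≤1 z) (e≤1 v y z))) (δ-≢ y≢z)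

    summed : sum₂ (e v) + (b * b + N) ≤ sum₂ (λ y z → B y * (B z * e v y z)) + (N * N + b)
    summed = begin
      sum₂ (e v) + (b * b + N)
        ≡⟨ cong (sum₂ (e v) +_) (cong₂ _+_ (trans (sum₂-product B′ B′) (cong₂ _*_ sum-B′ sum-B′)) (trans (sum-diagonal o o≤1) sum-o)) ⟨
      sum₂ (e v) + (sum₂ (λ y z → B′ y * B′ z) + sum₂ (λ y z → δ y z * (o y * o z)))
        ≡⟨ trans sum₂-+ (cong (sum₂ (e v) +_) sum₂-+) ⟨
      sum₂ (λ y z → e v y z + (B′ y * B′ z + δ y z * (o y * o z)))
        ≤⟨ sum₂-mono pointwise ⟩
      sum₂ (λ y z → B y * (B z * e v y z) + (o y * o z + δ y z * (B′ y * B′ z)))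
        ≡⟨ trans sum₂-+ (cong (sum₂ (λ y z → B y * (B z * e v y z)) +_) sum₂-+) ⟩
      sum₂ (λ y z → B y * (B z * e v y z)) + (sum₂ (λ y z → o y * o z) + sum₂ (λ y z → δ y z * (B′ y * B′ z)))
        ≡⟨ cong (sum₂ (λ y z → B y * (B z * e v y z)) +_) (cong₂ _+_ (trans (sum₂-product o o) (cong₂ _*_ sum-o sum-o)) (trans (sum-diagonal B′ B′≤1) sum-B′)) ⟩
      sum₂ (λ y z → B y * (B z * e v y z)) + (N * N + b) ∎
      where open ≤-Reasoning
    certificate : ∀ N b₀ c b s d → b * b + (b₀ + 2 * c) + (s + (b₀ * b₀ + N) + (d + (N * N + b))) + 0
      ≡ d + (b₀ * b₀ + b) + (N * N + (b₀ + 2 * c) + (s + (b * b + N)))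
    certificate = solve-∀

-- Balancing the two classes

equate : ∀ {a b L R} → L ≡ R → a + R ≡ b + L → a ≡ b
equate {a} {b} {L} {R} refl eq = +-cancelʳ-≡ R a b eq

-- n = 4k + 2r with r ≤ 1, so that ⌊3n/4⌋ = 3k + r and c = 2 − r.
module Main (N k r c b₀ w X : ℕ)
  (e : Fin (suc N) → Fin (suc N) → Fin (suc N) → ℕ) (e≤1 : ∀ x y z → e x y z ≤ 1)
  (e-swap₁₂ : ∀ x y z → e x y z ≡ e y x z) (e-swap₂₃ : ∀ x y z → e x y z ≡ e x z y)
  (e-diag : ∀ x y → e x x y ≡ 0)
  (B₀ : Fin (suc N) → ℕ) (B₀≤1 : ∀ v → B₀ v ≤ 1) (sum-B₀ : sum B₀ ≡ b₀)
  (n≡ : suc N ≡ 4 * k + 2 * r) (b₀≡ : b₀ ≡ 3 * k + r) (r≤1 : r ≤ 1) (c+r≡2 : c + r ≡ 2)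
  (min-degree : ∀ v → N * N + (b₀ + 2 * c) ≤ sum₂ (e v) + (b₀ * b₀ + N))
  (extremal : sum (λ v → B₀ v * sum₂ (λ y z → B₀ y * (B₀ z * e v y z))) ≤ X)
  (small : suc N * (3 * suc N) + 2 * X < suc w * (30 * (w * suc N)))
  (lower : 200000 * w ≤ suc N) (upper : suc N ≤ 250000 * w) (10≤w : 10 ≤ w)
  where

  n θ : ℕ
  n = suc N
  θ = 30 * (w * n)

  scale : ∀ c {_ : T (c ≤ᵇ 200000)} → c * w ≤ n
  scale c {p} = ≤-trans (*-monoˡ-≤ w (≤ᵇ⇒≤ c 200000 p)) lower

  0<w : 0 < w
  0<w = ≤-trans (s≤s z≤n) 10≤w

  0<wn : 0 < w * n
  0<wn = *-mono-≤ 0<w (s≤s z≤n)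

  n≤2b₀ : n ≤ 2 * b₀
  n≤2b₀ = linear (2 * k) (+-mono-≤ (≤-reflexive n≡) (*-monoʳ-≤ 2 (≤-reflexive (sym b₀≡)))) (certificate n k r b₀)
    where
    certificate : ∀ n k r b → n + (4 * k + 2 * r + 2 * b) + 2 * k ≡ 2 * b + (n + 2 * (3 * k + r))
    certificate = solve-∀

  b₀≤n : b₀ ≤ n
  b₀≤n = linear (k + r) (+-mono-≤ (≤-reflexive (sym n≡)) (≤-reflexive b₀≡)) (certificate n k r b₀)
    where
    certificate : ∀ n k r b → b + (n + (3 * k + r)) + (k + r) ≡ n + (4 * k + 2 * r + b)
    certificate = solve-∀

  n²≤4b₀² : n * n ≤ 4 * (b₀ * b₀)
  n²≤4b₀² = ≤-trans (*-mono-≤ n≤2b₀ n≤2b₀) (≤-reflexive (square b₀))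
    where
    square : ∀ b → 2 * b * (2 * b) ≡ 4 * (b * b)
    square = solve-∀

  2θ≤b₀² : 2 * θ ≤ b₀ * b₀
  2θ≤b₀² = *-cancelˡ-≤ 4 (begin
    4 * (2 * θ)       ≡⟨ regroup w n ⟩
    240 * w * n       ≤⟨ *-monoˡ-≤ n (scale 240) ⟩
    n * n             ≤⟨ n²≤4b₀² ⟩
    4 * (b₀ * b₀)     ∎)
    where
    open ≤-Reasoning
    regroup : ∀ w n → 4 * (2 * (30 * (w * n))) ≡ 240 * w * n
    regroup = solve-∀

  open Structure N e e≤1 e-swap₁₂ B₀ B₀≤1 b₀ sum-B₀ c X w θ min-degree extremal small 2θ≤b₀²
    using (A; B; Core; W; B≤1; Core≤1; A+B; B≤B₀+W; B₀≤B+W; A≤Core+W; sum-W; B-missing; B-degree; Core-missing; A-degree)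

  open Segments e B
  open Greedy e e≤1 e-swap₁₂ e-swap₂₃ e-diag A B A+B w θ A-degree using (State; Partition; A-segments; module Absorb)
  open Inside e e≤1 e-swap₁₂ e-swap₂₃ e-diag B B≤1 using (Interior; module Disjoint; module Two; d)

  a b : ℕ
  a = sum A
  b = sum B

  a+b : a + b ≡ n
  a+b = trans (sym sum-+) (trans (sum-cong-≗ A+B) (trans (sum-const n 1) (*-identityʳ n)))

  b≤b₀+w : b ≤ b₀ + w
  b≤b₀+w = ≤-trans (sum-mono B≤B₀+W) (≤-trans (≤-reflexive sum-+) (+-mono-≤ (≤-reflexive sum-B₀) sum-W))

  b₀≤b+w : b₀ ≤ b + w
  b₀≤b+w = ≤-trans (≤-reflexive (sym sum-B₀)) (≤-trans (sum-mono B₀≤B+W) (≤-trans (≤-reflexive sum-+) (+-monoʳ-≤ b sum-W)))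

  -- At most `12 * w` vertices are ever used: `7 * w` for balancing and 5 for each of at most `w`
  -- exceptional vertices. Together with the misplaced ones they spoil at most `26 * (w * n)` pairs,
  -- hence the 30 in `θ`.
  room : ∀ {v} → v ≤ 12 * w → 2 * (n * w + n * v) < θ
  room {v} v≤ = linear 3 (+-mono-≤ (*-monoʳ-≤ 2 (*-monoʳ-≤ n v≤)) (*-monoʳ-≤ 4 0<wn)) (certificate n w v)
    where
    certificate : ∀ n w v → suc (2 * (n * w + n * v)) + (2 * (n * (12 * w)) + 4 * (w * n)) + 3 ≡ 30 * (w * n) + (2 * (n * v) + 4 * 1)
    certificate = solve-∀

  7w≤12w : 7 * w ≤ 12 * w
  7w≤12w = *-monoˡ-≤ w (≤ᵇ⇒≤ 7 12 _)

  surplus : b ≤ b₀ → State 0 (7 * w)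
  surplus b≤b₀ = A-segments j fit (room 7w≤12w) (record
    { segments = [] ; R = A ; S = B
    ; part = record { total = A+B ; R≤A = λ v → ≤-refl ; S≤B = λ v → ≤-refl }
    ; balance = balanced ; few = z≤n })
    where
    m j : ℕ
    m = 2 * k + r
    -- With `m` equal to half of `n`, this solves `b + 2 * j ≡ 3 * a` under `a + b ≡ n`.
    j = 2 * a ∸ m
    m≤2a : m ≤ 2 * a
    m≤2a = linear r (*-monoʳ-≤ 2 (+-mono-≤ (≤-reflexive (sym a+b)) (+-mono-≤ b≤b₀ (+-mono-≤ (≤-reflexive b₀≡) (≤-reflexive (sym n≡))))))
      (certificate n k r a b b₀)
      where
      certificate : ∀ n k r a b b₀ → 2 * k + r + 2 * (a + b + (b₀ + (3 * k + r + n))) + r ≡ 2 * a + 2 * (n + (b + (b₀ + (4 * k + 2 * r))))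
      certificate = solve-∀
    j+m : j + m ≡ 2 * a
    j+m = m∸n+n≡m m≤2a
    balanced : b + 0 + 2 * j ≡ 3 * a
    balanced = equate (cong₂ _+_ (cong (2 *_) j+m) (cong₂ _+_ a+b n≡)) (certificate n k r a b j)
      where
      certificate : ∀ n k r a b j → b + 0 + 2 * j + (2 * (2 * a) + (n + (4 * k + 2 * r))) ≡ 3 * a + (2 * (j + (2 * k + r)) + (a + b + n))
      certificate = solve-∀
    j≤ : j ≤ 2 * w + 1
    j≤ = linear 0 (+-mono-≤ (≤-reflexive j+m) (+-mono-≤ r≤1
        (*-monoʳ-≤ 2 (+-mono-≤ (≤-reflexive a+b) (+-mono-≤ b₀≤b+w (+-mono-≤ (≤-reflexive (sym b₀≡)) (≤-reflexive n≡)))))))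
      (certificate n k r a b b₀ w j)
      where
      certificate : ∀ n k r a b b₀ w j → j + (2 * a + (1 + 2 * (n + (b + w + (b₀ + (4 * k + 2 * r)))))) + 0
        ≡ 2 * w + 1 + (j + (2 * k + r) + (r + 2 * (a + b + (b₀ + (3 * k + r + n)))))
      certificate = solve-∀
    fit : 3 * j + 0 ≤ 7 * w
    -- Three vertices for each of at most `2 * w + 1` segments; `10 ≤ w` absorbs the additive
    -- constant.
    fit = linear 7 (+-mono-≤ (*-monoʳ-≤ 3 j≤) 10≤w) (certificate j w)
      where
      certificate : ∀ j w → 3 * j + 0 + (3 * (2 * w + 1) + w) + 7 ≡ 7 * w + (3 * j + 10)
      certificate = solve-∀

  M : ℕ
  M = θ + (n * w + n * w)

  B-degree′ : ∀ v → B v ≡ 1 → d v ≤ M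
  B-degree′ v = B-degree {v}

  module Deficit (s : ℕ) (b≡ : suc (b₀ + s) ≡ b) where

    s<w : suc s ≤ w
    s<w = linear 0 (+-mono-≤ (≤-reflexive b≡) b≤b₀+w) (certificate s w b b₀)
      where
      certificate : ∀ s w b b₀ → suc s + (b + (b₀ + w)) + 0 ≡ w + (suc (b₀ + s) + b)
      certificate = solve-∀

    inside-degree : ∀ v → B v ≡ 1 → (b₀ + s) * (b₀ + s) + (b₀ + 2 * c) ≤ d v + (b₀ * b₀ + (b₀ + s))
    inside-degree = InsideDegree.inside-degree N e e≤1 e-swap₁₂ e-swap₂₃ e-diag B B≤1 b₀ c (b₀ + s) (sym b≡) min-degree

    -- The bound on degrees inside `B` has main term `2 * (b₀ * s)` and remainder `s * s` minus `s`,
    -- both of which vanish at `s = 0`. There `2 * c` is all that is left.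
    2c≤d : ∀ v → B v ≡ 1 → 2 * c ≤ d v
    2c≤d v p = linear (2 * (b₀ * s)) (+-mono-≤ (inside-degree v p) (s≤s² s)) (certificate b₀ s c (d v))
      where
      s≤s² : ∀ s → s ≤ s * s
      s≤s² zero    = z≤n
      s≤s² (suc s) = m≤m+n (suc s) (s * suc s)
      certificate : ∀ b₀ s c d → 2 * c + (d + (b₀ * b₀ + (b₀ + s)) + s * s) + 2 * (b₀ * s) ≡ d + ((b₀ + s) * (b₀ + s) + (b₀ + 2 * c) + s)
      certificate = solve-∀

    5≤b : 5 ≤ b
    5≤b = *-cancelˡ-≤ 2 (linear (2 + 2 * s) (+-mono-≤ (scale 1) (+-mono-≤ n≤2b₀ (+-mono-≤ (*-monoʳ-≤ 2 (≤-reflexive b≡)) 10≤w))) (certificate n b₀ s w b))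
      where
      certificate : ∀ n b₀ s w b → 2 * 5 + (n + (2 * b₀ + (2 * b + w))) + (2 + 2 * s) ≡ 2 * b + (1 * w + (n + (2 * suc (b₀ + s) + 10)))
      certificate = solve-∀

  -- A balanced cycle using `j` edges inside `B` requires `4 * b ≡ 3 * n + 2 * j`; for
  -- `b ≡ suc (b₀ + s)` this becomes the stated relation with the residue `r`.
  Few : ℕ → Set
  Few s = ∃ λ j → j + r ≡ 2 * suc s × Interior j

  -- At `s = 0` a single edge, or the analysis in `Two`, is needed and the exact value of `c`
  -- decides. For `s > 0` the degrees inside `B` grow with `b₀`, and disjoint edges can be chosen
  -- greedily.
  few-edges : ∀ s → suc (b₀ + s) ≡ b → Few s
  few-edges zero b≡ = by-residue (bit r≤1)
    where
    open Deficit zero b≡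
    by-residue : r ≡ 0 ⊎ r ≡ 1 → Few zero
    by-residue (inj₁ r≡0) = 2 , cong (2 +_) r≡0 , Two.two 4≤d 5≤b
      where
      c≡2 : c ≡ 2
      c≡2 = trans (sym (+-identityʳ c)) (trans (cong (c +_) (sym r≡0)) c+r≡2)
      4≤d : ∀ v → B v ≡ 1 → 4 ≤ d v
      4≤d v p = ≤-trans (≤-reflexive (cong (2 *_) (sym c≡2))) (2c≤d v p)
    by-residue (inj₂ r≡1) = 1 , cong (1 +_) r≡1 , proj₁ (Disjoint.disjoint 2 M 2≤d B-degree′ 1 base)
      where
      c≡1 : c ≡ 1
      c≡1 = +-cancelʳ-≡ 1 c 1 (trans (cong (c +_) (sym r≡1)) c+r≡2)
      2≤d : ∀ v → B v ≡ 1 → 2 ≤ d v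
      2≤d v p = ≤-trans (≤-reflexive (cong (2 *_) (sym c≡1))) (2c≤d v p)
      base : ∀ i → i < 1 → 2 * (3 * i * M) + 3 * i * 2 < b * 2
      base zero _ = ≤-trans (s≤s z≤n) (*-monoˡ-≤ 2 (≤-trans (s≤s z≤n) 5≤b))
      base (suc i) (s≤s ())
  few-edges (suc s′) b≡ = j , j+r , proj₁ (Disjoint.disjoint L M L≤d B-degree′ j enough)
    where
    open Deficit (suc s′) b≡
    s j L : ℕ
    s = suc s′
    j = 2 * suc s ∸ r
    L = 2 * (s * b₀)
    j+r : j + r ≡ 2 * suc s
    j+r = m∸n+n≡m (≤-trans r≤1 (s≤s z≤n))
    L≤d : ∀ v → B v ≡ 1 → L ≤ d v
    L≤d v p = linear (s′ * suc s′ + 2 * c) (inside-degree v p) (certificate b₀ s′ c (d v))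
      where
      certificate : ∀ b₀ t c d → 2 * (suc t * b₀) + (d + (b₀ * b₀ + (b₀ + suc t))) + (t * suc t + 2 * c) ≡ d + ((b₀ + suc t) * (b₀ + suc t) + (b₀ + 2 * c))
      certificate = solve-∀
    -- Since `i ≤ 3 * s`, at most `9 * s` vertices are used, each with at most `32 * (w * n)`
    -- ordered pairs inside `B`. The available `b * L` is of order `s * (n * n)`, and `w` is a small
    -- fraction of `n`.
    enough : ∀ i → i < j → 2 * (3 * i * M) + 3 * i * L < b * L
    enough i i<j = *-cancelˡ-< 2 _ _ (begin-strict
      2 * (2 * (3 * i * M) + 3 * i * L)
        ≤⟨ *-monoʳ-≤ 2 (+-mono-≤ (*-monoʳ-≤ 2 (*-monoˡ-≤ M (*-monoʳ-≤ 3 i≤3s))) (*-monoˡ-≤ L (*-monoʳ-≤ 3 i≤3s))) ⟩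
      2 * (2 * (3 * (3 * s) * M) + 3 * (3 * s) * L)
        ≡⟨ expand s w n b₀ ⟩
      36 * (s * b₀) * s + 1152 * w * (s * n)
        ≤⟨ +-monoˡ-≤ (1152 * w * (s * n)) (*-mono-≤ (*-monoʳ-≤ 36 (*-monoʳ-≤ s b₀≤n)) s≤w) ⟩
      36 * (s * n) * w + 1152 * w * (s * n)
        ≡⟨ collect (s * n) w ⟩
      1188 * w * (s * n)
        <⟨ *-monoˡ-< (s * n) 1188w<n ⟩
      n * (s * n)
        ≡⟨ swap n s ⟩
      s * (n * n)
        ≤⟨ *-monoʳ-≤ s n²≤4b₀² ⟩
      s * (4 * (b₀ * b₀))
        ≡⟨ regroup s b₀ ⟩
      2 * (b₀ * L)
        ≤⟨ *-monoʳ-≤ 2 (*-monoˡ-≤ L b₀≤b) ⟩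
      2 * (b * L) ∎)
      where
      open ≤-Reasoning
      instance
        sn≢0 : NonZero (s * n)
        sn≢0 = >-nonZero (s≤s z≤n)
      s≤w : s ≤ w
      s≤w = ≤-trans (n≤1+n s) s<w
      b₀≤b : b₀ ≤ b
      b₀≤b = ≤-trans (m≤m+n b₀ s) (≤-trans (n≤1+n (b₀ + s)) (≤-reflexive b≡))
      1188w<n : 1188 * w < n
      1188w<n = ≤-trans (+-monoˡ-≤ (1188 * w) 0<w) (scale 1189)
      i≤3s : i ≤ 3 * s
      i≤3s = linear (r + s′) (+-mono-≤ i<j (≤-reflexive j+r)) (certificate i j r s′)
        where
        certificate : ∀ i j r t → i + (j + 2 * suc (suc t)) + (r + t) ≡ 3 * suc t + (suc i + (j + r))
        certificate = solve-∀
      expand : ∀ s w n b₀ → 2 * (2 * (3 * (3 * s) * (30 * (w * n) + (n * w + n * w))) + 3 * (3 * s) * (2 * (s * b₀))) ≡ 36 * (s * b₀) * s + 1152 * w * (s * n)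
      expand = solve-∀
      collect : ∀ x w → 36 * x * w + 1152 * w * x ≡ 1188 * w * x
      collect = solve-∀
      swap : ∀ n s → n * (s * n) ≡ s * (n * n)
      swap = solve-∀
      regroup : ∀ s b₀ → s * (4 * (b₀ * b₀)) ≡ 2 * (b₀ * (2 * (s * b₀)))
      regroup = solve-∀

  deficit-by : ∀ s → suc (b₀ + s) ≡ b → Few s → State 0 (7 * w)
  deficit-by s b≡ (j , j+r , I) = record
    { segments = segs ; R = A ; S = S
    ; part = record
        { total = λ v → trans (rotate (mult U v) (A v) (S v)) (trans (cong (A v +_) (Interior.inside I v)) (A+B v))
        ; R≤A = λ v → ≤-refl
        ; S≤B = λ v → ≤-trans (m≤n+m (S v) (mult U v)) (≤-reflexive (Interior.inside I v)) }
    ; balance = balanced ; few = ≤-trans (Interior.few I) 3j≤7w }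
    where
    segs = Interior.segments I
    U = allVertices segs
    S = Interior.R I
    rotate : ∀ u a s → u + (a + s) ≡ a + (u + s)
    rotate = solve-∀
    sum-S : sum S + length U ≡ b
    sum-S = trans (+-comm (sum S) (length U)) (trans (cong (_+ sum S) (sym (sum-mult U))) (trans (sym sum-+) (sum-cong-≗ (Interior.inside I))))
    4b : 4 * b ≡ 3 * n + 2 * j
    4b = equate (cong₂ _+_ (cong (4 *_) (sym b≡)) (cong₂ _+_ (cong (3 *_) (sym n≡)) (cong₂ _+_ (cong (4 *_) b₀≡) (cong (2 *_) (sym j+r)))))
      (certificate b n k r b₀ s j)
      where
      certificate : ∀ b n k r b₀ s j → 4 * b + (4 * suc (b₀ + s) + (3 * n + (4 * (3 * k + r) + 2 * (j + r))))
        ≡ 3 * n + 2 * j + (4 * b + (3 * (4 * k + 2 * r) + (4 * b₀ + 2 * (2 * suc s))))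
      certificate = solve-∀
    balanced : sum S + length segs + 2 * 0 ≡ 3 * a
    balanced = equate (cong₂ _+_ sum-S (cong₂ _+_ (sym (Interior.count I)) (cong₂ _+_ (cong (3 *_) (sym a+b)) 4b)))
      (certificate (sum S) (length segs) (length U) a b n j)
      where
      certificate : ∀ S l u a b n j → S + l + 2 * 0 + (b + (u + (3 * (a + b) + (3 * n + 2 * j))))
        ≡ 3 * a + (S + u + (2 * j + l + (3 * n + 4 * b)))
      certificate = solve-∀
    3j≤7w : 3 * j ≤ 7 * w
    3j≤7w = linear (3 * r + w) (+-mono-≤ (*-monoʳ-≤ 3 (≤-reflexive j+r)) (*-monoʳ-≤ 6 (Deficit.s<w s b≡))) (certificate j r s w)
      where
      certificate : ∀ j r s w → 3 * j + (3 * (2 * suc s) + 6 * w) + (3 * r + w) ≡ 7 * w + (3 * (j + r) + 6 * suc s)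
      certificate = solve-∀

  deficit : b₀ < b → State 0 (7 * w)
  deficit b₀<b = deficit-by (b ∸ suc b₀) b≡ (few-edges (b ∸ suc b₀) b≡)
    where
    b≡ : suc (b₀ + (b ∸ suc b₀)) ≡ b
    b≡ = m+[n∸m]≡n b₀<b

  initial : State 0 (7 * w)
  initial = by-size (≤-<-connex b b₀)
    where
    by-size : b ≤ b₀ ⊎ b₀ < b → State 0 (7 * w)
    by-size (inj₁ p) = surplus p
    by-size (inj₂ p) = deficit p

  open Absorb (λ v → 1 ∸ Core v) (λ v → m∸n≤m 1 (Core v)) using (absorb)

  -- A vertex of `A` outside `Core` belongs to `W`, whichever side it had in the original partition.
  exceptional≤w : (st : State 0 (7 * w)) → sum (λ v → State.R st v * (1 ∸ Core v)) ≤ w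
  exceptional≤w st = ≤-trans (sum-mono pointwise) sum-W
    where
    pointwise : ∀ v → State.R st v * (1 ∸ Core v) ≤ W v
    pointwise v = ≤-trans (*-monoˡ-≤ (1 ∸ Core v) (Partition.R≤A (State.part st) v)) (by-bit (bit (Core≤1 v)) (A≤Core+W v))
      where
      by-bit : ∀ {t} → t ≡ 0 ⊎ t ≡ 1 → A v ≤ t + W v → A v * (1 ∸ t) ≤ W v
      by-bit (inj₁ refl) p = ≤-trans (≤-reflexive (*-identityʳ (A v))) p
      by-bit (inj₂ refl) p = ≤-trans (≤-reflexive (*-zeroʳ (A v))) z≤n

  Clean : State 0 (12 * w) → Set
  Clean st = ∀ v → State.R st v * (1 ∸ Core v) ≡ 0

  cleaned : ∃ Clean
  cleaned = absorb w initial (exceptional≤w initial) (≤-reflexive (sum-5-7 w)) (room ≤-refl)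
    where
    sum-5-7 : ∀ w → 5 * w + 7 * w ≡ 12 * w
    sum-5-7 = solve-∀

  -- `g` exceeds both missing counts, 31wn + 3n and 32wn. The choice of `h` meets two opposing
  -- demands: 33 * 250000 is at most 3000 * 3000, while 13 * 3000 = 39000 stays below 49997, the
  -- guaranteed ratio of `sum R` to `w`.
  g h : ℕ
  g = 33 * (w * n)
  h = 3000 * w

  g≤h² : g ≤ h * h
  g≤h² = begin
    33 * (w * n)                    ≤⟨ *-monoʳ-≤ 33 (*-monoʳ-≤ w upper) ⟩
    33 * (w * (250000 * w))         ≡⟨ regroup 33 250000 w ⟩
    33 * 250000 * (w * w)           ≤⟨ *-monoˡ-≤ (w * w) (≤ᵇ⇒≤ (33 * 250000) (3000 * 3000) _) ⟩
    3000 * 3000 * (w * w)           ≡⟨ regroup′ 3000 w ⟩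
    3000 * w * (3000 * w)           ∎
    where
    open ≤-Reasoning
    regroup : ∀ p q w → p * (w * (q * w)) ≡ p * q * (w * w)
    regroup = solve-∀
    regroup′ : ∀ p w → p * p * (w * w) ≡ p * w * (p * w)
    regroup′ = solve-∀

  B-missing′ : ∀ {v} → B v ≡ 1 → sum₂ (λ y z → A y * (1 ∸ e v y z)) ≤ g
  B-missing′ p = ≤-trans (B-missing p) (linear (7 * n + w * n) (*-monoˡ-≤ n 10≤w) (certificate n w))
    where
    certificate : ∀ n w → 3 * n + 30 * (w * n) + n * w + w * n + (7 * n + w * n) ≡ 33 * (w * n) + 10 * n
    certificate = solve-∀

  Core-missing′ : ∀ {v} → Core v ≡ 1 → sum₂ (λ y z → B y * (B z * (1 ∸ e v y z))) ≤ g
  Core-missing′ p = ≤-trans (Core-missing p) (linear (w * n) (≤-refl {0}) (certificate n w))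
    where
    certificate : ∀ n w → 30 * (w * n) + (n * w + n * w) + 0 + w * n ≡ 33 * (w * n) + 0
    certificate = solve-∀

  cycle : ∃ λ x → ∃ λ ps → Chain x ps x × ∀ v → mult (flat ps) v ≡ 1
  cycle = build cleaned
    where
    build : ∃ Clean → ∃ λ x → ∃ λ ps → Chain x ps x × ∀ v → mult (flat ps) v ≡ 1
    build (st , clean) = Finish.Assemble.cycle e e≤1 e-swap₁₂ e-swap₂₃ A B Core A+B g h B-missing′ Core-missing′ g≤h² 0<h
      segs R S (Partition.total part) (Partition.R≤A part) (Partition.S≤B part) core (sum R) (length segs) refl refl
      (trans (sym (+-identityʳ _)) (State.balance st)) P≤K 13h<K
      where
      open State st using (R; S; part) renaming (segments to segs)
      core : ∀ v → R v ≡ 1 → Core v ≡ 1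
      core v p = ≤-antisym (Core≤1 v) (m∸n≡0⇒m≤n (trans (sym (*-identityˡ _)) (trans (cong (_* (1 ∸ Core v)) (sym p)) (clean v))))
      0<h : 0 < h
      0<h = ≤-trans 0<w (m≤m+n w _)
      n≤ : n ≤ 12 * w + 4 * sum R
      -- By the balance `sum S` is at most `3 * sum R`, so all but the used vertices number at most
      -- `4 * sum R`.
      n≤ = linear (length segs) (+-mono-≤ (≤-reflexive (sym (Partition.size part))) (+-mono-≤ (State.few st) (≤-reflexive (State.balance st))))
        (certificate n w (length (allVertices segs)) (sum R) (sum S) (length segs))
        where
        certificate : ∀ n w u R S l → n + (u + (R + S) + (12 * w + 3 * R)) + l ≡ 12 * w + 4 * R + (n + (u + (S + l + 2 * 0)))
        certificate = solve-∀
      P≤K : length segs ≤ sum R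
      P≤K = *-cancelˡ-≤ 4 (linear 0 (+-mono-≤ (*-monoʳ-≤ 4 (≤-trans (length≤ segs) (State.few st))) (+-mono-≤ (scale 60) n≤))
        (certificate n w (sum R) (length segs)))
        where
        certificate : ∀ n w R l → 4 * l + (4 * (12 * w) + (n + (12 * w + 4 * R))) + 0 ≡ 4 * R + (4 * l + (60 * w + n))
        certificate = solve-∀
      13h<K : 13 * h < sum R
      13h<K = *-cancelˡ-< 4 _ _ (linear 0 (+-mono-≤ 0<w (+-mono-≤ (scale 156013) n≤)) (certificate n w (sum R)))
        where
        certificate : ∀ n w R → suc (4 * (13 * (3000 * w))) + (w + (n + (12 * w + 4 * R))) + 0 ≡ 4 * R + (1 + (156013 * w + n))
        certificate = solve-∀

-- The choice of constants

module Residue (n k r : ℕ) (n≡ : n ≡ 4 * k + 2 * r) where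

  three-quarters : r ≤ 1 → (3 * n) / 4 ≡ 3 * k + r
  three-quarters r≤1 = begin
    (3 * n) / 4                             ≡⟨ cong (_/ 4) (trans (cong (3 *_) n≡) (regroup k r)) ⟩
    (2 * r + (3 * k + r) * 4) / 4           ≡⟨ +-distrib-/-∣ʳ (2 * r) (divides (3 * k + r) refl) ⟩
    (2 * r) / 4 + (3 * k + r) * 4 / 4       ≡⟨ cong₂ _+_ (m<n⇒m/n≡0 (≤-trans (s≤s (*-monoʳ-≤ 2 r≤1)) (s≤s (s≤s (s≤s z≤n))))) (m*n/n≡m (3 * k + r) 4) ⟩
    3 * k + r                               ∎
    where
    open ≡-Reasoning
    regroup : ∀ k r → 3 * (4 * k + 2 * r) ≡ 2 * r + (3 * k + r) * 4
    regroup = solve-∀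

  n%4 : n % 4 ≡ (2 * r) % 4
  n%4 = trans (cong (_% 4) (trans n≡ (regroup k r))) ([m+kn]%n≡m%n (2 * r) k 4)
    where
    regroup : ∀ k r → 4 * k + 2 * r ≡ 2 * r + k * 4
    regroup = solve-∀

  cConst-residue : r ≡ 0 ⊎ r ≡ 1 → cConst n + r ≡ 2
  cConst-residue (inj₁ refl) = trans (+-identityʳ _) (c≡2 n%4)
    where
    c≡2 : n % 4 ≡ 0 → cConst n ≡ 2
    c≡2 eq rewrite eq = refl
  cConst-residue (inj₂ refl) = cong (_+ 1) (c≡1 n%4)
    where
    c≡1 : n % 4 ≡ 2 → cConst n ≡ 1
    c≡1 eq rewrite eq = refl

-- κ bounds n / w; then β = 1 / (54 κ²) makes e(B) ≤ β n³ give 54 e(B) ≤ w² n.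
extremal⇒few : ∀ κ .{{_ : NonZero (κ * κ)}} {n w E} → n ≤ κ * w → 54 * (κ * κ) * E ≤ 1 * (n * n * n) → 54 * E ≤ w * w * n
extremal⇒few κ {n} {w} {E} n≤ few = *-cancelˡ-≤ (κ * κ) (begin
  κ * κ * (54 * E)          ≡⟨ regroup κ E ⟩
  54 * (κ * κ) * E          ≤⟨ few ⟩
  1 * (n * n * n)           ≡⟨ *-identityˡ _ ⟩
  n * n * n                 ≤⟨ *-monoˡ-≤ n (*-mono-≤ n≤ n≤) ⟩
  κ * w * (κ * w) * n       ≡⟨ regroup′ κ w n ⟩
  κ * κ * (w * w * n)       ∎)
  where
  open ≤-Reasoning
  regroup : ∀ κ E → κ * κ * (54 * E) ≡ 54 * (κ * κ) * E
  regroup = solve-∀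
  regroup′ : ∀ κ w n → κ * w * (κ * w) * n ≡ κ * κ * (w * w * n)
  regroup′ = solve-∀

module Large (N : ℕ) (large : 50000 * 200000 < suc N) where

  n w : ℕ
  n = suc N
  w = n / 200000

  50000≤w : 50000 ≤ w
  50000≤w = ≤-trans (≤-reflexive (sym (m*n/n≡m 50000 200000))) (/-monoˡ-≤ 200000 (<⇒≤ large))

  lower : 200000 * w ≤ n
  lower = ≤-trans (≤-reflexive (*-comm 200000 w)) (m/n*n≤m n 200000)

  upper : n ≤ 250000 * w
  -- The remainder modulo 200000 is absorbed by `50000 * w`.
  upper = linear 0 (+-mono-≤ (≤-reflexive (m≡m%n+[m/n]*n n 200000)) (+-mono-≤ (<⇒≤ (m%n<n n 200000)) (*-monoʳ-≤ 50000 4≤w)))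
    (certificate n w (n % 200000))
    where
    4≤w : 4 ≤ w
    4≤w = ≤-trans (≤ᵇ⇒≤ 4 50000 _) 50000≤w
    certificate : ∀ n w r → n + (r + w * 200000 + (200000 + 50000 * w)) + 0 ≡ 250000 * w + (n + (r + 50000 * 4))
    certificate = solve-∀

  10≤w : 10 ≤ w
  10≤w = ≤-trans (≤ᵇ⇒≤ 10 50000 _) 50000≤w

  -- This term is the lower-order loss `3 * n` of `A₀-missing`, summed over all vertices. Bounding
  -- it by a multiple of `w * w * n` requires `50000 ≤ w` and thereby determines n₂.
  3n²≤15w²n : n * (3 * n) ≤ 15 * (w * (w * n))
  3n²≤15w²n = begin
    n * (3 * n)               ≤⟨ *-monoʳ-≤ n (*-monoʳ-≤ 3 upper) ⟩
    n * (3 * (250000 * w))    ≡⟨ regroup n 250000 w ⟩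
    3 * 250000 * (w * n)      ≡⟨ cong (_* (w * n)) {3 * 250000} {15 * 50000} refl ⟩
    15 * 50000 * (w * n)      ≡⟨ *-assoc 15 50000 (w * n) ⟩
    15 * (50000 * (w * n))    ≤⟨ *-monoʳ-≤ 15 (*-monoˡ-≤ (w * n) 50000≤w) ⟩
    15 * (w * (w * n))        ∎
    where
    open ≤-Reasoning
    regroup : ∀ n κ w → n * (3 * (κ * w)) ≡ 3 * κ * (w * n)
    regroup = solve-∀

  -- The factor 54 in β is 2 * 27: each edge gives at most 27 ordered triples, and their number
  -- enters the bound for the misplaced vertices twice.
  few⇒small : ∀ {E} → 54 * E ≤ w * w * n → n * (3 * n) + 2 * (27 * E) < suc w * (30 * (w * n))
  few⇒small {E} few = linear (14 * (w * w * n) + 29 * (w * n)) (+-mono-≤ few (+-mono-≤ 3n²≤15w²n 0<wn))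
    (certificate n w E (n * (3 * n)))
    where
    0<wn : 0 < w * n
    0<wn = *-mono-≤ (≤-trans (s≤s z≤n) 10≤w) (s≤s z≤n)
    certificate : ∀ n w E p → suc (p + 2 * (27 * E)) + (w * w * n + (15 * (w * (w * n)) + w * n)) + (14 * (w * w * n) + 29 * (w * n))
      ≡ suc w * (30 * (w * n)) + (54 * E + (p + 1))
    certificate = solve-∀

loose-hamilton : ∀ n → 50000 * 200000 < n → 2 ∣ n → (H : Hypergraph3 n) → MinDegreeAtLeast H (threshold n) →
  Extremal 1 (54 * (250000 * 250000)) H → LooseHamiltonCycle H
loose-hamilton (suc N) large (divides m n≡m*2) H deg (B , |B| , few) = finish (Main.cycle N k r (cConst n) b₀ w (27 * edgesIn H B)
    e e≤1 e-swap₁₂ e-swap₂₃ e-diag (χ B) (χ≤1 B) (trans (sum-χ B) |B|) n≡ (three-quarters r≤1) r≤1 (cConst-residue (bit r≤1))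
    (min-degree N refl b₀ refl deg) triples (few⇒small {edgesIn H B} (extremal⇒few 250000 {n} {w} {edgesIn H B} upper few)) lower upper 10≤w)
  where
  open Large N large
  open Degrees H
  k r b₀ : ℕ
  -- As `n` is twice `m`, the parity `r` of `m` distinguishes the two cases of `c`.
  k = m / 2
  r = m % 2
  b₀ = (3 * n) / 4
  r≤1 : r ≤ 1
  r≤1 = ≤-pred (m%n<n m 2)
  n≡ : n ≡ 4 * k + 2 * r
  n≡ = trans n≡m*2 (trans (cong (_* 2) (m≡m%n+[m/n]*n m 2)) (regroup k r))
    where
    regroup : ∀ k r → (r + k * 2) * 2 ≡ 4 * k + 2 * r
    regroup = solve-∀
  open Residue n k r n≡
  triples : sum (λ v → χ B v * sum₂ (λ y z → χ B y * (χ B z * e v y z))) ≤ 27 * edgesIn H B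
  triples = ≤-trans (≤-reflexive (sum-cong-≗ λ v → sym (sum₂-*ˡ (χ B v) _))) (edgesIn-triples B)
  finish : ∀ {Bs} → (∃ λ x → ∃ λ ps → Segments.Chain e Bs x ps x × ∀ v → mult (Segments.flat e Bs ps) v ≡ 1) → LooseHamiltonCycle H
  finish {Bs} (x , ps , c , once) = Cycle.hamilton H Bs _ x ps c once

theorem1p5 : Σ ℕ λ p → Σ ℕ λ q → (0 < p) × (0 < q) × Σ ℕ λ n₂ →
    ∀ (n : ℕ) → n₂ < n → 2 ∣ n →
    (H : Hypergraph3 n) → MinDegreeAtLeast H (threshold n) →
    Extremal p q H → LooseHamiltonCycle H
theorem1p5 = 1 , 54 * (250000 * 250000) , s≤s z≤n , s≤s z≤n , 50000 * 200000 , loose-hamilton
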